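{- For every $2$-coloring of the edges of $K_{\mathbb{N}}$ there exists a monochromatic path $P$ with $\bar{d}_s(P)\geq 2/3$.
   Context: $K_{\mathbb{N}}$ is the complete graph on the positive integers $\mathbb{N}$. A $2$-coloring is a partition of the edge set into two color classes. A path in $K_{\mathbb{N}}$ is an infinite sequence $(a_1,a_2,\dots)$ of distinct positive integers with edges $a_na_{n+1}$; it is monochromatic if all these edges have the same color. For an infinite sequence $A=(a_1,a_2,\dots)$ of distinct positive integers let $f(n)=\sup\{m : \{a_1,\dots,a_m\}\subseteq\{1,\dots,n\}\}$; the strong upper density of $A$ is $\bar{d}_s(A)=\limsup_{n\to\infty} f(n)/n$. The strong upper density of a path is that of its vertex sequence $(a_1,a_2,\dots)$. -}

module Defs where

open import Data.Nat using (ℕ; zero; suc; _+_; _*_; _≤_; _<_)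
open import Data.Bool using (Bool)
open import Data.Product using (Σ; ∃; _×_)
open import Relation.Binary.PropositionalEquality using (_≡_; _≢_)
open import Function.Definitions using (Injective)

-- A 2-colouring of the edges of K_ℕ (vertices = positive integers).
-- An edge {x,y} (x ≠ y, x,y ≥ 1) gets colour c x y; colourings of
-- unordered pairs are the symmetric ones.  Values at 0 / on the
-- diagonal are irrelevant.
record Colouring : Set where
  field
    col  : ℕ → ℕ → Bool
    symm : ∀ x y → col x y ≡ col y x
open Colouring public

-- An infinite sequence (a₁, a₂, …) is represented as a : ℕ → ℕ with
-- a 0 = a₁, a 1 = a₂, …
-- A path: distinct positive integers.
IsPath : (ℕ → ℕ) → Set
IsPath a = Injective _≡_ _≡_ a × (∀ i → 1 ≤ a i)

IsMonoPath : Colouring → Bool → (ℕ → ℕ) → Set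
IsMonoPath c b a = IsPath a × (∀ i → col c (a i) (a (suc i)) ≡ b)

-- {a₁,…,a_m} ⊆ {1,…,n}   (positivity is part of IsPath)
PrefixWithin : (ℕ → ℕ) → ℕ → ℕ → Set
PrefixWithin a n m = ∀ i → i < m → a i ≤ n

-- f(n) = sup{ m : {a₁,…,a_m} ⊆ {1,…,n} }.  Since this set is
-- downward closed, "f(n) ≥ m" ⇔ PrefixWithin a n m.
-- Strong upper density ≥ p/q  (q ≥ 1), i.e. limsup f(n)/n ≥ p/q, i.e.
-- for every k ≥ 1 there are infinitely many n with f(n)/n > p/q − 1/k,
-- i.e.  q·k·f(n) + q·n > p·k·n.
StrongUpperDensity≥ : (ℕ → ℕ) → ℕ → ℕ → Set
StrongUpperDensity≥ a p q =
  ∀ k → 1 ≤ k → ∀ N → Σ ℕ λ n → N ≤ n × Σ ℕ λ m →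
    PrefixWithin a n m × p * k * n < q * k * m + q * n

{-# OPTIONS --safe #-}
-- Suppose that in neither colour every finite path can be prolonged so as to fill nearly two thirds of some [1,t].
-- For one colour X this forces the other colour Y to be highly connected: a set without Y-edges to its complement in
-- [1,t] spans with the complement a complete bipartite X-graph, so it must be smaller than t/3 or larger than 2t/3,
-- and this also holds after the deletion of few vertices.  As sizes change by at most one when t grows by one,
-- large closed sets stay large, and hence both colours have giant components at all scales which are joined to the
-- given finite paths and to one another by short paths.
-- At a suitable t take, in each colour, the longest path in [1,t] that extends the given one and can leave to the giant
-- component beyond t.  If the longer of the two, of colour X, has fewer than 2t/3 vertices, it yields connectors for Y:
-- by maximality every vertex u off the path is Y-joined to b or b′ whenever b, b′ are consecutive on it, so of any three
-- ends of Y-paths two can be linked through b or b′.  This produces a Y-path almost as long as the X-path; a linear gain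
-- comes from Y-edges off the path or, when there are few, from X-cliques of four vertices, which can be threaded by a
-- Y-path through two of any three consecutive vertices of the X-path.  So the Y-path is longer, a contradiction.
-- If both longest paths are very short, a Gerencsér–Gyárfás partition of the rest into two monochromatic paths replaces this.
module Submission where

open import Defs
open import Data.Nat
open import Data.Nat.Properties
open import Data.Nat.Tactic.RingSolver using (solve)
open import Algebra.Properties.CommutativeSemigroup +-commutativeSemigroup using (interchange)
open import Data.Bool using (Bool; true; false; not)
open import Data.List using (List; []; _∷_; _++_; length)
open import Data.List.Properties using (length-++; ++-assoc)
open import Data.List.Membership.Propositional using (_∈_; _∉_)
open import Data.List.Membership.Propositional.Properties using (∈-++⁺ˡ; ∈-++⁺ʳ; ∈-++⁻)
open import Data.List.Relation.Unary.Any using (here; there)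
open import Data.Product as Product using (Σ; ∃; _×_; _,_; proj₁; proj₂; uncurry)
open import Data.Sum as Sum using (_⊎_; inj₁; inj₂; [_,_]′)
open import Data.Empty using (⊥; ⊥-elim)
open import Relation.Nullary using (Dec; yes; no; ¬_)
open import Relation.Binary.PropositionalEquality
  using (_≡_; _≢_; refl; sym; trans; cong; cong₂; subst; subst₂)
open import Axiom.ExcludedMiddle using (ExcludedMiddle)
open import Level using (0ℓ)

-- The obstacle is that every connection costs vertices, whereas a longest path might miss two
-- thirds of [1,t] only by a sliver. A choice of scales settles this. If neither colour comes within
-- 1/k of density 2/3, one takes t = (80k + 1)r with r above everything fixed before; failure then
-- leaves each admissible path at least 80r vertices below 2t/3. Connections are found level by
-- level: as long as the target is not met, a new level separates, so it has more than s = 80k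
-- vertices or contains one of fewer than r protected ones, and fewer than 2r levels fit into [1,t].
-- Connections thus cost a few r, and the shortfall leaves room off the path for 26r groups of four
-- vertices that repay this cost.
--
-- Longest paths are compared only among those that come with a detour to the giant component beyond
-- t. The detour does not count towards the length. It makes sure that a dense prefix found at time
-- t can be prolonged again, so that the finite paths fit together to one infinite path.

-- A certificate of a ≤ b: a combination L ≤ R of the hypotheses with a + R + d = b + L.
lin : ∀ {a b L R} d → L ≤ R → a + R + d ≡ b + L → a ≤ b
lin {a} {b} {L} {R} d h e =
  +-cancelʳ-≤ R a b (≤-trans (m≤m+n (a + R) d) (≤-trans (≤-reflexive e) (+-monoʳ-≤ b h)))

lin* : ∀ g {a b L R} d → L ≤ R → suc g * a + R + d ≡ suc g * b + L → a ≤ b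
lin* g d h e = *-cancelˡ-≤ (suc g) (lin d h e)

lin-⊥ : ∀ {L R} d → L ≤ R → suc (R + d) ≡ L → ⊥
lin-⊥ {L} {R} d h e = 1+n≰n (≤-trans (s≤s (m≤m+n R d)) (≤-trans (≤-reflexive e) h))

infixl 6 _⊞_
infixl 7 _⊡_

_⊞_ : ∀ {a b x y} → a ≤ b → x ≤ y → a + x ≤ b + y
_⊞_ = +-mono-≤

_⊡_ : ∀ n {x y} → x ≤ y → n * x ≤ n * y
n ⊡ h = *-monoʳ-≤ n h

-- Numerical inequalities behind the counting steps

stage-growth : ∀ i l n m → i + 3 * l + 3 ≤ n → 2 * (i + 3) * n < 3 * (i + 3) * m + 3 * n →
    (i + 3) * (1 + m) ≤ (i + 3) * (1 + l) → i * (i + 3 * l + 3) ≤ i * n → ⊥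
stage-growth i l n m h0 h1 h2 h3 = lin-⊥ (9 + 6 * i + i * i + i * n) (3 ⊡ h0 ⊞ h1 ⊞ 3 ⊡ h2 ⊞ h3) (solve (i ∷ l ∷ n ∷ m ∷ []))

density-monotone : ∀ k d n m → 2 * (k + d) * n < 3 * (k + d) * m + 3 * n → 3 * k * m + 3 * n ≤ 2 * k * n →
    d * (3 * m) ≤ d * (2 * n) → ⊥
density-monotone k d n m h0 h1 h2 = lin-⊥ 0 (h0 ⊞ h1 ⊞ h2) (solve (k ∷ d ∷ n ∷ m ∷ []))

density-cancel : ∀ k n m → 3 * k * m + 3 * n ≤ 2 * k * n → k * (3 * m) ≤ k * (2 * n)
density-cancel k n m h0 = lin (3 * n) h0 (solve (k ∷ n ∷ m ∷ []))

bipartite-long : ∀ k t j p f m → k * t ≤ k * (3 * j + 3 * p + 6 + f) → k * (3 * p + 12 + 2 * f) < t →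
    k * (2 * j + p) ≤ k * m → 2 * k * t < 3 * k * m + 3 * t
bipartite-long k t j p f m h0 h1 h2 = lin (2 * t) (2 ⊡ h0 ⊞ h1 ⊞ 3 ⊡ h2) (solve (k ∷ t ∷ j ∷ p ∷ f ∷ m ∷ []))

bipartite-side : ∀ t d l p f → t ≤ 3 * d + f → d ≤ l + (2 + p) → t ≤ 3 * l + 3 * p + 6 + f
bipartite-side t d l p f h0 h1 = lin 0 (h0 ⊞ 3 ⊡ h1) (solve (t ∷ d ∷ l ∷ p ∷ f ∷ []))

bipartite-nonempty : ∀ t p f j → t ≤ 3 * j + 3 * p + 6 + f → 3 * p + f + 10 ≤ t → 1 ≤ j
bipartite-nonempty t p f j h0 h1 = lin* 2 1 (h0 ⊞ h1) (solve (t ∷ p ∷ f ∷ j ∷ []))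

few-below : ∀ g f x t → x ≤ g → 3 * g + f + 1 ≤ t → 3 * x + f < t
few-below g f x t h0 h1 = lin 0 (3 ⊡ h0 ⊞ h1) (solve (g ∷ f ∷ x ∷ t ∷ []))

zigzag-length : ∀ x l → 2 + 2 * x ≤ l → 2 + 2 * (1 + x) ≤ l + 2
zigzag-length x l h0 = lin 0 h0 (solve (x ∷ l ∷ []))

zigzag-count : ∀ l z y xs ys x v → l ≤ z + (y + (xs + ys)) → l + (x + (v + 0)) ≤ z + (v + (x + (xs + (y + ys))))
zigzag-count l z y xs ys x v h0 = lin 0 h0 (solve (l ∷ z ∷ y ∷ xs ∷ ys ∷ x ∷ v ∷ []))

same-side-count : ∀ l v z y xt yt xs ys → l ≤ z + (y + (xt + yt)) → xt ≤ xs → yt ≤ ys → l + (v + 0) ≤ z + (v + (xs + (y + ys)))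
same-side-count l v z y xt yt xs ys h0 h1 h2 = lin 0 (h0 ⊞ h1 ⊞ h2) (solve (l ∷ v ∷ z ∷ y ∷ xt ∷ yt ∷ xs ∷ ys ∷ []))

same-side-length : ∀ j x l m → j ≤ x → 2 + 2 * x ≤ l → l + 1 ≤ m → 2 * (1 + j) ≤ m
same-side-length j x l m h0 h1 h2 = lin 1 (2 ⊡ h0 ⊞ h1 ⊞ h2) (solve (j ∷ x ∷ l ∷ m ∷ []))

cover-big : ∀ t d o f s → t ≤ d + (o + (f + s)) → 3 * o + f < t → 2 * t < 3 * d + 2 * f + 3 * s
cover-big t d o f s h0 h1 = lin 0 (3 ⊡ h0 ⊞ h1) (solve (t ∷ d ∷ o ∷ f ∷ s ∷ []))

big-absurd : ∀ t d f s → 2 * t < 3 * d + 2 * f + 3 * s → 2 * f + 3 * s ≤ t → 3 * d < t → ⊥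
big-absurd t d f s h0 h1 h2 = lin-⊥ 1 (h0 ⊞ h1 ⊞ h2) (solve (t ∷ d ∷ f ∷ s ∷ []))

persist-step : ∀ t d e f s → 2 * t < 3 * d + 2 * f + 3 * s → 2 * f + 3 * s ≤ t → d ≤ e → 1 + t ≤ 3 * e
persist-step t d e f s h0 h1 h2 = lin 0 (h0 ⊞ h1 ⊞ 3 ⊡ h2) (solve (t ∷ d ∷ e ∷ f ∷ s ∷ []))

union-small : ∀ t u a b f → 2 * t < 3 * u + 2 * f → u ≤ a + b → 3 * a + f < t → 3 * b + f < t → ⊥
union-small t u a b f h0 h1 h2 h3 = lin-⊥ 2 (h0 ⊞ 3 ⊡ h1 ⊞ h2 ⊞ h3) (solve (t ∷ u ∷ a ∷ b ∷ f ∷ []))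

hit-K-size : ∀ T t d e f s → 2 * T < 3 * d + 2 * f + 3 * s → d ≤ t + e → 3 * e < T → 3 * t + 2 * f + 3 * s ≤ T → ⊥
hit-K-size T t d e f s h0 h1 h2 h3 = lin-⊥ 1 (h0 ⊞ 3 ⊡ h1 ⊞ h2 ⊞ h3) (solve (T ∷ t ∷ d ∷ e ∷ f ∷ s ∷ []))

component-minus-vertex : ∀ T a b f → 2 * T < 3 * a + 2 * f → a ≤ 1 + b → 2 * f + 3 ≤ T → T ≤ 3 * b
component-minus-vertex T a b f h0 h1 h2 = lin 1 (h0 ⊞ 3 ⊡ h1 ⊞ h2) (solve (T ∷ a ∷ b ∷ f ∷ []))

late-large : ∀ t n → 2 * t < n + (20 * t + 20)
late-large t n = lin (19 + n + 18 * t) (z≤n {0}) (solve (t ∷ n ∷ []))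

layer-protected : ∀ sj s1 p q r v → sj ≤ p + r → p ≤ q → r + s1 ≤ v → s1 + sj ≤ q + v
layer-protected sj s1 p q r v h0 h1 h2 = lin 0 (h0 ⊞ h1 ⊞ h2) (solve (sj ∷ s1 ∷ p ∷ q ∷ r ∷ v ∷ []))

layer-large : ∀ sj s p q r v l → sj ≤ p + r → p + l ≤ q → r ≤ v → s < l → (1 + s) + sj ≤ q + v
layer-large sj s p q r v l h0 h1 h2 h3 = lin 0 (h0 ⊞ h1 ⊞ h2 ⊞ h3) (solve (sj ∷ s ∷ p ∷ q ∷ r ∷ v ∷ l ∷ []))

entry-size : ∀ t d u c → 2 * t < 3 * d + c → d + u ≤ t → t + c ≤ 3 * u → ⊥
entry-size t d u c h0 h1 h2 = lin-⊥ 0 (h0 ⊞ 3 ⊡ h1 ⊞ h2) (solve (t ∷ d ∷ u ∷ c ∷ []))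

exit-late : ∀ t m s L → 2 * m + 3 * (s + 4) ≤ t → 20 * t ≤ L → 3 * t + 2 * m + 3 * (s + 4) ≤ L
exit-late t m s L h0 h1 = lin (16 * t) (h0 ⊞ h1) (solve (t ∷ m ∷ s ∷ L ∷ []))

base-late : ∀ t m p s L → 2 * p + 3 * s ≤ m → m ≤ t → 20 * t ≤ L → 3 * t + 2 * p + 3 * s ≤ L
base-late t m p s L h0 h1 h2 = lin (16 * t) (h0 ⊞ h1 ⊞ h2) (solve (t ∷ m ∷ p ∷ s ∷ L ∷ []))

merge-count₁ : ∀ c w f p q u k x → c + ((w + f) + ((p + (q + x)) + u)) ≤ 1 → k ≤ w → (p + (k + c)) + (f + ((q + x) + u)) ≤ 1
merge-count₁ c w f p q u k x h0 h1 = lin 0 (h0 ⊞ h1) (solve (c ∷ w ∷ f ∷ p ∷ q ∷ u ∷ k ∷ x ∷ []))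

merge-count₂ : ∀ L p k c f q x w → L ≤ (p + (k + c)) + (f + (q + x)) → k ≤ w → L ≤ c + ((w + f) + (p + (q + x)))
merge-count₂ L p k c f q x w h0 h1 = lin 0 (h0 ⊞ h1) (solve (L ∷ p ∷ k ∷ c ∷ f ∷ q ∷ x ∷ w ∷ []))

merge-count₃ : ∀ c w f p q u k x → c + ((w + f) + ((p + (q + x)) + u)) ≤ 1 → k ≤ w → (q + (k + c)) + (f + ((p + x) + u)) ≤ 1
merge-count₃ c w f p q u k x h0 h1 = lin 0 (h0 ⊞ h1) (solve (c ∷ w ∷ f ∷ p ∷ q ∷ u ∷ k ∷ x ∷ []))

merge-count₄ : ∀ L p k c f q x w → L ≤ (q + (k + c)) + (f + (p + x)) → k ≤ w → L ≤ c + ((w + f) + (p + (q + x)))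
merge-count₄ L p k c f q x w h0 h1 = lin 0 (h0 ⊞ h1) (solve (L ∷ p ∷ k ∷ c ∷ f ∷ q ∷ x ∷ w ∷ []))

merge-count₅ : ∀ c w f p q u k x → c + ((w + f) + ((p + (q + x)) + u)) ≤ 1 → k ≤ w → c + (f + (((p + (k + q)) + x) + u)) ≤ 1
merge-count₅ c w f p q u k x h0 h1 = lin 0 (h0 ⊞ h1) (solve (c ∷ w ∷ f ∷ p ∷ q ∷ u ∷ k ∷ x ∷ []))

merge-count₆ : ∀ L p k c f q x w → L ≤ c + (f + ((p + (k + q)) + x)) → k ≤ w → L ≤ c + ((w + f) + (p + (q + x)))
merge-count₆ L p k c f q x w h0 h1 = lin 0 (h0 ⊞ h1) (solve (L ∷ p ∷ k ∷ c ∷ f ∷ q ∷ x ∷ w ∷ []))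

merge-length₁ : ∀ L p c q x n → (p + (1 + c)) + (q + x) + n ≤ L → c + (p + (q + x)) + (1 + n) ≤ L
merge-length₁ L p c q x n h0 = lin 0 h0 (solve (L ∷ p ∷ c ∷ q ∷ x ∷ n ∷ []))

merge-length₂ : ∀ L p c q x n → (q + (1 + c)) + (p + x) + n ≤ L → c + (p + (q + x)) + (1 + n) ≤ L
merge-length₂ L p c q x n h0 = lin 0 h0 (solve (L ∷ p ∷ c ∷ q ∷ x ∷ n ∷ []))

merge-length₃ : ∀ L p c q x n → c + ((p + (1 + q)) + x) + n ≤ L → c + (p + (q + x)) + (1 + n) ≤ L
merge-length₃ L p c q x n h0 = lin 0 h0 (solve (L ∷ p ∷ c ∷ q ∷ x ∷ n ∷ []))

disjoint-front : ∀ c w p u → c + (w + (p + u)) ≤ 1 → 1 ≤ c → 1 ≤ p → ⊥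
disjoint-front c w p u h0 h1 h2 = lin-⊥ (u + w) (h0 ⊞ h1 ⊞ h2) (solve (c ∷ w ∷ p ∷ u ∷ []))

disjoint-back : ∀ c w p u → c + (w + (p + u)) ≤ 1 → 1 ≤ p → 1 ≤ u → ⊥
disjoint-back c w p u h0 h1 h2 = lin-⊥ (c + w) (h0 ⊞ h1 ⊞ h2) (solve (c ∷ w ∷ p ∷ u ∷ []))

close-count₁ : ∀ p c w v z k l → k ≤ w → l ≤ v → l + (p + (k + c)) ≤ c + ((w + (v + z)) + (p + 0))
close-count₁ p c w v z k l h0 h1 = lin z (h0 ⊞ h1) (solve (p ∷ c ∷ w ∷ v ∷ z ∷ k ∷ l ∷ []))

close-count₂ : ∀ p c w v z k l → k ≤ w → (p + (k + c)) ≤ c + ((w + (v + z)) + (p + 0))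
close-count₂ p c w v z k l h0 = lin (v + z) h0 (solve (p ∷ c ∷ w ∷ v ∷ z ∷ k ∷ l ∷ []))

close-length : ∀ p c L → p + c ≤ L → c + (p + 0) + 0 ≤ L
close-length p c L h0 = lin 0 h0 (solve (p ∷ c ∷ L ∷ []))

two-paths-count₁ : ∀ u x xs y ys us → (x + xs) + (y + ys) ≤ us → (u + (y + (x + xs))) + ys ≤ u + us
two-paths-count₁ u x xs y ys us h0 = lin 0 h0 (solve (u ∷ x ∷ xs ∷ y ∷ ys ∷ us ∷ []))

two-paths-count₂ : ∀ u x xs y ys us → (x + xs) + (y + ys) ≤ us → xs + (u + (x + (y + ys))) ≤ u + us
two-paths-count₂ u x xs y ys us h0 = lin 0 h0 (solve (u ∷ x ∷ xs ∷ y ∷ ys ∷ us ∷ []))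

two-paths-count₃ : ∀ u xs ys us → xs + ys ≤ us → xs + (u + ys) ≤ u + us
two-paths-count₃ u xs ys us h0 = lin 0 h0 (solve (u ∷ xs ∷ ys ∷ us ∷ []))

two-paths-length₁ : ∀ x y us → us ≤ (1 + x) + (1 + y) → 1 + us ≤ (1 + (1 + (1 + x))) + y
two-paths-length₁ x y us h0 = lin 0 h0 (solve (x ∷ y ∷ us ∷ []))

two-paths-length₂ : ∀ x y us → us ≤ (1 + x) + (1 + y) → 1 + us ≤ x + (1 + (1 + (1 + y)))
two-paths-length₂ x y us h0 = lin 0 h0 (solve (x ∷ y ∷ us ∷ []))

two-paths-length₃ : ∀ x y us → us ≤ x + y → 1 + us ≤ x + (1 + y)
two-paths-length₃ x y us h0 = lin 0 h0 (solve (x ∷ y ∷ us ∷ []))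

blocks-hit : ∀ r n h k → r ≤ 6 * n + 6 * h + 5 → 1 ≤ k → 6 + r ≤ 6 * n + 6 * (k + h) + 5
blocks-hit r n h k h0 h1 = lin 0 (h0 ⊞ 6 ⊡ h1) (solve (r ∷ n ∷ h ∷ k ∷ []))

blocks-free : ∀ r n h k → r ≤ 6 * n + 6 * h + 5 → 6 + r ≤ 6 * (1 + n) + 6 * (k + h) + 5
blocks-free r n h k h0 = lin (6 * k) h0 (solve (r ∷ n ∷ h ∷ k ∷ []))

sort-pair : ∀ p f q r us v → f + (q + r) ≤ us → p ≤ v → (p + f) + (q + r) ≤ v + us
sort-pair p f q r us v h0 h1 = lin 0 (h0 ⊞ h1) (solve (p ∷ f ∷ q ∷ r ∷ us ∷ v ∷ []))

sort-quad : ∀ f q r us v → f + (q + r) ≤ us → f + ((v + q) + r) ≤ v + us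
sort-quad f q r us v h0 = lin 0 h0 (solve (f ∷ q ∷ r ∷ us ∷ v ∷ []))

five-count : ∀ x y z k l f t → x + (y + (z + 0)) ≤ f → k + (l + 0) ≤ t → x + (k + (y + (l + (z + 0)))) ≤ f + t
five-count x y z k l f t h0 h1 = lin 0 (h0 ⊞ h1) (solve (x ∷ y ∷ z ∷ k ∷ l ∷ f ∷ t ∷ []))

exchange-count : ∀ z p b w m n o q x → m + (z + ((p + (b + (w + (n + o)))) + q)) ≤ x → z + ((p + (b + (m + (n + o)))) + q) ≤ x
exchange-count z p b w m n o q x h0 = lin w h0 (solve (z ∷ p ∷ b ∷ w ∷ m ∷ n ∷ o ∷ q ∷ x ∷ []))

exchange-length : ∀ p m n o → m < n → 1 + (p + (1 + (m + (1 + o)))) ≤ p + (1 + (n + (1 + o)))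
exchange-length p m n o h0 = lin 0 h0 (solve (p ∷ m ∷ n ∷ o ∷ []))

fives-count : ∀ x y z f g h b d e → x ≤ f + b → y ≤ g + d → z ≤ h + e → x + (y + z) ≤ (f + (g + h)) + ((b + d) + e)
fives-count x y z f g h b d e h0 h1 h2 = lin 0 (h0 ⊞ h1 ⊞ h2) (solve (x ∷ y ∷ z ∷ f ∷ g ∷ h ∷ b ∷ d ∷ e ∷ []))

assemble-count₁ : ∀ c w f u z p → c + (w + (f + (z + p))) ≤ 1 → u ≤ z → c + (w + (f + u)) ≤ 1
assemble-count₁ c w f u z p h0 h1 = lin p (h0 ⊞ h1) (solve (c ∷ w ∷ f ∷ u ∷ z ∷ p ∷ []))

assemble-count₂ : ∀ l c w f z p → c + (w + (f + (z + p))) ≤ 1 → l ≤ c + (w + f) → z + (l + p) ≤ 1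
assemble-count₂ l c w f z p h0 h1 = lin 0 (h0 ⊞ h1) (solve (l ∷ c ∷ w ∷ f ∷ z ∷ p ∷ []))

room-left : ∀ t u T r m p c → t ≤ u + (T + ((2 * r + (m + p)) + 4)) → T ≤ r → p ≤ r → 3 * m + 240 * r ≤ 2 * t → 12 ≤ r →
    c ≤ r → t + c ≤ 3 * u
room-left t u T r m p c h0 h1 h2 h3 h4 h5 = lin (226 * r) (3 ⊡ h0 ⊞ 3 ⊡ h1 ⊞ 3 ⊡ h2 ⊞ h3 ⊞ h4 ⊞ h5) (solve (t ∷ u ∷ T ∷
    r ∷ m ∷ p ∷ c ∷ []))

-- Nine levels of more than 10kr + r vertices exceed t; two more levels are allowed for the two
-- protected vertices.
exit-levels : ∀ t k r → t ≤ (1 + 80 * k) * r → t + (1 + (10 * k * r + r)) * 2 < (1 + (10 * k * r + r)) * 11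
exit-levels t k r h0 = lin (8 + 10 * (k * r) + 8 * r) h0 (solve (t ∷ k ∷ r ∷ []))

exit-room : ∀ t k r T → (1 + 80 * k) * r ≤ t → T ≤ r → 12 ≤ r → r ≤ k * r → 2 * T + 3 * ((10 * k * r + r) + 4) ≤ t
exit-room t k r T h0 h1 h2 h3 = lin (45 * (k * r)) (h0 ⊞ 2 ⊡ h1 ⊞ h2 ⊞ 5 ⊡ h3) (solve (t ∷ k ∷ r ∷ T ∷ []))

prefix-short : ∀ p s T → 2 * p + 3 * (s + 15) ≤ T → p ≤ T
prefix-short p s T h0 = lin (45 + p + 3 * s) h0 (solve (p ∷ s ∷ T ∷ []))

time-large : ∀ t k r → (1 + 80 * k) * r ≤ t → 10 * r ≤ k * r → 801 * r ≤ t
time-large t k r h0 h1 = lin 0 (h0 ⊞ 80 ⊡ h1) (solve (t ∷ k ∷ r ∷ []))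

rest-large : ∀ t u w T r m p n q → t ≤ u + w →
    w ≤ T + ((2 * r + (m + p)) + ((2 * r + (n + q)) + ((2 * r + 11) + (2 * r + 11)))) → 1 + m ≤ 160 * r →
    1 + n ≤ 160 * r → T ≤ r → p ≤ r → q ≤ r → 801 * r ≤ t → 1000 ≤ r → 320 * r ≤ u
rest-large t u w T r m p n q h0 h1 h2 h3 h4 h5 h6 h7 h8 = lin (980 + 149 * r) (h0 ⊞ h1 ⊞ h2 ⊞ h3 ⊞ h4 ⊞ h5 ⊞ h6 ⊞ h7 ⊞
    h8) (solve (t ∷ u ∷ w ∷ T ∷ r ∷ m ∷ p ∷ n ∷ q ∷ []))

block-exists : ∀ m B h n → 6 * n + 12 ≤ m → m ≤ 6 * B + 6 * h + 5 → h ≤ n → 1 ≤ B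
block-exists m B h n h0 h1 h2 = lin* 5 1 (h0 ⊞ h1 ⊞ 6 ⊡ h2) (solve (m ∷ B ∷ h ∷ n ∷ []))

half-large : ∀ x y u r → 320 * r ≤ u → u ≤ x + y → 1 + x ≤ 160 * r → 160 * r ≤ y
half-large x y u r h0 h1 h2 = lin 1 (h0 ⊞ h1 ⊞ h2) (solve (x ∷ y ∷ u ∷ r ∷ []))

reserved-count : ∀ j w y z p → j + (w + (y + (z + p))) ≤ 1 → y + (w + ((j + 0) + (z + p))) ≤ 1
reserved-count j w y z p h0 = lin 0 h0 (solve (j ∷ w ∷ y ∷ z ∷ p ∷ []))

blocks-many : ∀ m B h r p → m ≤ 6 * B + 6 * h + 5 → h ≤ 2 * r + (11 + p) → p ≤ r → m ≤ 6 * B + 18 * r + 71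
blocks-many m B h r p h0 h1 h2 = lin 0 (h0 ⊞ 6 ⊡ h1 ⊞ 6 ⊡ h2) (solve (m ∷ B ∷ h ∷ r ∷ p ∷ []))

blocks-enough : ∀ m B r j i x → m ≤ 6 * B + 18 * r + 71 → 160 * r ≤ m → i + j ≤ 26 * r → 2 * x ≤ j → 1000 ≤ r → x ≤ B
blocks-enough m B r j i x h0 h1 h2 h3 h4 = lin* 5 (929 + 3 * i + 63 * r) (h0 ⊞ h1 ⊞ 3 ⊡ h2 ⊞ 3 ⊡ h3 ⊞ h4) (solve (m ∷ B ∷ r
    ∷ j ∷ i ∷ x ∷ []))

windows-enough : ∀ m B r j i x → m ≤ 6 * (x + B) + 18 * r + 71 → 160 * r ≤ m → i + j ≤ 26 * r → 2 * x ≤ j → 1000 ≤ r →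
    1 + (i + 2 * x) ≤ 3 * B
windows-enough m B r j i x h0 h1 h2 h3 h4 = lin* 1 (927 + 3 * i + 11 * r) (h0 ⊞ h1 ⊞ 5 ⊡ h2 ⊞ 5 ⊡ h3 ⊞ h4) (solve (m ∷ B ∷ r
    ∷ j ∷ i ∷ x ∷ []))

outside-large : ∀ t u f r T m p w → t ≤ f + (T + ((2 * r + (m + p)) + 4)) → f ≤ u + (2 * r + (11 + w)) → T ≤ r → p ≤ r →
    w ≤ r → t ≤ u + m + 7 * r + 15
outside-large t u f r T m p w h0 h1 h2 h3 h4 = lin 0 (h0 ⊞ h1 ⊞ h2 ⊞ h3 ⊞ h4) (solve (t ∷ u ∷ f ∷ r ∷ T ∷ m ∷ p ∷ w ∷ []))

quads-fit : ∀ t u r m → t ≤ u + m + 7 * r + 15 → 3 * m + 240 * r ≤ 2 * t → 1000 ≤ r → 4 * (26 * r) ≤ u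
quads-fit t u r m h0 h1 h2 = lin* 1 (970 + m + 17 * r) (2 ⊡ h0 ⊞ h1 ⊞ h2) (solve (t ∷ u ∷ r ∷ m ∷ []))

-- At least m/2 + 113r - 15 vertices are available off the path of length m, and the groups of four
-- take 104r of them. The 3B windows call for fewer than m/2 single vertices, as 6B ≤ m. This is
-- what the 240r in the gap is for.
singles-fit : ∀ t u r m e g B x i → t ≤ u + m + 7 * r + 15 → 3 * m + 240 * r ≤ 2 * t → 1000 ≤ r → u ≤ 4 * (26 * r) + e →
    6 * (x + B) ≤ m → g + (1 + (i + 2 * x)) ≤ 3 * B → g ≤ e
singles-fit t u r m e g B x i h0 h1 h2 h3 h4 h5 = lin* 1 (972 + 2 * i + 17 * r + 10 * x) (2 ⊡ h0 ⊞ h1 ⊞ h2 ⊞ 2 ⊡ h3 ⊞ h4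
    ⊞ 2 ⊡ h5) (solve (t ∷ u ∷ r ∷ m ∷ e ∷ g ∷ B ∷ x ∷ i ∷ []))

-- The pieces have 2i + 10x + g vertices and are joined by i + 2x + g - 1 counted connectors. With g
-- = 3B - 1 - i - 2x the total is 6(x + B) + i + 2x - 3. The blocks miss at most 18r + 71 of the m
-- path vertices, while i + 2x ≥ 26r - 1, so the new path has at least m + 8r - 75 vertices.
total-too-long : ∀ m B r j i x g f l → m ≤ 6 * (x + B) + 18 * r + 71 → 26 * r ≤ i + j → j ≤ 2 * x + 1 →
    3 * B ≤ g + (1 + (i + 2 * x)) → 2 * i + (5 * (2 * x) + g) ≤ f → i + (2 * x + g) ≤ 1 + l → f + l ≤ m → 1000 ≤ r → ⊥
total-too-long m B r j i x g f l h0 h1 h2 h3 h4 h5 h6 h7 = lin-⊥ (924 + 7 * r) (h0 ⊞ h1 ⊞ h2 ⊞ 2 ⊡ h3 ⊞ h4 ⊞ h5 ⊞ h6 ⊞ h7)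
    (solve (m ∷ B ∷ r ∷ j ∷ i ∷ x ∷ g ∷ f ∷ l ∷ []))

total-count : ∀ y z p u x a q f s b h → x ≤ q + a → f + (q + s) ≤ u → h ≤ s → u + ((a + b) + (y + (z + p))) ≤ 1 →
    y + (b + ((f + (x + h)) + (z + p))) ≤ 1
total-count y z p u x a q f s b h h0 h1 h2 h3 = lin 0 (h0 ⊞ h1 ⊞ h2 ⊞ h3) (solve (y ∷ z ∷ p ∷ u ∷ x ∷ a ∷ q ∷ f ∷ s ∷ b ∷
    h ∷ []))

pieces-count : ∀ f x h q a s u → x ≤ q + a → f + (q + s) ≤ u → h ≤ s → f + (x + h) ≤ u + a
pieces-count f x h q a s u h0 h1 h2 = lin 0 (h0 ⊞ h1 ⊞ h2) (solve (f ∷ x ∷ h ∷ q ∷ a ∷ s ∷ u ∷ []))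

-- The permitted defect 3t is at least 240kr, that is, 240r after division by k; hence the factor 80
-- in t.
gap-scaled : ∀ k q p t r → 3 * k * (q + p) + 3 * t ≤ 2 * k * t → (1 + 80 * k) * r ≤ t → k * (3 * q + 240 * r) ≤ k * (2 * t)
gap-scaled k q p t r h0 h1 = lin (3 * (k * p) + 3 * r) (h0 ⊞ 3 ⊡ h1) (solve (k ∷ q ∷ p ∷ t ∷ r ∷ []))

-- Counting in initial segments and in lists

module Counting (em : ExcludedMiddle 0ℓ) where

  open import Data.List.Relation.Binary.Sublist.Propositional using (_⊆_; []; _∷_; _∷ʳ_)

  lem : ∀ (P : Set) → P ⊎ ¬ P
  lem P with em {P}
  ... | yes p = inj₁ p
  ... | no n = inj₂ n

  bit : {P : Set} → Dec P → ℕ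
  bit (yes _) = 1
  bit (no _) = 0

  bit≤1 : {P : Set} (d : Dec P) → bit d ≤ 1
  bit≤1 (yes _) = ≤-refl
  bit≤1 (no _) = z≤n

  bit-mono : {P Q : Set} (d : Dec P) (e : Dec Q) → (P → Q) → bit d ≤ bit e
  bit-mono (yes p) (yes q) f = ≤-refl
  bit-mono (yes p) (no nq) f = ⊥-elim (nq (f p))
  bit-mono (no np) e f = z≤n

  bit-∪ : {P Q R : Set} (d : Dec P) (e : Dec Q) (f : Dec R) → (P → Q ⊎ R) → bit d ≤ bit e + bit f
  bit-∪ (no _) e f h = z≤n
  bit-∪ (yes p) e f h with h p
  ... | inj₁ q = ≤-trans (bit-mono (yes p) e (λ _ → q)) (m≤m+n _ _)
  ... | inj₂ r = ≤-trans (bit-mono (yes p) f (λ _ → r)) (m≤n+m _ _)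

  bit-disj : {P Q R : Set} (d : Dec P) (e : Dec Q) (f : Dec R) →
             (P → R) → (Q → R) → (P → Q → ⊥) → bit d + bit e ≤ bit f
  bit-disj (yes p) (yes q) f g h k = ⊥-elim (k p q)
  bit-disj (yes p) (no _) f g h k = bit-mono (yes p) f g
  bit-disj (no _) e f g h k = bit-mono e f h

  bit-yes : {P : Set} (d : Dec P) → P → 1 ≤ bit d
  bit-yes (yes _) p = ≤-refl
  bit-yes (no np) p = ⊥-elim (np p)

  # : (ℕ → Set) → ℕ → ℕ
  # P zero = 0
  # P (suc n) = bit (em {P (suc n)}) + # P n

  #-∪ : ∀ {P Q R : ℕ → Set} n → (∀ v → 1 ≤ v → v ≤ n → P v → Q v ⊎ R v) → # P n ≤ # Q n + # R n
  #-∪ zero h = z≤n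
  #-∪ {P} {Q} {R} (suc n) h =
    ≤-trans (+-mono-≤ (bit-∪ (em {P (suc n)}) (em {Q (suc n)}) (em {R (suc n)}) (h (suc n) (s≤s z≤n) ≤-refl))
                      (#-∪ {P} {Q} {R} n (λ v a b → h v a (m≤n⇒m≤1+n b))))
            (≤-reflexive (interchange (bit (em {Q (suc n)})) (bit (em {R (suc n)})) (# Q n) (# R n)))

  #-mono : ∀ {P Q : ℕ → Set} n → (∀ v → 1 ≤ v → v ≤ n → P v → Q v) → # P n ≤ # Q n
  #-mono zero h = z≤n
  #-mono {P} {Q} (suc n) h = +-mono-≤ (bit-mono (em {P (suc n)}) em (h (suc n) (s≤s z≤n) ≤-refl)) (#-mono {P} {Q} n (λ v a b →
      h v a (m≤n⇒m≤1+n b)))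

  #-disj : ∀ {P Q R : ℕ → Set} n → (∀ v → 1 ≤ v → v ≤ n → P v → R v) → (∀ v → 1 ≤ v → v ≤ n → Q v → R v) →
           (∀ v → 1 ≤ v → v ≤ n → P v → Q v → ⊥) → # P n + # Q n ≤ # R n
  #-disj zero f g h = z≤n
  #-disj {P} {Q} {R} (suc n) f g h =
    ≤-trans (≤-reflexive (interchange (bit (em {P (suc n)})) (# P n) (bit (em {Q (suc n)})) (# Q n)))
     (+-mono-≤ (bit-disj (em {P (suc n)}) (em {Q (suc n)}) (em {R (suc n)}) (f _ (s≤s z≤n) ≤-refl) (g _ (s≤s z≤n) ≤-refl) (h _
         (s≤s z≤n) ≤-refl))
               (#-disj {P} {Q} {R} n (λ v a b → f v a (m≤n⇒m≤1+n b)) (λ v a b → g v a (m≤n⇒m≤1+n b)) (λ v a b → h v a (m≤n⇒m≤1+n b))))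

  #-all : ∀ {P : ℕ → Set} n → (∀ v → 1 ≤ v → v ≤ n → P v) → n ≤ # P n
  #-all zero h = z≤n
  #-all {P} (suc n) h = +-mono-≤ (bit-yes (em {P (suc n)}) (h _ (s≤s z≤n) ≤-refl)) (#-all {P} n (λ v a b → h v a (m≤n⇒m≤1+n b)))

  #≤ : ∀ (P : ℕ → Set) n → # P n ≤ n
  #≤ P zero = z≤n
  #≤ P (suc n) = +-mono-≤ (bit≤1 (em {P (suc n)})) (#≤ P n)

  #-suc : ∀ (P : ℕ → Set) n → # P n ≤ # P (suc n)
  #-suc P n = m≤n+m _ _

  #-≤ : ∀ (P : ℕ → Set) {m n} → m ≤ n → # P m ≤ # P n
  #-≤ P h = go (≤⇒≤′ h) where
    go : ∀ {m n} → m ≤′ n → # P m ≤ # P n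
    go ≤′-refl = ≤-refl
    go (≤′-step h) = ≤-trans (go h) (#-suc P _)

  #-∅ : ∀ {P : ℕ → Set} n → (∀ v → 1 ≤ v → v ≤ n → P v → ⊥) → # P n ≤ 0
  #-∅ zero h = z≤n
  #-∅ {P} (suc n) h = +-mono-≤ (≤-trans (bit-mono (em {P (suc n)}) (no (λ x → x)) (h _ (s≤s z≤n) ≤-refl)) ≤-refl) (#-∅ {P} n (λ v a b →
      h v a (m≤n⇒m≤1+n b)))

  #-pos : ∀ {P : ℕ → Set} n v → 1 ≤ v → v ≤ n → P v → 1 ≤ # P n
  #-pos zero (suc v) a () p
  #-pos {P} (suc n) v a b p with v ≟ suc n
  ... | yes refl = ≤-trans (bit-yes (em {P (suc n)}) p) (m≤m+n _ _)
  ... | no ne = ≤-trans (#-pos {P} n v a (≤-pred (≤∧≢⇒< b ne)) p) (m≤n+m _ _)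

  #-below : ∀ g n → # (_≤ g) n ≤ g
  #-below g zero = z≤n
  #-below g (suc n) with em {suc n ≤ g}
  ... | no _ = #-below g n
  ... | yes h = ≤-trans (+-monoʳ-≤ 1 (#≤ (_≤ g) n)) h

  #-sing : ∀ x n → # (_≡ x) n ≤ 1
  #-sing x zero = z≤n
  #-sing x (suc n) with em {suc n ≡ x}
  ... | no _ = #-sing x n
  ... | yes refl = +-monoʳ-≤ 1 (#-∅ n (λ v a b e → 1+n≰n (≤-trans (≤-reflexive (sym e)) b)))

  -- Multisets are compared through occurrence counts, so that all rearrangements of lists become linear arithmetic.
  cnt : ℕ → List ℕ → ℕ
  cnt a [] = 0
  cnt a (x ∷ xs) = bit (a ≟ x) + cnt a xs

  cnt-++ : ∀ a xs ys → cnt a (xs ++ ys) ≡ cnt a xs + cnt a ys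
  cnt-++ a [] ys = refl
  cnt-++ a (x ∷ xs) ys rewrite cnt-++ a xs ys = sym (+-assoc (bit (a ≟ x)) _ _)

  ∈⇒cnt : ∀ {a xs} → a ∈ xs → 1 ≤ cnt a xs
  ∈⇒cnt {a} {x ∷ xs} (here p) = ≤-trans (bit-yes (a ≟ x) p) (m≤m+n _ _)
  ∈⇒cnt {a} {x ∷ xs} (there p) = ≤-trans (∈⇒cnt p) (m≤n+m _ _)

  cnt⇒∈ : ∀ {a} xs → 1 ≤ cnt a xs → a ∈ xs
  cnt⇒∈ {a} (x ∷ xs) h with a ≟ x
  ... | yes p = here p
  ... | no _ = there (cnt⇒∈ xs h)

  ∉⇒cnt : ∀ {a} xs → ¬ (a ∈ xs) → cnt a xs ≤ 0
  ∉⇒cnt {a} xs h with cnt a xs in eq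
  ... | zero = z≤n
  ... | suc n = ⊥-elim (h (cnt⇒∈ xs (≤-trans (s≤s z≤n) (≤-reflexive (sym eq)))))

  cnt-⊆ : ∀ {xs ys} → xs ⊆ ys → ∀ a → cnt a xs ≤ cnt a ys
  cnt-⊆ [] a = z≤n
  cnt-⊆ (y ∷ʳ s) a = ≤-trans (cnt-⊆ s a) (m≤n+m _ (bit (a ≟ y)))
  cnt-⊆ (_∷_ {x} refl s) a = +-monoʳ-≤ (bit (a ≟ x)) (cnt-⊆ s a)

  Dist : List ℕ → Set
  Dist xs = ∀ a → cnt a xs ≤ 1

  -- Connecting paths may run beyond `t` at no cost: only their vertices up to `t` take up room in
  -- [1,t].
  wt : ℕ → List ℕ → ℕ
  wt t [] = 0
  wt t (x ∷ xs) = bit (x ≤? t) + wt t xs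

  wt≤length : ∀ t xs → wt t xs ≤ length xs
  wt≤length t [] = z≤n
  wt≤length t (x ∷ xs) = +-mono-≤ (bit≤1 (x ≤? t)) (wt≤length t xs)

  #-∈≤wt : ∀ t xs → # (_∈ xs) t ≤ wt t xs
  #-∈≤wt t [] = #-∅ t (λ v _ _ ())
  #-∈≤wt t (x ∷ xs) = ≤-trans (#-∪ {_∈ (x ∷ xs)} {_≡ x} {_∈ xs} t (λ { v _ _ (here p) → inj₁ p ; v _ _ (there p) → inj₂ p }))
                              (+-mono-≤ one (#-∈≤wt t xs))
    where one : # (_≡ x) t ≤ bit (x ≤? t)
          one with x ≤? t
          ... | yes _ = #-sing x t
          ... | no n = #-∅ t (λ { v _ b refl → n b })

  #-∈≤length : ∀ t xs → # (_∈ xs) t ≤ length xs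
  #-∈≤length t xs = ≤-trans (#-∈≤wt t xs) (wt≤length t xs)

  dist-tail : ∀ {x xs} → Dist (x ∷ xs) → Dist xs
  dist-tail d a = ≤-trans (m≤n+m _ _) (d a)

  dist-head : ∀ {x xs} → Dist (x ∷ xs) → ¬ (x ∈ xs)
  dist-head {x} {xs} d i = 1+n≰n (≤-trans (+-mono-≤ (bit-yes (x ≟ x) refl) (∈⇒cnt i)) (d x))

  length≤# : ∀ {P : ℕ → Set} t xs → Dist xs → (∀ v → v ∈ xs → 1 ≤ v × v ≤ t × P v) → length xs ≤ # P t
  length≤# t [] d h = z≤n
  length≤# {P} t (x ∷ xs) d h =
    ≤-trans (+-mono-≤ (#-pos {_≡ x} t x (proj₁ hx) (proj₁ (proj₂ hx)) refl)
                      (length≤# {λ v → P v × v ≢ x} t xs (dist-tail {x} {xs} d)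
                         (λ v i → let a , b , p = h v (there i) in a , b , p , λ { refl → dist-head {x} {xs} d i })))
            (#-disj {_≡ x} {λ v → P v × v ≢ x} {P} t (λ { v _ _ refl → proj₂ (proj₂ hx) }) (λ v _ _ → proj₁) (λ v _ _ e p → proj₂ p e))
    where hx = h x (here refl)

  els : (ℕ → Set) → ℕ → List ℕ
  els P zero = []
  els P (suc n) with em {P (suc n)}
  ... | yes _ = suc n ∷ els P n
  ... | no _ = els P n

  els-length : ∀ P n → length (els P n) ≡ # P n
  els-length P zero = refl
  els-length P (suc n) with em {P (suc n)}
  ... | yes _ = cong suc (els-length P n)
  ... | no _ = els-length P n

  ∈els : ∀ P n {a} → a ∈ els P n → 1 ≤ a × a ≤ n × P a
  ∈els P (suc n) i with em {P (suc n)}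
  ∈els P (suc n) (here refl) | yes p = s≤s z≤n , ≤-refl , p
  ∈els P (suc n) (there i) | yes p = let a , b , q = ∈els P n i in a , m≤n⇒m≤1+n b , q
  ... | no _ = let a , b , q = ∈els P n i in a , m≤n⇒m≤1+n b , q

  els-dist : ∀ P n → Dist (els P n)
  els-dist P zero a = z≤n
  els-dist P (suc n) a with em {P (suc n)}
  ... | no _ = els-dist P n a
  ... | yes _ with a ≟ suc n
  ... | no _ = els-dist P n a
  ... | yes refl = +-monoʳ-≤ 1 (∉⇒cnt (els P n) (λ i → 1+n≰n (proj₁ (proj₂ (∈els P n i)))))

  range : ℕ → List ℕ
  range zero = []
  range (suc n) = suc n ∷ range n

  range-length : ∀ n → length (range n) ≡ n
  range-length zero = refl
  range-length (suc n) = cong suc (range-length n)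

  ∈range : ∀ n {v} → v ∈ range n → v ≤ n
  ∈range (suc n) (here refl) = ≤-refl
  ∈range (suc n) (there i) = m≤n⇒m≤1+n (∈range n i)

  range∈ : ∀ n {v} → 1 ≤ v → v ≤ n → v ∈ range n
  range∈ zero (s≤s _) ()
  range∈ (suc n) {v} a b with v ≟ suc n
  ... | yes p = here p
  ... | no ne = there (range∈ n a (≤-pred (≤∧≢⇒< b ne)))

  bound : List ℕ → ℕ
  bound [] = 0
  bound (x ∷ xs) = x + bound xs

  ∈bound : ∀ {v} xs → v ∈ xs → v ≤ bound xs
  ∈bound (x ∷ xs) (here refl) = m≤m+n _ _
  ∈bound (x ∷ xs) (there i) = ≤-trans (∈bound xs i) (m≤n+m _ _)

  max-exists : (P : ℕ → Set) → ∀ b m → P m → (∀ n → P n → n ≤ b) → ∃ λ n → P n × (∀ k → P k → k ≤ n)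
  max-exists P b m pm h = go b m pm (λ k pk → ≤-trans (h k pk) (m≤m+n b m))
    where
    go : ∀ d m → P m → (∀ k → P k → k ≤ d + m) → ∃ λ n → P n × (∀ k → P k → k ≤ n)
    go zero m pm h = m , pm , h
    go (suc d) m pm h with em {∃ λ k → P k × m < k}
    ... | yes (k , pk , lt) = go d k pk (λ j pj → ≤-trans (h j pj) (≤-trans (≤-reflexive (sym (+-suc d m))) (+-monoʳ-≤ d lt)))
    ... | no n = m , pm , λ k pk → ≮⇒≥ (λ lt → n (k , pk , lt))

-- Monochromatic finite paths

module Colours (em : ExcludedMiddle 0ℓ) (c : Colouring) where

  open import Data.List.Relation.Unary.All using (All; []; _∷_)
  open import Data.List.Relation.Binary.Sublist.Propositional using ([]; _∷_; _∷ʳ_)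
  open Counting em

  E : Bool → ℕ → ℕ → Set
  E Y u v = col c u v ≡ Y

  E-sym : ∀ {Y u v} → E Y u v → E Y v u
  E-sym {Y} {u} {v} e = trans (sym (symm c u v)) e

  ¬E⇒E : ∀ {Y u v} → ¬ E Y u v → E (not Y) u v
  ¬E⇒E {true} {u} {v} n with col c u v
  ... | true = ⊥-elim (n refl)
  ... | false = refl
  ¬E⇒E {false} {u} {v} n with col c u v
  ... | true = refl
  ... | false = ⊥-elim (n refl)

  ¬E⇒E′ : ∀ {Y u v} → ¬ E (not Y) u v → E Y u v
  ¬E⇒E′ {true} {u} {v} n with col c u v
  ... | true = refl
  ... | false = ⊥-elim (n refl)
  ¬E⇒E′ {false} {u} {v} n with col c u v
  ... | true = ⊥-elim (n refl)
  ... | false = refl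

  E? : ∀ Y u v → E Y u v ⊎ E (not Y) u v
  E? Y u v with em {E Y u v}
  ... | yes e = inj₁ e
  ... | no n = inj₂ (¬E⇒E n)

  data Seg (Y : Bool) : ℕ → ℕ → List ℕ → Set where
    single : ∀ {v} → Seg Y v v (v ∷ [])
    cons : ∀ {u v w xs} → E Y u v → Seg Y v w xs → Seg Y u w (u ∷ xs)

  module _ {Y : Bool} where

    join : ∀ {u v w z xs ys} → Seg Y u v xs → E Y v w → Seg Y w z ys → Seg Y u z (xs ++ ys)
    join single e t = cons e t
    join (cons e s) e′ t = cons e (join s e′ t)

    seg-head : ∀ {u v x xs} → Seg Y u v (x ∷ xs) → u ≡ x
    seg-head single = refl
    seg-head (cons _ _) = refl

    seg-first∈ : ∀ {u v xs} → Seg Y u v xs → u ∈ xs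
    seg-first∈ single = here refl
    seg-first∈ (cons _ _) = here refl

    seg-last∈ : ∀ {u v xs} → Seg Y u v xs → v ∈ xs
    seg-last∈ single = here refl
    seg-last∈ (cons _ s) = there (seg-last∈ s)

    split : ∀ {u v b ys} xs → Seg Y u v (xs ++ b ∷ ys) → Seg Y u b (xs ++ b ∷ []) × Seg Y b v (b ∷ ys)
    split [] s with seg-head s
    ... | refl = single , s
    split (x ∷ []) (cons e s) with seg-head s
    ... | refl = cons e single , s
    split (x ∷ x′ ∷ xs) (cons e s) with split (x′ ∷ xs) s
    ... | s₁ , s₂ = cons e s₁ , s₂

    glue : ∀ {u v b ys} xs → Seg Y u b (xs ++ b ∷ []) → Seg Y b v (b ∷ ys) → Seg Y u v (xs ++ b ∷ ys)
    glue [] single t = t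
    glue [] (cons _ ()) t
    glue (x ∷ []) (cons e s) t = cons e (glue [] s t)
    glue (x ∷ x′ ∷ xs) (cons e s) t = cons e (glue (x′ ∷ xs) s t)

    replace : ∀ {u v b b′ ys} xs mid mid′ → Seg Y u v (xs ++ b ∷ mid ++ b′ ∷ ys) →
              Seg Y b b′ (b ∷ mid′ ++ b′ ∷ []) → Seg Y u v (xs ++ b ∷ mid′ ++ b′ ∷ ys)
    replace {b = b} xs mid mid′ s t with split xs s
    ... | s₁ , s₂ with split (b ∷ mid) s₂
    ... | _ , s₃ = glue xs s₁ (glue (b ∷ mid′) t s₃)

    rev : ∀ {u v xs} → Seg Y u v xs → ∃ λ ys → Seg Y v u ys × (∀ a → cnt a ys ≡ cnt a xs) × length ys ≡ length xs
    rev single = _ , single , (λ _ → refl) , refl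
    rev {u} {v} (cons {xs = xs} e s) with rev s
    ... | ys , t , p , q = ys ++ u ∷ [] , join t (E-sym e) single ,
          (λ a → trans (cnt-++ a ys (u ∷ [])) (trans (+-comm (cnt a ys) _) (cong₂ _+_ (+-identityʳ (bit (a ≟ u))) (p a)))) ,
          trans (length-++ ys) (trans (+-comm (length ys) 1) (cong suc q))

    truncate : ∀ {u v a xs} t → Seg Y u v xs → a ∈ xs →
               ∃ λ ys → Seg Y a v ys × (∀ x → cnt x ys ≤ cnt x xs) × wt t ys ≤ wt t xs
    truncate t single (here refl) = _ , single , (λ _ → ≤-refl) , ≤-refl
    truncate t (cons e s) (here refl) = _ , cons e s , (λ _ → ≤-refl) , ≤-refl
    truncate t (cons e s) (there i) with truncate t s i
    ... | ys , r , p , q = ys , r , (λ x → ≤-trans (p x) (m≤n+m _ _)) , ≤-trans q (m≤n+m _ _)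

  -- From finite paths to an infinite dense path

  fromEnd : List ℕ → ℕ → ℕ
  fromEnd [] i = 0
  fromEnd (x ∷ xs) i with i ≟ length xs
  ... | yes _ = x
  ... | no _ = fromEnd xs i

  fromEnd-∈ : ∀ L i → i < length L → fromEnd L i ∈ L
  fromEnd-∈ (x ∷ xs) i h with i ≟ length xs
  ... | yes _ = here refl
  ... | no ne = there (fromEnd-∈ xs i (≤∧≢⇒< (≤-pred h) ne))

  -- Positions counted from the end do not change when vertices are prepended; this makes the limit
  -- sequence well defined.
  fromEnd-++ : ∀ Z L i → i < length L → fromEnd (Z ++ L) i ≡ fromEnd L i
  fromEnd-++ [] L i h = refl
  fromEnd-++ (x ∷ Z) L i h with i ≟ length (Z ++ L)
  ... | no ne = fromEnd-++ Z L i h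
  ... | yes refl = ⊥-elim (1+n≰n (≤-trans h (≤-trans (m≤n+m (length L) (length Z)) (≤-reflexive (sym (length-++ Z))))))

  fromEnd-inj : ∀ L i j → Dist L → i < length L → j < length L → fromEnd L i ≡ fromEnd L j → i ≡ j
  fromEnd-inj (x ∷ xs) i j d hi hj e with i ≟ length xs | j ≟ length xs
  ... | yes p | yes q = trans p (sym q)
  ... | no p | no q = fromEnd-inj xs i j (dist-tail {x} {xs} d) (≤∧≢⇒< (≤-pred hi) p) (≤∧≢⇒< (≤-pred hj) q) e
  ... | yes p | no q = ⊥-elim (dist-head {x} {xs} d (subst (_∈ xs) (sym e) (fromEnd-∈ xs j (≤∧≢⇒< (≤-pred hj) q))))
  ... | no p | yes q = ⊥-elim (dist-head {x} {xs} d (subst (_∈ xs) e (fromEnd-∈ xs i (≤∧≢⇒< (≤-pred hi) p))))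

  fromEnd-last : ∀ x xs → fromEnd (x ∷ xs) (length xs) ≡ x
  fromEnd-last x xs with length xs ≟ length xs
  ... | yes _ = refl
  ... | no ne = ⊥-elim (ne refl)

  fromEnd-edge : ∀ {Y u v L} → Seg Y u v L → ∀ i → suc i < length L → E Y (fromEnd L i) (fromEnd L (suc i))
  fromEnd-edge single i (s≤s ())
  fromEnd-edge {Y} (cons {u = u} {xs = xs} e s) i h with suc i ≟ length xs | i ≟ length xs
  ... | yes p | yes q = ⊥-elim (1+n≰n (≤-reflexive (trans p (sym q))))
  ... | no p | yes refl = ⊥-elim (1+n≰n (≤-pred h))
  ... | no p | no q = fromEnd-edge s i (≤∧≢⇒< (≤-pred h) p)
  fromEnd-edge {Y} (cons {u = u} {xs = x ∷ xs} e s) i h | yes refl | no q =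
    subst (λ z → E Y z u) (sym (trans (fromEnd-last x xs) (sym (seg-head s)))) (E-sym e)

  -- For positive n and k the condition reads m/n > 2/3 - 1/k, so it becomes stronger as k grows.
  dense-mono : ∀ k k′ n m → 1 ≤ k → k ≤ k′ → 2 * k′ * n < 3 * k′ * m + 3 * n → 2 * k * n < 3 * k * m + 3 * n
  dense-mono (suc k) k′ n m _ h lt with m≤n⇒∃[o]m+o≡n h
  ... | d , refl = ≰⇒> λ le → density-monotone (suc k) d n m lt le
        (*-monoʳ-≤ d (*-cancelˡ-≤ (suc k) (density-cancel (suc k) n m le)))

  record IsSeg (Y : Bool) (P : List ℕ) : Set where
    field
      {end beg} : ℕ
      seg : Seg Y end beg P
      dist : Dist P
      pos : ∀ v → v ∈ P → 1 ≤ v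
  open IsSeg public

  -- Finite paths are listed from their last vertex backwards, so that they are extended by prepending.
  Extends : (List ℕ → Set) → List ℕ → ℕ → ℕ → Set
  Extends G P N k = ∃ λ Z → ∃ λ M → ∃ λ n → N ≤ n × G (Z ++ M ++ P) × (∀ v → v ∈ M ++ P → v ≤ n) ×
                    2 * k * n < 3 * k * length (M ++ P) + 3 * n

  Dense : Bool → Set
  Dense Y = Σ (ℕ → ℕ) λ a → IsMonoPath c Y a × StrongUpperDensity≥ a 2 3

  -- `M ++ P` is the dense prefix at time `n`. The vertices of `Z` come later and may exceed `n`;
  -- they only restore the invariant `G`, so that the next stage can start.
  module Limit {Y : Bool} (G : List ℕ → Set) (G-seg : ∀ P → G P → IsSeg Y P)
               (ext : ∀ P → G P → ∀ N k → 1 ≤ k → Extends G P N k) (P₀ : List ℕ) (G₀ : G P₀) where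

    Step : ℕ → List ℕ → Set
    -- As `i + 3 ≥ 3`, the density exceeds 1/3, and `n ≥ 3 * length P + 3` then forces the path to
    -- grow at every stage. The increasing parameter drives the density to 2/3.
    Step i P = Extends G P (i + 3 * length P + 3) (i + 3)

    stage : ℕ → Σ (List ℕ) G
    step : ∀ i → Step i (proj₁ (stage i))
    stage zero = P₀ , G₀
    stage (suc i) = let Z , M , n , _ , g , _ = step i in Z ++ M ++ proj₁ (stage i) , g
    step i = ext (proj₁ (stage i)) (proj₂ (stage i)) (i + 3 * length (proj₁ (stage i)) + 3) (i + 3) (≤-trans (s≤s z≤n) (m≤n+m 3 i))

    P : ℕ → List ℕ
    P i = proj₁ (stage i)

    prefix : ∀ i → ∃ λ W → P (suc i) ≡ W ++ P i
    prefix i = let Z , M , _ = step i in Z ++ M , sym (++-assoc Z M (P i))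

    grows : ∀ i → suc (length (P i)) ≤ length (P (suc i))
    grows i = let Z , M , n , a , _ , _ , d = step i in
      ≤-trans (grow-arith i (length (P i)) n (length (M ++ P i)) a d)
              (≤-trans (m≤n+m _ (length Z)) (≤-reflexive (sym (length-++ Z))))
      where
      grow-arith : ∀ i l n m → i + 3 * l + 3 ≤ n → 2 * (i + 3) * n < 3 * (i + 3) * m + 3 * n → suc l ≤ m
      grow-arith i l n m h₀ h₁ = ≮⇒≥ λ lt → stage-growth i l n m h₀ h₁ (*-monoʳ-≤ (i + 3) lt) (*-monoʳ-≤ i h₀) 

    prefix≤ : ∀ {i j} → i ≤′ j → ∃ λ W → P j ≡ W ++ P i
    prefix≤ ≤′-refl = [] , refl
    prefix≤ {i} (≤′-step {j} h) with prefix≤ h | prefix j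
    ... | W , e | V , f = V ++ W , trans f (trans (cong (V ++_) e) (sym (++-assoc V W (P i))))

    i<length : ∀ i → i ≤ length (P i)
    i<length zero = z≤n
    i<length (suc i) = ≤-trans (s≤s (i<length i)) (grows i)

    a : ℕ → ℕ
    -- Stage `suc i` has at least i + 1 vertices, so the default value of `fromEnd` never occurs.
    a i = fromEnd (P (suc i)) i

    a-eq : ∀ i j → i < length (P j) → fromEnd (P j) i ≡ a i
    a-eq i j h with ≤-total (suc i) j
    ... | inj₁ le with prefix≤ (≤⇒≤′ le)
    ...   | W , e = trans (cong (λ L → fromEnd L i) e) (fromEnd-++ W (P (suc i)) i (i<length (suc i)))
    a-eq i j h | inj₂ le with prefix≤ (≤⇒≤′ le)
    ...   | W , e = sym (trans (cong (λ L → fromEnd L i) e) (fromEnd-++ W (P j) i h))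

    seg-of : ∀ i → IsSeg Y (P i)
    seg-of i = G-seg (P i) (proj₂ (stage i))

    a-inj : ∀ {i j} → a i ≡ a j → i ≡ j
    a-inj {i} {j} e = fromEnd-inj (P m) i j (dist (seg-of m)) hi hj (trans (a-eq i m hi) (trans e (sym (a-eq j m hj))))
      where m = suc (i + j)
            hi : i < length (P m)
            hi = ≤-trans (s≤s (m≤m+n i j)) (i<length m)
            hj : j < length (P m)
            hj = ≤-trans (s≤s (m≤n+m j i)) (i<length m)

    a-pos : ∀ i → 1 ≤ a i
    a-pos i = pos (seg-of (suc i)) _ (fromEnd-∈ (P (suc i)) i (i<length (suc i)))

    a-edge : ∀ i → E Y (a i) (a (suc i))
    a-edge i = subst₂ (E Y) (a-eq i m (≤-trans (n≤1+n _) h)) (a-eq (suc i) m h) (fromEnd-edge (seg (seg-of m)) i h)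
      where m = suc (suc i)
            h : suc i < length (P m)
            h = i<length m

    a-dense : StrongUpperDensity≥ a 2 3
    a-dense k 1≤k N = let Z , M , n , h , g , b , d = step i in
        n , ≤-trans (≤-trans (m≤n+m N k) (≤-trans (m≤m+n (k + N) _) (≤-trans (m≤m+n _ 3) ≤-refl))) h ,
        length (M ++ P i) ,
        (λ j lt → subst (_≤ n) (val Z M j refl lt) (b _ (fromEnd-∈ (M ++ P i) j lt))) ,
        dense-mono k (i + 3) n (length (M ++ P i)) 1≤k (≤-trans (m≤m+n k N) (m≤m+n (k + N) 3)) d
      where
      i = k + N
      val : ∀ Z M j → P (suc i) ≡ Z ++ M ++ P i → j < length (M ++ P i) → fromEnd (M ++ P i) j ≡ a j
      val Z M j e lt = trans (sym (trans (cong (λ L → fromEnd L j) e) (fromEnd-++ Z (M ++ P i) j lt)))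
                             (a-eq j (suc i) (≤-trans lt (≤-trans (m≤n+m _ (length Z))
                                (≤-reflexive (trans (sym (length-++ Z)) (cong length (sym e)))))))

    dense : Dense Y
    dense = a , (((λ {i} {j} → a-inj {i} {j}) , a-pos) , a-edge) , a-dense

  -- A colour without dense path makes the other colour highly connected

  dne : {P : Set} → ¬ ¬ P → P
  dne {P} h with em {P}
  ... | yes p = p
  ... | no n = ⊥-elim (h n)

  dist-++ : ∀ {xs ys} → Dist xs → Dist ys → (∀ a → a ∈ xs → a ∈ ys → ⊥) → Dist (xs ++ ys)
  dist-++ {xs} {ys} d e h a with em {a ∈ xs}
  ... | no n = ≤-trans (≤-reflexive (cnt-++ a xs ys)) (+-mono-≤ (∉⇒cnt xs n) (e a))
  ... | yes i = ≤-trans (≤-reflexive (trans (cnt-++ a xs ys) (+-comm (cnt a xs) _))) (+-mono-≤ (∉⇒cnt ys (h a i)) (d a))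

  dist-single : ∀ x → Dist (x ∷ [])
  dist-single x a = ≤-trans (≤-reflexive (+-identityʳ _)) (bit≤1 (a ≟ x))

  dist-∷ : ∀ {x xs} → Dist xs → ¬ (x ∈ xs) → Dist (x ∷ xs)
  dist-∷ {x} {xs} d n = dist-++ {x ∷ []} {xs} (dist-single x) d (λ { a (here refl) i → n i })

  ∈-cnt≤ : ∀ {a xs ys} → (∀ a → cnt a xs ≤ cnt a ys) → a ∈ xs → a ∈ ys
  ∈-cnt≤ {a} {xs} {ys} h i = cnt⇒∈ ys (≤-trans (∈⇒cnt i) (h a))

  Out : List ℕ → ℕ → Set
  Out F v = 1 ≤ v × v ∉ F

  infixl 6 _∖_
  _∖_ : (ℕ → Set) → (ℕ → Set) → ℕ → Set
  (A ∖ B) v = A v × ¬ B v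

  record Closed (Y : Bool) (A D : ℕ → Set) (t : ℕ) : Set where
    constructor closed
    field
      inside : ∀ v → D v → A v
      step : ∀ u v → u ≤ t → v ≤ t → D u → A v → E Y u v → D v

  -- The deleted set S may have any size, as long as it avoids the vertices p and q: these are the ends of the long path
  -- of the other colour that a violation would produce.
  Star : Bool → Set₁
  Star Y = (F : List ℕ) → Σ ℕ λ n → Σ ℕ λ p → Σ ℕ λ q → p ≤ n × q ≤ n ×
    (∀ t → n ≤ t → (S D : ℕ → Set) → ¬ S p → ¬ S q → Closed Y (Out F ∖ S) D t →
       (3 * # D t + length F < t) ⊎ (3 * # (Out F ∖ S ∖ D) t + length F < t))

  Inf : Bool → ℕ → Set
  Inf Y v = ∀ n → ∃ λ w → n < w × E Y v w

  record InfEnd (Y : Bool) (P : List ℕ) : Set where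
    field
      isSeg : IsSeg Y P
      infEnd : Inf Y (end isSeg)
  open InfEnd

  module _ {Y : Bool} where

    -- Here `z` and `xs` form one side and `v` and `ys` the other. A zigzag from `z` to `y` on the
    -- remaining vertices is followed by `x` and `v`, so each step adds two vertices at the `v` end.
    zigzag : ∀ xs ys {v z} → length xs ≡ length ys → E Y v z → (∀ x → x ∈ xs → E Y v x) → (∀ y → y ∈ ys → E Y z y) →
             (∀ x y → x ∈ xs → y ∈ ys → E Y x y) →
             ∃ λ L → Seg Y z v L × (∀ a → cnt a L ≤ cnt a (z ∷ v ∷ xs ++ ys)) × 2 + 2 * length xs ≤ length L
    zigzag [] [] {v} {z} _ e _ _ _ = z ∷ v ∷ [] , cons (E-sym e) single , (λ a → ≤-refl) , ≤-refl
    zigzag (x ∷ xs) (y ∷ ys) {v} {z} le e hv hz h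
      with zigzag xs ys {y} {z} (suc-injective le) (E-sym (hz y (here refl))) (λ x i → E-sym (h x y (there i) (here refl)))
                  (λ y i → hz y (there i)) (λ x y i j → h x y (there i) (there j))
    ... | L , s , m , l = L ++ x ∷ v ∷ [] ,
          join s (E-sym (h x y (here refl) (here refl))) (cons (E-sym (hv x (here refl))) single) ,
          (λ a → zig-cnt a (m a)) ,
          ≤-trans (zigzag-length (length xs) (length L) l) (≤-reflexive (sym (length-++ L)))
      where
      zig-cnt : ∀ a → cnt a L ≤ cnt a (z ∷ y ∷ xs ++ ys) → cnt a (L ++ x ∷ v ∷ []) ≤ cnt a (z ∷ v ∷ x ∷ xs ++ y ∷ ys)
      zig-cnt a h rewrite cnt-++ a L (x ∷ v ∷ []) | cnt-++ a xs ys | cnt-++ a xs (y ∷ ys) =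
        zigzag-count (cnt a L) (bit (a ≟ z)) (bit (a ≟ y)) (cnt a xs) (cnt a ys) (bit (a ≟ x)) (bit (a ≟ v)) h

    shorten : ∀ j (xs : List ℕ) → j ≤ length xs → ∃ λ ys → length ys ≡ j × (∀ a → cnt a ys ≤ cnt a xs)
    shorten zero xs _ = [] , refl , λ _ → z≤n
    shorten (suc j) (x ∷ xs) (s≤s h) with shorten j xs h
    ... | ys , l , m = x ∷ ys , cong suc l , λ a → +-monoʳ-≤ (bit (a ≟ x)) (m a)

    module Bipartite (A B : ℕ → Set) (complete : ∀ x y → A x → B y → E Y x y) where

      cross : ∀ {v z} xs ys j → (∀ x → x ∈ xs → A x) → (∀ y → y ∈ ys → B y) → B v → A z → j ≤ length xs → j ≤ length ys →
              ∃ λ L → Seg Y z v L × (∀ a → cnt a L ≤ cnt a (z ∷ v ∷ xs ++ ys)) × 2 * j ≤ length L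
      cross {v} {z} xs ys j hx hy bv az lx ly with shorten j xs lx | shorten j ys ly
      ... | xs′ , ex , mx | ys′ , ey , my
        with zigzag xs′ ys′ {v} {z} (trans ex (sym ey)) (E-sym (complete z v az bv))
               (λ x i → E-sym (complete x v (hx x (∈-cnt≤ mx i)) bv)) (λ y i → complete z y az (hy y (∈-cnt≤ my i)))
               (λ x y i i′ → complete x y (hx x (∈-cnt≤ mx i)) (hy y (∈-cnt≤ my i′)))
      ... | L , s , m , l = L , s , (λ a → ≤-trans (m a) (+-monoʳ-≤ (bit (a ≟ z)) (+-monoʳ-≤ (bit (a ≟ v))
               (≤-trans (≤-reflexive (cnt-++ a xs′ ys′)) (≤-trans (+-mono-≤ (mx a) (my a)) (≤-reflexive (sym (cnt-++ a xs ys)))))))) ,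
            ≤-trans (*-monoʳ-≤ 2 (≤-reflexive (sym ex))) (≤-trans (m≤n+m _ 2) l)

      -- One vertex `y` is set aside as the end on the other side; the zigzag from `z` to `y` is
      -- then closed with `v`.
      same : ∀ {v z} xs ys j → (∀ x → x ∈ xs → A x) → (∀ y → y ∈ ys → B y) → A v → A z → j ≤ length xs → j ≤ length ys → 1 ≤ j →
              ∃ λ L → Seg Y z v L × (∀ a → cnt a L ≤ cnt a (z ∷ v ∷ xs ++ ys)) × 2 * j ≤ length L
      same {v} {z} xs (y ∷ ys) (suc j) hx hy av az lx (s≤s ly) _ with shorten j xs (≤-trans (n≤1+n j) lx) | shorten j ys ly
      ... | xs′ , ex , mx | ys′ , ey , my
        with zigzag xs′ ys′ {y} {z} (trans ex (sym ey)) (E-sym (complete z y az (hy y (here refl))))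
               (λ x i → E-sym (complete x y (hx x (∈-cnt≤ mx i)) (hy y (here refl)))) (λ y i → complete z y az (hy y (there (∈-cnt≤ my i))))
               (λ x y i i′ → complete x y (hx x (∈-cnt≤ mx i)) (hy y (there (∈-cnt≤ my i′))))
      ... | L , s , m , l = L ++ v ∷ [] , join s (E-sym (complete v y av (hy y (here refl)))) single ,
            (λ a → same-cnt a (m a) (mx a) (my a)) ,
            same-side-length j (length xs′) _ _ (≤-reflexive (sym ex)) l (≤-reflexive (sym (length-++ L)))
        where
        same-cnt : ∀ a → cnt a L ≤ cnt a (z ∷ y ∷ xs′ ++ ys′) → cnt a xs′ ≤ cnt a xs → cnt a ys′ ≤ cnt a ys →
                   cnt a (L ++ v ∷ []) ≤ cnt a (z ∷ v ∷ xs ++ y ∷ ys)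
        same-cnt a h hx hy rewrite cnt-++ a L (v ∷ []) | cnt-++ a xs′ ys′ | cnt-++ a xs (y ∷ ys) =
          same-side-count (cnt a L) (bit (a ≟ v)) (bit (a ≟ z)) (bit (a ≟ y)) (cnt a xs′) (cnt a ys′) (cnt a xs) (cnt a ys) h hx hy

  module _ (Y : Bool) where

    -- Some vertex `v` beyond `n₀` and `F` has finitely many Y-neighbours, so it is joined in the
    -- other colour to everything after some `g`. The side of a cut that contains `v` takes all
    -- these vertices, and the other side keeps at most `g`. Thus `v` serves as both spared
    -- vertices.
    star-finite : ∀ n₀ → (∀ z → n₀ < z → ¬ Inf Y z) → Star (not Y)
    star-finite n₀ h F = n , v , v , v≤n , v≤n , λ t n≤t S D nS _ cl → go t n≤t S D nS cl
      where
      v = suc (n₀ + bound F)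
      v∉F : v ∉ F
      v∉F i = 1+n≰n (≤-trans (s≤s (m≤n+m (bound F) n₀)) (∈bound F i))
      gg : ∃ λ g → ∀ w → g < w → ¬ E Y v w
      gg = dne λ no → h v (s≤s (m≤m+n n₀ _)) λ m → dne λ no′ → no (m , λ w lt e → no′ (w , lt , e))
      g = proj₁ gg
      n = v + (3 * g + length F + 1)
      v≤n : v ≤ n
      v≤n = m≤m+n v _
      go : ∀ t → n ≤ t → (S D : ℕ → Set) → ¬ S v → Closed (not Y) (Out F ∖ S) D t →
           (3 * # D t + length F < t) ⊎ (3 * # (Out F ∖ S ∖ D) t + length F < t)
      go t n≤t S D nS cl with em {D v}
      ... | yes dv = inj₂ (few-below g (length F) _ t
              (≤-trans (#-mono {Out F ∖ S ∖ D} {_≤ g} t (λ w _ b q → ≮⇒≥ λ lt → proj₂ q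
                  (Closed.step cl v w (≤-trans v≤n n≤t) b dv (proj₁ q) (¬E⇒E (proj₂ gg w lt)))))
                (#-below g t)) (≤-trans (m≤n+m _ v) n≤t))
      ... | no nd = inj₁ (few-below g (length F) _ t
              (≤-trans (#-mono {D} {_≤ g} t (λ w _ b q → ≮⇒≥ λ lt → nd
                  (Closed.step cl w v b (≤-trans v≤n n≤t) q ((s≤s z≤n , v∉F) , nS) (E-sym (¬E⇒E (proj₂ gg w lt))))))
                (#-below g t)) (≤-trans (m≤n+m _ v) n≤t))

    module _ (infinite : ∀ n → ∃ λ z → n < z × Inf Y z) (P : List ℕ) (good : InfEnd Y P) (N k : ℕ)
             (fails : ¬ Extends (InfEnd Y) P N k) where

      private
        y = end (isSeg good)
        s = seg (isSeg good)

      -- A closed set `D` and its complement span a complete bipartite Y-graph. The end of `P` has a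
      -- Y-neighbour `v` beyond `F` and `P`, and a later `z` has infinite Y-degree. If both sides
      -- were at least about t/3, a zigzag between `v` and `z` through nearly 2t/3 vertices would
      -- extend `P` in the way that `fails` forbids. The deleted set must spare `v` and `z` because
      -- both have to lie on one of the two sides.
      star-fails : Star (not Y)
      star-fails F = n , v , z , ≤-trans (≤-trans (n≤1+n v) v<z) z≤n′ , z≤n′ , λ t n≤t S D nv nz cl → go t n≤t S D nv nz cl
        where
        b₀ = bound F + bound P
        ev = infEnd good b₀
        v = proj₁ ev
        ez = infinite v
        z = proj₁ ez
        v<z : v < z
        v<z = proj₁ (proj₂ ez)
        f = length F
        p = length P
        -- The first summand keeps the vertices lost in the zigzag within the defect t/k, the second
        -- leaves a usable vertex on each side.
        slack = k * (3 * p + 12 + 2 * f) + (3 * p + f + 10)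
        n = z + (N + slack + 1)
        z≤n′ : z ≤ n
        z≤n′ = m≤m+n z _
        b₀<v : b₀ < v
        b₀<v = proj₁ (proj₂ ev)
        out : ∀ w → b₀ < w → w ∉ F × w ∉ P
        out w lt = (λ i → 1+n≰n (≤-trans lt (≤-trans (∈bound F i) (m≤m+n _ _)))) ,
                   (λ i → 1+n≰n (≤-trans lt (≤-trans (∈bound P i) (m≤n+m _ _))))
        b₀<z : b₀ < z
        b₀<z = <-trans b₀<v v<z
        go : ∀ t → n ≤ t → (S D : ℕ → Set) → ¬ S v → ¬ S z → Closed (not Y) (Out F ∖ S) D t →
             (3 * # D t + length F < t) ⊎ (3 * # (Out F ∖ S ∖ D) t + length F < t)
        go t n≤t S D nv nz cl with em {3 * # D t + length F < t} | em {3 * # (Out F ∖ S ∖ D) t + length F < t}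
        ... | yes a | _ = inj₁ a
        ... | no _ | yes b = inj₂ b
        ... | no a | no b = ⊥-elim (fails ([] , proj₁ path , t , N≤t , new-good , below , long))
          where
          D′ = Out F ∖ S ∖ D
          A₀ B₀ : ℕ → Set
          A₀ w = w ≤ t × D w
          B₀ w = w ≤ t × D′ w
          complete : ∀ x y → A₀ x → B₀ y → E Y x y
          complete x y (xt , dx) (yt , ay , ndy) = ¬E⇒E′ (λ e → ndy (Closed.step cl x y xt yt dx ay e))
          bad = v ∷ z ∷ P
          xs = els (λ w → D w × w ∉ bad) t
          ys = els (λ w → D′ w × w ∉ bad) t
          N≤t : N ≤ t
          N≤t = ≤-trans (≤-trans (≤-trans (m≤m+n N slack) (m≤m+n _ 1)) (m≤n+m _ z)) n≤t
          slack<t : slack < t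
          slack<t = ≤-trans (≤-trans (≤-trans (≤-reflexive (+-comm 1 slack)) (+-monoˡ-≤ 1 (m≤n+m slack N))) (m≤n+m _ z)) n≤t
          len : ∀ (C : ℕ → Set) → # C t ≤ length (els (λ w → C w × w ∉ bad) t) + (2 + p)
          len C = ≤-trans (#-∪ {C} {λ w → C w × w ∉ bad} {_∈ bad} t (λ w _ _ cw → [ inj₂ , (λ n → inj₁ (cw , n)) ]′ (lem (w ∈ bad))))
                          (+-mono-≤ (≤-reflexive (sym (els-length (λ w → C w × w ∉ bad) t))) (#-∈≤length t bad))
          j = length xs ⊓ length ys
          t≤j : t ≤ 3 * j + 3 * p + 6 + f
          t≤j with ⊓-sel (length xs) (length ys)
          ... | inj₁ e rewrite e = bipartite-side t (# D t) (length xs) p f (≮⇒≥ a) (len D)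
          ... | inj₂ e rewrite e = bipartite-side t (# D′ t) (length ys) p f (≮⇒≥ b) (len D′)
          1≤j : 1 ≤ j
          1≤j = bipartite-nonempty t p f j t≤j (≤-trans (m≤n+m _ (k * (3 * p + 12 + 2 * f))) (≤-trans (n≤1+n _) slack<t))
          hx : ∀ x → x ∈ xs → A₀ x
          hx x i = let _ , b , d , _ = ∈els _ t i in b , d
          hy : ∀ x → x ∈ ys → B₀ x
          hy x i = let _ , b , d , _ = ∈els _ t i in b , d
          module AB = Bipartite {Y} A₀ B₀ complete
          module BA = Bipartite {Y} B₀ A₀ (λ x y a b → E-sym (complete y x b a))
          z≤t : z ≤ t
          z≤t = ≤-trans z≤n′ n≤t
          v≤t : v ≤ t
          v≤t = ≤-trans (<⇒≤ v<z) z≤t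
          W = z ∷ v ∷ xs ++ ys
          side : ∀ w → b₀ < w → w ≤ t → ¬ S w → A₀ w ⊎ B₀ w
          side w lt wt nS with em {D w}
          ... | yes d = inj₁ (wt , d)
          ... | no nd = inj₂ (wt , ((≤-trans (s≤s z≤n) lt , proj₁ (out w lt)) , nS) , nd)
          swap-cnt : ∀ a → cnt a (z ∷ v ∷ ys ++ xs) ≤ cnt a W
          swap-cnt a = +-monoʳ-≤ (bit (a ≟ z)) (+-monoʳ-≤ (bit (a ≟ v))
            (≤-reflexive (trans (cnt-++ a ys xs) (trans (+-comm (cnt a ys) _) (sym (cnt-++ a xs ys))))))
          path : ∃ λ L → Seg Y z v L × (∀ a → cnt a L ≤ cnt a W) × 2 * j ≤ length L
          path with side v b₀<v v≤t nv | side z b₀<z z≤t nz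
          ... | inj₁ va | inj₁ za = AB.same xs ys j hx hy va za (m⊓n≤m _ _) (m⊓n≤n (length xs) _) 1≤j
          ... | inj₂ vb | inj₁ za = AB.cross xs ys j hx hy vb za (m⊓n≤m _ _) (m⊓n≤n (length xs) _)
          ... | inj₁ va | inj₂ zb = let L , q , m , l = BA.cross ys xs j hy hx va zb (m⊓n≤n (length xs) _) (m⊓n≤m _ _) in
                                    L , q , (λ a → ≤-trans (m a) (swap-cnt a)) , l
          ... | inj₂ vb | inj₂ zb = let L , q , m , l = BA.same ys xs j hy hx vb zb (m⊓n≤n (length xs) _) (m⊓n≤m _ _) 1≤j in
                                    L , q , (λ a → ≤-trans (m a) (swap-cnt a)) , l
          L = proj₁ path
          xs-ys : Dist (xs ++ ys)
          xs-ys = dist-++ {xs} {ys} (els-dist _ t) (els-dist _ t) (λ a i i′ → proj₂ (proj₂ (hy a i′)) (proj₂ (hx a i)))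
          ∉bad : ∀ a → a ∈ xs ++ ys → a ∉ bad
          ∉bad a i with ∈-++⁻ xs i
          ... | inj₁ i = let _ , _ , _ , n = ∈els _ t i in n
          ... | inj₂ i = let _ , _ , _ , n = ∈els _ t i in n
          W-dist : Dist (W ++ P)
          W-dist = dist-++ {W} {P}
            (dist-∷ {z} {v ∷ xs ++ ys}
              (dist-∷ {v} {xs ++ ys} xs-ys (λ i → ∉bad v i (here refl)))
              (λ { (here e) → 1+n≰n (≤-trans v<z (≤-reflexive e)) ; (there i) → ∉bad z i (there (here refl)) }))
            (dist (isSeg good))
            (λ { a (here refl) i → proj₂ (out z b₀<z) i ; a (there (here refl)) i → proj₂ (out v b₀<v) i
               ; a (there (there i)) i′ → ∉bad a i (there (there i′)) })
          LP-cnt : ∀ a → cnt a (L ++ P) ≤ cnt a (W ++ P)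
          LP-cnt a = ≤-trans (≤-reflexive (cnt-++ a L P)) (≤-trans (+-monoˡ-≤ (cnt a P) (proj₁ (proj₂ (proj₂ path)) a)) (≤-reflexive
              (sym (cnt-++ a W P))))
          inW : ∀ a → a ∈ W → 1 ≤ a × a ≤ t
          inW a (here refl) = ≤-trans (s≤s z≤n) b₀<z , z≤t
          inW a (there (here refl)) = ≤-trans (s≤s z≤n) b₀<v , v≤t
          inW a (there (there i)) with ∈-++⁻ xs i
          ... | inj₁ i = let q , r , _ = ∈els _ t i in q , r
          ... | inj₂ i = let q , r , _ = ∈els _ t i in q , r
          new-good : InfEnd Y (L ++ P)
          new-good = record
            { isSeg = record { seg = join (proj₁ (proj₂ path)) (E-sym (proj₂ (proj₂ ev))) s
                             ; dist = λ a → ≤-trans (LP-cnt a) (W-dist a)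
                             ; pos = λ w i → [ (λ i → proj₁ (inW w (∈-cnt≤ (proj₁ (proj₂ (proj₂ path))) i))) , pos (isSeg good) w ]′
                                 (∈-++⁻ L i) }
            ; infEnd = proj₂ (proj₂ ez) }
          below : ∀ w → w ∈ L ++ P → w ≤ t
          below w i = [ (λ i → proj₂ (inW w (∈-cnt≤ (proj₁ (proj₂ (proj₂ path))) i))) ,
                        (λ i → ≤-trans (∈bound P i) (≤-trans (m≤n+m _ (bound F)) (≤-trans (<⇒≤ b₀<z) z≤t))) ]′ (∈-++⁻ L i)
          long : 2 * k * t < 3 * k * length (L ++ P) + 3 * t
          long = bipartite-long k t j p f (length (L ++ P)) (*-monoʳ-≤ k t≤j) (≤-trans (s≤s (m≤m+n _ _)) slack<t)
                   (*-monoʳ-≤ k (≤-trans (+-monoˡ-≤ p (proj₂ (proj₂ (proj₂ path)))) (≤-reflexive (sym (length-++ L)))))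

    -- If infinitely many vertices have infinite Y-degree, an end of infinite degree is a suitable
    -- invariant for the limit construction: either it can be restored at every stage, or a single
    -- failing extension feeds `star-fails`.
    dense⊎star : Dense Y ⊎ Star (not Y)
    dense⊎star with em {∀ n → ∃ λ z → n < z × Inf Y z}
    ... | no h = let n₀ , g = few in inj₂ (star-finite n₀ g)
      where few : ∃ λ n₀ → ∀ z → n₀ < z → ¬ Inf Y z
            few = dne λ no → h λ n → dne λ no′ → no (n , λ z lt i → no′ (z , lt , i))
    ... | yes infinite with em {∀ P → InfEnd Y P → ∀ N k → Extends (InfEnd Y) P N k}
    ...   | yes w = let z , lt , i = infinite 0 in
            inj₁ (Limit.dense {Y} (InfEnd Y) (λ P → isSeg) (λ P g N k _ → w P g N k) (z ∷ [])
              (record { isSeg = record { seg = single ; dist = dist-single z ; pos = λ { v (here refl) → lt } } ; infEnd = i }))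
    ...   | no nw = let P , good , N , k , f = failure in inj₂ (star-fails infinite P good N k f)
      where failure : ∃ λ P → InfEnd Y P × ∃ λ N → ∃ λ k → ¬ Extends (InfEnd Y) P N k
            failure = dne λ no → nw λ P g N k → dne λ no′ → no (P , g , N , k , no′)

  -- Merging many paths through connectors

  module Merge (Y : Bool) (U : ℕ → Set) where

    -- `near` is enough to join some two of three ends. `link` joins two prescribed ones; it is
    -- needed where no third end is left to choose from.
    record Window (w : ℕ × ℕ) : Set where
      constructor window
      private
        b = proj₁ w
        b′ = proj₂ w
      field
        near : ∀ u → U u → E Y b u ⊎ E Y b′ u
        link : ∀ u u′ → U u → U u′ → u ≢ u′ → E Y u u′ ⊎ (E Y b u × E Y b u′) ⊎ (E Y b′ u × E Y b′ u′)
    open Window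

    flat₂ : List (ℕ × ℕ) → List ℕ
    flat₂ [] = []
    flat₂ ((b , b′) ∷ ws) = b ∷ b′ ∷ flat₂ ws

    record Piece : Set where
      field
        {hd lst} : ℕ
        xs : List ℕ
        seg : Seg Y hd lst xs
        hd∈U : U hd
        lst∈U : U lst

    flat : List Piece → List ℕ
    flat [] = []
    flat (p ∷ ps) = Piece.xs p ++ flat ps

    Connector : ℕ × ℕ → ℕ → Set
    Connector (b , b′) k = ∀ a → bit (a ≟ k) ≤ bit (a ≟ b) + bit (a ≟ b′)

    fst-conn : ∀ {w} → Connector w (proj₁ w)
    fst-conn a = m≤m+n _ _

    snd-conn : ∀ {w} → Connector w (proj₂ w)
    snd-conn {b , b′} a = m≤n+m _ (bit (a ≟ b))

    -- Every vertex of U is joined to b or to b′, so two of any three are joined to the same one.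
    pick : ∀ {w e h h′} → Window w → U e → U h → U h′ → ∃ λ k → Connector w k ×
           ((E Y k e × E Y k h) ⊎ (E Y k e × E Y k h′) ⊎ (E Y k h × E Y k h′))
    pick {w} {e} {h} {h′} W ue uh uh′ with near W e ue | near W h uh | near W h′ uh′
    ... | inj₁ p | inj₁ q | _ = proj₁ w , fst-conn {w} , inj₁ (p , q)
    ... | inj₁ p | inj₂ q | inj₁ r = proj₁ w , fst-conn {w} , inj₂ (inj₁ (p , r))
    ... | inj₁ p | inj₂ q | inj₂ r = proj₂ w , snd-conn {w} , inj₂ (inj₂ (q , r))
    ... | inj₂ p | inj₂ q | _ = proj₂ w , snd-conn {w} , inj₁ (p , q)
    ... | inj₂ p | inj₁ q | inj₂ r = proj₂ w , snd-conn {w} , inj₂ (inj₁ (p , r))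
    ... | inj₂ p | inj₁ q | inj₁ r = proj₁ w , fst-conn {w} , inj₂ (inj₂ (q , r))

    joint : ∀ {w u u′} → Window w → U u → U u′ → u ≢ u′ → E Y u u′ ⊎ ∃ λ k → Connector w k × E Y k u × E Y k u′
    joint {w} {u} {u′} W a b n with link W u u′ a b n
    ... | inj₁ e = inj₁ e
    ... | inj₂ (inj₁ x) = inj₂ (proj₁ w , fst-conn {w} , x)
    ... | inj₂ (inj₂ x) = inj₂ (proj₂ w , snd-conn {w} , x)

    record Joined (u v : ℕ) (xs : List ℕ) (k : ℕ) (ys : List ℕ) : Set where
      field
        zs : List ℕ
        seg : Seg Y u v zs
        cnts : ∀ a → cnt a zs ≡ cnt a xs + (bit (a ≟ k) + cnt a ys)
        len : length zs ≡ length xs + suc (length ys)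

    attach : ∀ {h l e s xs ys k} → Seg Y h l xs → Seg Y e s ys → E Y k h → E Y k e → Joined l s xs k ys
    attach {xs = xs} {ys} {k} p q kh ke with rev p
    ... | zs , r , m , n = record { zs = zs ++ k ∷ ys ; seg = join r (E-sym kh) (cons ke q)
        ; cnts = λ a → trans (cnt-++ a zs (k ∷ ys)) (cong (_+ (bit (a ≟ k) + cnt a ys)) (m a))
        ; len = trans (length-++ zs) (cong (_+ suc (length ys)) n) }

    record Result (s u : ℕ) (cs ws ps : List ℕ) (n : ℕ) : Set where
      field
        {top} : ℕ
        L : List ℕ
        seg : Seg Y top s L
        to : E Y u top
        cnts : ∀ a → cnt a L ≤ cnt a cs + (cnt a ws + cnt a ps)
        len : length cs + length ps + n ≤ length L

    ∈≢ : ∀ {u v} {xs ys : List ℕ} (w z : ℕ → ℕ) → u ∈ xs → v ∈ ys → (∀ a → cnt a xs + (w a + (cnt a ys + z a)) ≤ 1) → u ≢ v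
    ∈≢ {u} {xs = xs} {ys} w z i j h refl = disjoint-front (cnt u xs) (w u) (cnt u ys) (z u) (h u) (∈⇒cnt i) (∈⇒cnt j)

    -- `pick` joins two of three ends: the free end `e` of the growing path and the heads of the
    -- next two pieces. Each such step uses one window, adds a connector and lowers the number of
    -- pieces by one. The last piece has to be joined at prescribed ends, to the growing path and to
    -- `u`. This takes `link` and two more windows; a direct edge may replace a connector there, so
    -- these two connectors are not counted in the length.
    merge : ∀ ws {cs e s u} (p : Piece) (ps : List Piece) → Seg Y e s cs → U e → U u → All Window ws →
            length ws ≡ 2 + length ps →
            (∀ a → cnt a cs + (cnt a (flat₂ ws) + (cnt a (flat (p ∷ ps)) + cnt a (u ∷ []))) ≤ 1) →
            Result s u cs (flat₂ ws) (flat (p ∷ ps)) (length ps)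
    merge (w ∷ w′ ∷ ws) {cs} {e} {s} {u} p [] sg ue uu (W ∷ W′ ∷ _) _ d =
        close (joint {w} W ue (hd∈U) e≢h)
      where
      open Piece p renaming (seg to pseg)
      d′ : ∀ a → cnt a cs + (cnt a (flat₂ (w ∷ w′ ∷ ws)) + (cnt a xs + cnt a (u ∷ []))) ≤ 1
      d′ a = subst (λ z → cnt a cs + (cnt a (flat₂ (w ∷ w′ ∷ ws)) + (z + cnt a (u ∷ []))) ≤ 1) (trans (cnt-++ a xs []) (+-identityʳ _))
          (d a)
      e≢h : e ≢ hd
      e≢h = ∈≢ {xs = cs} {xs} (λ a → cnt a (flat₂ (w ∷ w′ ∷ ws))) (λ a → cnt a (u ∷ [])) (seg-first∈ sg) (seg-first∈ pseg) d′
      l≢u : lst ≢ u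
      l≢u refl = disjoint-back (cnt u cs) (cnt u (flat₂ (w ∷ w′ ∷ ws))) (cnt u xs) _ (d′ u) (∈⇒cnt (seg-last∈ pseg))
          (∈⇒cnt {u} {u ∷ []} (here refl))
      wc = λ a → bit (a ≟ proj₁ w) + bit (a ≟ proj₂ w)
      wc′ = λ a → bit (a ≟ proj₁ w′) + bit (a ≟ proj₂ w′)
      regroup : ∀ a {x} → x ≤ cnt a cs + ((wc a + (wc′ a + cnt a (flat₂ ws))) + (cnt a xs + 0)) →
                x ≤ cnt a cs + (cnt a (flat₂ (w ∷ w′ ∷ ws)) + cnt a (flat (p ∷ [])))
      regroup a h = ≤-trans h (≤-reflexive (cong (cnt a cs +_) (cong₂ _+_
          (trans (cong (wc a +_) (+-assoc (bit (a ≟ proj₁ w′)) _ _)) (+-assoc (bit (a ≟ proj₁ w)) _ _)) (sym (cnt-++ a xs [])))))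
      lenp : length (flat (p ∷ [])) ≡ length xs + 0
      lenp = length-++ xs
      finish : ∀ zs → Seg Y lst s zs → (ks : ℕ → ℕ) → (∀ a → cnt a zs ≡ cnt a xs + (ks a + cnt a cs)) → (∀ a → ks a ≤ wc a) →
               length xs + length cs ≤ length zs → Result s u cs (flat₂ (w ∷ w′ ∷ ws)) (flat (p ∷ [])) 0
      finish zs sz ks cz ksw lz with joint {w′} W′ lst∈U uu l≢u
      ... | inj₁ e′ = record { L = zs ; seg = sz ; to = E-sym e′
            ; cnts = λ a → regroup a (≤-trans (≤-reflexive (cz a)) (close-count₂ (cnt a xs) (cnt a cs) (wc a) (wc′ a) (cnt a
                (flat₂ ws)) (ks a) 0 (ksw a)))
            ; len = subst (λ x → length cs + x + 0 ≤ length zs) (sym lenp) (close-length (length xs) (length cs) (length zs) lz) }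
      ... | inj₂ (k , ck , kl , ku) = record { L = k ∷ zs ; seg = cons kl sz ; to = E-sym ku
            ; cnts = λ a → regroup a (≤-trans (≤-reflexive (cong (bit (a ≟ k) +_) (cz a)))
                             (close-count₁ (cnt a xs) (cnt a cs) (wc a) (wc′ a) (cnt a (flat₂ ws)) (ks a) (bit (a ≟ k)) (ksw a) (ck a)))
            ; len = subst (λ x → length cs + x + 0 ≤ suc (length zs)) (sym lenp) (close-length (length xs) (length cs) _ (≤-trans lz
                (n≤1+n _))) }
      close : (E Y e hd ⊎ ∃ λ k → Connector w k × E Y k e × E Y k hd) → Result s u cs (flat₂ (w ∷ w′ ∷ ws)) (flat (p ∷ [])) 0
      close (inj₁ eh) with rev pseg
      ... | zs , r , m , n = finish (zs ++ cs) (join r (E-sym eh) sg) (λ _ → 0) (λ a → trans (cnt-++ a zs cs) (cong (_+ cnt a cs)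
          (m a))) (λ _ → z≤n)
                               (≤-reflexive (sym (trans (length-++ zs) (cong (_+ length cs) n))))
      close (inj₂ (k , ck , ke , kh)) = finish (Joined.zs Jn) (Joined.seg Jn) (λ a → bit (a ≟ k)) (Joined.cnts Jn) ck
                               (≤-trans (+-monoʳ-≤ (length xs) (n≤1+n _)) (≤-reflexive (sym (Joined.len Jn))))
        where Jn = attach pseg sg kh ke
    merge (w ∷ ws) {cs} {e} {s} {u} p (p′ ∷ ps) sg ue uu (W ∷ Ws) lw d = go (pick {w} W ue P.hd∈U P′.hd∈U)
      where
      module P = Piece p
      module P′ = Piece p′
      wc = λ a → bit (a ≟ proj₁ w) + bit (a ≟ proj₂ w)
      u₁ = λ a → cnt a (u ∷ [])
      eq-p : ∀ a → cnt a (flat (p ∷ p′ ∷ ps)) ≡ cnt a P.xs + (cnt a P′.xs + cnt a (flat ps))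
      eq-p a = trans (cnt-++ a P.xs _) (cong (cnt a P.xs +_) (cnt-++ a P′.xs _))
      eq-l : length (flat (p ∷ p′ ∷ ps)) ≡ length P.xs + (length P′.xs + length (flat ps))
      eq-l = trans (length-++ P.xs) (cong (length P.xs +_) (length-++ P′.xs))
      d′ : ∀ a → cnt a cs + ((wc a + cnt a (flat₂ ws)) + ((cnt a P.xs + (cnt a P′.xs + cnt a (flat ps))) + u₁ a)) ≤ 1
      d′ a = subst₂ (λ y z → cnt a cs + (y + (z + u₁ a)) ≤ 1) (sym (+-assoc (bit (a ≟ proj₁ w)) _ _)) (eq-p a) (d a)
      out : ∀ a {x} → x ≤ cnt a cs + ((wc a + cnt a (flat₂ ws)) + (cnt a P.xs + (cnt a P′.xs + cnt a (flat ps)))) →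
            x ≤ cnt a cs + (cnt a (flat₂ (w ∷ ws)) + cnt a (flat (p ∷ p′ ∷ ps)))
      out a h = ≤-trans h (≤-reflexive (cong (cnt a cs +_) (cong₂ _+_ (+-assoc (bit (a ≟ proj₁ w)) _ _) (sym (eq-p a)))))
      lw′ : length ws ≡ 2 + length ps
      lw′ = suc-injective lw
      go : (∃ λ k → Connector w k × ((E Y k e × E Y k P.hd) ⊎ (E Y k e × E Y k P′.hd) ⊎ (E Y k P.hd × E Y k P′.hd))) →
           Result s u cs (flat₂ (w ∷ ws)) (flat (p ∷ p′ ∷ ps)) (suc (length ps))
      go (k , ck , inj₁ (ke , kh)) = record { L = R.L ; seg = R.seg ; to = R.to
          ; cnts = λ a → out a (merge-count₂ (cnt a R.L) (cnt a P.xs) (bit (a ≟ k)) (cnt a cs) (cnt a (flat₂ ws)) (cnt a P′.xs)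
              (cnt a (flat ps)) (wc a)
                     (subst₂ (λ y z → cnt a R.L ≤ y + (cnt a (flat₂ ws) + z)) (Jn.cnts a) (cnt-++ a P′.xs _) (R.cnts a)) (ck a))
          ; len = subst (λ x → length cs + x + suc (length ps) ≤ length R.L) (sym eq-l)
                    (merge-length₁ (length R.L) (length P.xs) (length cs) (length P′.xs) (length (flat ps)) (length ps)
                      (subst₂ (λ y z → y + z + length ps ≤ length R.L) Jn.len (length-++ P′.xs) R.len)) }
        where module Jn = Joined (attach P.seg sg kh ke)
              module R = Result (merge ws {Jn.zs} {P.lst} {s} {u} p′ ps Jn.seg P.lst∈U uu Ws lw′
                          (λ a → subst₂ (λ y z → y + (cnt a (flat₂ ws) + (z + u₁ a)) ≤ 1) (sym (Jn.cnts a)) (sym (cnt-++ a P′.xs _))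
                            (merge-count₁ (cnt a cs) (wc a) (cnt a (flat₂ ws)) (cnt a P.xs) (cnt a P′.xs) (u₁ a) (bit (a ≟ k)) (cnt a
                                (flat ps)) (d′ a) (ck a))))
      go (k , ck , inj₂ (inj₁ (ke , kh))) = record { L = R.L ; seg = R.seg ; to = R.to
          ; cnts = λ a → out a (merge-count₄ (cnt a R.L) (cnt a P.xs) (bit (a ≟ k)) (cnt a cs) (cnt a (flat₂ ws)) (cnt a P′.xs)
              (cnt a (flat ps)) (wc a)
                     (subst₂ (λ y z → cnt a R.L ≤ y + (cnt a (flat₂ ws) + z)) (Jn.cnts a) (cnt-++ a P.xs _) (R.cnts a)) (ck a))
          ; len = subst (λ x → length cs + x + suc (length ps) ≤ length R.L) (sym eq-l)
                    (merge-length₂ (length R.L) (length P.xs) (length cs) (length P′.xs) (length (flat ps)) (length ps)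
                      (subst₂ (λ y z → y + z + length ps ≤ length R.L) Jn.len (length-++ P.xs) R.len)) }
        where module Jn = Joined (attach P′.seg sg kh ke)
              module R = Result (merge ws {Jn.zs} {P′.lst} {s} {u} p ps Jn.seg P′.lst∈U uu Ws lw′
                          (λ a → subst₂ (λ y z → y + (cnt a (flat₂ ws) + (z + u₁ a)) ≤ 1) (sym (Jn.cnts a)) (sym (cnt-++ a P.xs _))
                            (merge-count₃ (cnt a cs) (wc a) (cnt a (flat₂ ws)) (cnt a P.xs) (cnt a P′.xs) (u₁ a) (bit (a ≟ k)) (cnt a
                                (flat ps)) (d′ a) (ck a))))
      go (k , ck , inj₂ (inj₂ (kh , kh′))) = record { L = R.L ; seg = R.seg ; to = R.to
          ; cnts = λ a → out a (merge-count₆ (cnt a R.L) (cnt a P.xs) (bit (a ≟ k)) (cnt a cs) (cnt a (flat₂ ws)) (cnt a P′.xs)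
              (cnt a (flat ps)) (wc a)
                     (subst (λ z → cnt a R.L ≤ cnt a cs + (cnt a (flat₂ ws) + z)) (eq-q a) (R.cnts a)) (ck a))
          ; len = subst (λ x → length cs + x + suc (length ps) ≤ length R.L) (sym eq-l)
                    (merge-length₃ (length R.L) (length P.xs) (length cs) (length P′.xs) (length (flat ps)) (length ps)
                      (subst (λ z → length cs + z + length ps ≤ length R.L) eq-ql R.len)) }
        where module Jn = Joined (attach P.seg P′.seg kh kh′)
              q : Piece
              q = record { xs = Jn.zs ; seg = Jn.seg ; hd∈U = P.lst∈U ; lst∈U = P′.lst∈U }
              eq-q : ∀ a → cnt a (flat (q ∷ ps)) ≡ (cnt a P.xs + (bit (a ≟ k) + cnt a P′.xs)) + cnt a (flat ps)
              eq-q a = trans (cnt-++ a Jn.zs _) (cong (_+ cnt a (flat ps)) (Jn.cnts a))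
              eq-ql : length (flat (q ∷ ps)) ≡ (length P.xs + suc (length P′.xs)) + length (flat ps)
              eq-ql = trans (length-++ Jn.zs) (cong (_+ length (flat ps)) Jn.len)
              module R = Result (merge ws {cs} {e} {s} {u} q ps sg ue uu Ws lw′
                          (λ a → subst (λ z → cnt a cs + (cnt a (flat₂ ws) + (z + u₁ a)) ≤ 1) (sym (eq-q a))
                            (merge-count₅ (cnt a cs) (wc a) (cnt a (flat₂ ws)) (cnt a P.xs) (cnt a P′.xs) (u₁ a) (bit (a ≟ k)) (cnt a
                                (flat ps)) (d′ a) (ck a))))

  -- Partition of a vertex set into two monochromatic paths

  Chain : Bool → List ℕ → Set
  Chain Y xs = xs ≡ [] ⊎ ∃ λ u → ∃ λ v → Seg Y u v xs

  chain-∷ : ∀ {Y u x xs} → E Y u x → Chain Y (x ∷ xs) → Chain Y (u ∷ x ∷ xs)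
  chain-∷ {Y} {u} e (inj₂ (_ , v , s)) = inj₂ (u , v , cons (subst (E Y u) (sym (seg-head s)) e) s)

  chain-tail : ∀ {Y x xs} → Chain Y (x ∷ xs) → Chain Y xs
  chain-tail (inj₂ (_ , _ , single)) = inj₁ refl
  chain-tail (inj₂ (_ , v , cons _ s)) = inj₂ (_ , v , s)

  -- Gerencsér–Gyárfás: adding a vertex to one of the two paths may cost the other path its end vertex.
  two-paths : ∀ X Y → (∀ u v → E X u v ⊎ E Y u v) → ∀ us → ∃ λ xs → ∃ λ ys → Chain X xs × Chain Y ys ×
              (∀ a → cnt a xs + cnt a ys ≤ cnt a us) × length us ≤ length xs + length ys
  two-paths X Y dich [] = [] , [] , inj₁ refl , inj₁ refl , (λ _ → z≤n) , z≤n
  two-paths X Y dich (u ∷ us) with two-paths X Y dich us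
  ... | [] , ys , _ , cy , m , l = u ∷ [] , ys , inj₂ (u , u , single) , cy ,
          (λ a → ≤-trans (≤-reflexive (+-assoc (bit (a ≟ u)) 0 _)) (+-monoʳ-≤ (bit (a ≟ u)) (m a))) , s≤s l
  ... | x ∷ xs , [] , cx , _ , m , l = x ∷ xs , u ∷ [] , cx , inj₂ (u , u , single) ,
          (λ a → two-paths-count₃ (bit (a ≟ u)) (cnt a (x ∷ xs)) 0 (cnt a us) (m a)) , two-paths-length₃ (suc (length xs)) 0 (length us) l
  ... | x ∷ xs , y ∷ ys , cx , cy , m , l with dich u x
  ...   | inj₁ e = u ∷ x ∷ xs , y ∷ ys , chain-∷ e cx , cy ,
            (λ a → ≤-trans (≤-reflexive (+-assoc (bit (a ≟ u)) _ _)) (+-monoʳ-≤ (bit (a ≟ u)) (m a))) , s≤s l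
  ...   | inj₂ ux with dich u y
  ...     | inj₂ e = x ∷ xs , u ∷ y ∷ ys , cx , chain-∷ e cy ,
              (λ a → two-paths-count₃ (bit (a ≟ u)) (cnt a (x ∷ xs)) (cnt a (y ∷ ys)) (cnt a us) (m a)) , two-paths-length₃ (suc
                  (length xs)) (suc (length ys)) (length us) l
  ...     | inj₁ uy with dich x y
  ...       | inj₁ xy = u ∷ y ∷ x ∷ xs , ys , chain-∷ uy (chain-∷ (E-sym xy) cx) , chain-tail cy ,
                (λ a → two-paths-count₁ (bit (a ≟ u)) (bit (a ≟ x)) (cnt a xs) (bit (a ≟ y)) (cnt a ys) (cnt a us) (m a)) ,
                two-paths-length₁ (length xs) (length ys) (length us) l
  ...       | inj₂ xy = xs , u ∷ x ∷ y ∷ ys , chain-tail cx , chain-∷ ux (chain-∷ xy cy) ,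
                (λ a → two-paths-count₂ (bit (a ≟ u)) (bit (a ≟ x)) (cnt a xs) (bit (a ≟ y)) (cnt a ys) (cnt a us) (m a)) ,
                two-paths-length₂ (length xs) (length ys) (length us) l

  -- Blocks of six consecutive vertices and the gain from cliques

  sum : (ℕ → Set) → List ℕ → ℕ
  sum P [] = 0
  sum P (x ∷ xs) = bit (em {P x}) + sum P xs

  sum≤# : ∀ {P : ℕ → Set} t xs → Dist xs → (∀ v → v ∈ xs → 1 ≤ v × v ≤ t) → sum P xs ≤ # P t
  sum≤# t [] d h = z≤n
  sum≤# {P} t (x ∷ xs) d h with em {P x}
  ... | no _ = sum≤# t xs (dist-tail {x} {xs} d) (λ v i → h v (there i))
  ... | yes p = ≤-trans (+-mono-≤ (#-pos {_≡ x} t x (proj₁ hx) (proj₂ hx) refl)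
                   (≤-trans (go xs (dist-head {x} {xs} d)) (sum≤# {λ v → P v × v ≢ x} t xs (dist-tail {x} {xs} d) (λ v i → h v (there i)))))
                 (#-disj {_≡ x} {λ v → P v × v ≢ x} {P} t (λ { v _ _ refl → p }) (λ v _ _ → proj₁) (λ v _ _ e q → proj₂ q e))
    where hx = h x (here refl)
          go : ∀ ys → x ∉ ys → sum P ys ≤ sum (λ v → P v × v ≢ x) ys
          go [] _ = z≤n
          go (y ∷ ys) n = +-mono-≤ (bit-mono (em {P y}) em (λ py → py , λ { refl → n (here refl) })) (go ys (λ i → n (there i)))

  -- Six vertices fit both uses of a block: three pairs, each of them a window, or two triples, each
  -- carrying a piece of five vertices. The position is recorded because exchanges need vertices
  -- that are consecutive on `Q`.
  record Block (Q H : List ℕ) : Set where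
    field
      pre post : List ℕ
      b₁ b₂ b₃ b₄ b₅ b₆ : ℕ
      at : Q ≡ pre ++ b₁ ∷ b₂ ∷ b₃ ∷ b₄ ∷ b₅ ∷ b₆ ∷ post
      avoids : ∀ v → v ∈ b₁ ∷ b₂ ∷ b₃ ∷ b₄ ∷ b₅ ∷ b₆ ∷ [] → v ∉ H
    six : List ℕ
    six = b₁ ∷ b₂ ∷ b₃ ∷ b₄ ∷ b₅ ∷ b₆ ∷ []

  flat₆ : ∀ {Q H} → List (Block Q H) → List ℕ
  flat₆ [] = []
  flat₆ (b ∷ bs) = Block.six b ++ flat₆ bs

  -- The list is cut into consecutive sixes. A six that is discarded contains a vertex of `H`, and
  -- at most five vertices remain at the end.
  blocks : ∀ {Q H} pre rest → Q ≡ pre ++ rest → ∃ λ (bs : List (Block Q H)) →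
           (∀ a → cnt a (flat₆ bs) ≤ cnt a rest) × length rest ≤ 6 * length bs + 6 * sum (_∈ H) rest + 5 × 6 * length bs ≤ length rest
  blocks {Q} {H} pre (b₁ ∷ b₂ ∷ b₃ ∷ b₄ ∷ b₅ ∷ b₆ ∷ rest) eq
    with blocks {Q} {H} (pre ++ b₁ ∷ b₂ ∷ b₃ ∷ b₄ ∷ b₅ ∷ b₆ ∷ []) rest (trans eq (sym (++-assoc pre _ rest)))
       | em {∃ λ v → v ∈ b₁ ∷ b₂ ∷ b₃ ∷ b₄ ∷ b₅ ∷ b₆ ∷ [] × v ∈ H}
  ... | bs , m , l , l′ | yes (v , i , h) = bs ,
        (λ a → ≤-trans (m a) (≤-trans (m≤n+m (cnt a rest) (cnt a six)) (≤-reflexive (sym (cnt-++ a six rest))))) ,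
        ≤-trans (blocks-hit (length rest) (length bs) (sum (_∈ H) rest) (sum (_∈ H) six) l (hit six i))
                (≤-reflexive (cong (λ x → 6 * length bs + 6 * x + 5) (sym (sum-++ six)))) ,
        ≤-trans l′ (m≤n+m _ 6)
    where
    six = b₁ ∷ b₂ ∷ b₃ ∷ b₄ ∷ b₅ ∷ b₆ ∷ []
    sum-++ : ∀ xs → sum (_∈ H) (xs ++ rest) ≡ sum (_∈ H) xs + sum (_∈ H) rest
    sum-++ [] = refl
    sum-++ (x ∷ xs) = trans (cong (bit (em {x ∈ H}) +_) (sum-++ xs)) (sym (+-assoc (bit (em {x ∈ H})) _ _))
    hit : ∀ xs → v ∈ xs → 1 ≤ sum (_∈ H) xs
    hit (x ∷ xs) (here refl) = ≤-trans (bit-yes (em {x ∈ H}) h) (m≤m+n _ _)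
    hit (x ∷ xs) (there i) = ≤-trans (hit xs i) (m≤n+m _ _)
  ... | bs , m , l , l′ | no none = b ∷ bs ,
        (λ a → ≤-trans (≤-reflexive (cnt-++ a six (flat₆ bs))) (≤-trans (+-monoʳ-≤ (cnt a six) (m a)) (≤-reflexive (sym
            (cnt-++ a six rest))))) ,
        ≤-trans (blocks-free (length rest) (length bs) (sum (_∈ H) rest) (sum (_∈ H) six) l)
                (≤-reflexive (cong (λ x → 6 * suc (length bs) + 6 * x + 5) (sym (sum-++ six)))) ,
        ≤-trans (≤-reflexive (*-suc 6 (length bs))) (+-monoʳ-≤ 6 l′)
    where
    six = b₁ ∷ b₂ ∷ b₃ ∷ b₄ ∷ b₅ ∷ b₆ ∷ []
    b : Block Q H
    b = record { pre = pre ; post = rest ; b₁ = b₁ ; b₂ = b₂ ; b₃ = b₃ ; b₄ = b₄ ; b₅ = b₅ ; b₆ = b₆ ; at = eq ; avoids = λ v i h → none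
        (v , i , h) }
    sum-++ : ∀ xs → sum (_∈ H) (xs ++ rest) ≡ sum (_∈ H) xs + sum (_∈ H) rest
    sum-++ [] = refl
    sum-++ (x ∷ xs) = trans (cong (bit (em {x ∈ H}) +_) (sum-++ xs)) (sym (+-assoc (bit (em {x ∈ H})) _ _))
  blocks pre [] eq = [] , (λ _ → z≤n) , z≤n , z≤n
  blocks pre (_ ∷ []) eq = [] , (λ _ → z≤n) , ≤-trans (s≤s z≤n) (m≤n+m 5 _) , z≤n
  blocks pre (_ ∷ _ ∷ []) eq = [] , (λ _ → z≤n) , ≤-trans (s≤s (s≤s z≤n)) (m≤n+m 5 _) , z≤n
  blocks pre (_ ∷ _ ∷ _ ∷ []) eq = [] , (λ _ → z≤n) , ≤-trans (s≤s (s≤s (s≤s z≤n))) (m≤n+m 5 _) , z≤n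
  blocks pre (_ ∷ _ ∷ _ ∷ _ ∷ []) eq = [] , (λ _ → z≤n) , ≤-trans (s≤s (s≤s (s≤s (s≤s z≤n)))) (m≤n+m 5 _) , z≤n
  blocks pre (_ ∷ _ ∷ _ ∷ _ ∷ _ ∷ []) eq = [] , (λ _ → z≤n) , m≤n+m 5 _ , z≤n

  module Quads (X Y : Bool) (dich : ∀ u v → E X u v ⊎ E Y u v) (U : ℕ → Set) where

    open Merge Y U

    record Quad : Set where
      constructor quad
      field
        {q₁ q₂ q₃ q₄} : ℕ
        in₁ : U q₁
        in₂ : U q₂
        in₃ : U q₃
        in₄ : U q₄
        e₁₂ : E X q₁ q₂ × q₁ ≢ q₂
        e₁₃ : E X q₁ q₃ × q₁ ≢ q₃
        e₁₄ : E X q₁ q₄ × q₁ ≢ q₄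
        e₂₃ : E X q₂ q₃ × q₂ ≢ q₃
        e₂₄ : E X q₂ q₄ × q₂ ≢ q₄
        e₃₄ : E X q₃ q₄ × q₃ ≢ q₄
      four : List ℕ
      four = q₁ ∷ q₂ ∷ q₃ ∷ q₄ ∷ []

    flat₄ : List Quad → List ℕ
    flat₄ [] = []
    flat₄ (q ∷ qs) = Quad.four q ++ flat₄ qs

    -- The negation of an exchange: otherwise b, u, u′, b′ would be an X-path that could be inserted
    -- between `b` and `b′`.
    Separates : ℕ → ℕ → Set
    Separates b b′ = ∀ u u′ → U u → U u′ → u ≢ u′ → E X u u′ → E Y b u ⊎ E Y b′ u′

    record Triple (b₁ b₂ b₃ : ℕ) : Set where
      field
        s₁₂ : Separates b₁ b₂
        s₁₃ : Separates b₁ b₃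
        s₂₃ : Separates b₂ b₃

    record Five (vs : List ℕ) : Set where
      field
        piece : Piece
        len : length (Piece.xs piece) ≡ 5
        cnts : ∀ a → cnt a (Piece.xs piece) ≤ cnt a vs

    -- e is the vertex of the quad that is left out.
    record Three (q : Quad) (e : ℕ) : Set where
      field
        {x y z} : ℕ
        ux : U x
        uy : U y
        uz : U z
        ex : E X e x × e ≢ x
        ey : E X e y × e ≢ y
        ez : E X e z × e ≢ z
        few : ∀ a → cnt a (x ∷ y ∷ z ∷ []) ≤ cnt a (Quad.four q)

    flip-≢ : ∀ {u v : ℕ} → E X u v × u ≢ v → E X v u × v ≢ u
    flip-≢ (e , n) = E-sym e , λ { refl → n refl }

    module _ (q : Quad) where
      open Quad q

      omit₁ : Three q q₁
      omit₁ = record { ux = in₂ ; uy = in₃ ; uz = in₄ ; ex = e₁₂ ; ey = e₁₃ ; ez = e₁₄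
        ; few = cnt-⊆ (_ ∷ʳ refl ∷ refl ∷ refl ∷ []) }

      omit₂ : Three q q₂
      omit₂ = record { ux = in₁ ; uy = in₃ ; uz = in₄ ; ex = flip-≢ e₁₂ ; ey = e₂₃ ; ez = e₂₄
        ; few = cnt-⊆ (refl ∷ _ ∷ʳ refl ∷ refl ∷ []) }

      omit₃ : Three q q₃
      omit₃ = record { ux = in₁ ; uy = in₂ ; uz = in₄ ; ex = flip-≢ e₁₃ ; ey = flip-≢ e₂₃ ; ez = e₃₄
        ; few = cnt-⊆ (refl ∷ refl ∷ _ ∷ʳ refl ∷ []) }

      omit₄ : Three q q₄
      omit₄ = record { ux = in₁ ; uy = in₂ ; uz = in₃ ; ex = flip-≢ e₁₄ ; ey = flip-≢ e₂₄ ; ez = flip-≢ e₃₄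
        ; few = cnt-⊆ (refl ∷ refl ∷ refl ∷ _ ∷ʳ []) }

      AllY : ℕ → Set
      AllY b = E Y b q₁ × E Y b q₂ × E Y b q₃ × E Y b q₄

      all-or-three : ∀ b → AllY b ⊎ ∃ λ e → Three q e × U e × ¬ E Y b e
      all-or-three b with em {E Y b q₁} | em {E Y b q₂} | em {E Y b q₃} | em {E Y b q₄}
      ... | no n | _ | _ | _ = inj₂ (q₁ , omit₁ , in₁ , n)
      ... | yes _ | no n | _ | _ = inj₂ (q₂ , omit₂ , in₂ , n)
      ... | yes _ | yes _ | no n | _ = inj₂ (q₃ , omit₃ , in₃ , n)
      ... | yes _ | yes _ | yes _ | no n = inj₂ (q₄ , omit₄ , in₄ , n)
      ... | yes y₁ | yes y₂ | yes y₃ | yes y₄ = inj₁ (y₁ , y₂ , y₃ , y₄)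

      YThree : ∀ {e} → Three q e → ℕ → Set
      YThree t b = E Y b (Three.x t) × E Y b (Three.y t) × E Y b (Three.z t)

      avoid : ∀ {e b b′} (t : Three q e) → U e → ¬ E Y b e → Separates b b′ → YThree t b′
      avoid {e} {b} {b′} t ue n s = go ux ex , go uy ey , go uz ez
        where
        open Three t
        go : ∀ {v} → U v → E X e v × e ≢ v → E Y b′ v
        go uv (ev , ne) with s e _ ue uv ne ev
        ... | inj₁ y = ⊥-elim (n y)
        ... | inj₂ y = y

      all⇒three : ∀ {e b} (t : Three q e) → (∀ v → v ∈ four → E Y b v) → YThree t b
      all⇒three t h = go (here refl) , go (there (here refl)) , go (there (there (here refl)))
        where
        open Three t
        go : ∀ {v} → v ∈ x ∷ y ∷ z ∷ [] → E Y _ v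
        go i = h _ (∈-cnt≤ few i)

      allY⇒ : ∀ {b} → AllY b → ∀ v → v ∈ four → E Y b v
      allY⇒ (y₁ , _) v (here refl) = y₁
      allY⇒ (_ , y₂ , _) v (there (here refl)) = y₂
      allY⇒ (_ , _ , y₃ , _) v (there (there (here refl))) = y₃
      allY⇒ (_ , _ , _ , y₄) v (there (there (there (here refl)))) = y₄

      zigzag₅ : ∀ {e k k′ bs} (t : Three q e) → YThree t k → YThree t k′ → (∀ a → cnt a (k ∷ k′ ∷ []) ≤ cnt a bs) → Five (four ++ bs)
      zigzag₅ {e} {k} {k′} {bs} t (kx , ky , kz) (kx′ , ky′ , kz′) m = record
        { piece = record { xs = x ∷ k ∷ y ∷ k′ ∷ z ∷ [] ; seg = cons (E-sym kx) (cons ky (cons (E-sym ky′) (cons kz′ single))) ; hd∈U =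
            ux ; lst∈U = uz }
        ; len = refl
        ; cnts = λ a → ≤-trans (five-count (bit (a ≟ x)) (bit (a ≟ y)) (bit (a ≟ z)) (bit (a ≟ k)) (bit (a ≟ k′)) (cnt a four)
            (cnt a bs) (few a) (m a))
                         (≤-reflexive (sym (cnt-++ a four bs))) }
        where open Three t

      -- If `b₁` is not Y-joined to some `e` of the quad, then `b₂` and `b₃` are Y-joined to the
      -- other three vertices, as these are X-joined to `e`. If `b₁` is joined to all four and `b₂`
      -- misses `e`, the same holds for `b₁` and `b₃`. If neither misses a vertex, `b₁` and `b₂`
      -- themselves do. Two vertices joined to three others carry a path of five with both ends in
      -- `U`.
      five : ∀ {b₁ b₂ b₃} → Triple b₁ b₂ b₃ → Five (four ++ b₁ ∷ b₂ ∷ b₃ ∷ [])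
      five {b₁} {b₂} {b₃} T with all-or-three b₁ | all-or-three b₂
      ... | inj₂ (e , t , ue , n) | _ = zigzag₅ t (avoid t ue n s₁₂) (avoid t ue n s₁₃) (cnt-⊆ (_ ∷ʳ refl ∷ refl ∷ []))
        where open Triple T
      ... | inj₁ y | inj₂ (e , t , ue , n) = zigzag₅ t (all⇒three t (allY⇒ y)) (avoid t ue n s₂₃) (cnt-⊆ (refl ∷ _ ∷ʳ refl ∷ []))
        where open Triple T
      ... | inj₁ y | inj₁ y′ = zigzag₅ omit₁ (all⇒three omit₁ (allY⇒ y)) (all⇒three omit₁ (allY⇒ y′)) (cnt-⊆ (refl ∷ refl ∷ _ ∷ʳ []))

    record Pair (vs : List ℕ) : Set where
      field
        piece : Piece
        len : length (Piece.xs piece) ≡ 2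
        cnts : ∀ a → cnt a (Piece.xs piece) ≤ cnt a vs

    pair : ∀ {u v vs} → U u → U v → E Y u v → (∀ a → cnt a (u ∷ v ∷ []) ≤ cnt a vs) → Pair vs
    pair uu uv e h = record { piece = record { xs = _ ∷ _ ∷ [] ; seg = cons e single ; hd∈U = uu ; lst∈U = uv } ; len = refl ; cnts = h }

    pair-or-quad : ∀ a b c d → U a → U b → U c → U d → Dist (a ∷ b ∷ c ∷ d ∷ []) →
                   Pair (a ∷ b ∷ c ∷ d ∷ []) ⊎ ∃ λ q → Quad.four q ≡ a ∷ b ∷ c ∷ d ∷ []
    pair-or-quad a b c d ua ub uc ud dst with dich a b | dich a c | dich a d | dich b c | dich b d | dich c d
    ... | inj₂ y | _ | _ | _ | _ | _ = inj₁ (pair ua ub y (cnt-⊆ (refl ∷ refl ∷ _ ∷ʳ _ ∷ʳ [])))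
    ... | inj₁ _ | inj₂ y | _ | _ | _ | _ = inj₁ (pair ua uc y (cnt-⊆ (refl ∷ _ ∷ʳ refl ∷ _ ∷ʳ [])))
    ... | inj₁ _ | inj₁ _ | inj₂ y | _ | _ | _ = inj₁ (pair ua ud y (cnt-⊆ (refl ∷ _ ∷ʳ _ ∷ʳ refl ∷ [])))
    ... | inj₁ _ | inj₁ _ | inj₁ _ | inj₂ y | _ | _ = inj₁ (pair ub uc y (cnt-⊆ (_ ∷ʳ refl ∷ refl ∷ _ ∷ʳ [])))
    ... | inj₁ _ | inj₁ _ | inj₁ _ | inj₁ _ | inj₂ y | _ = inj₁ (pair ub ud y (cnt-⊆ (_ ∷ʳ refl ∷ _ ∷ʳ refl ∷ [])))
    ... | inj₁ _ | inj₁ _ | inj₁ _ | inj₁ _ | inj₁ _ | inj₂ y = inj₁ (pair uc ud y (cnt-⊆ (_ ∷ʳ _ ∷ʳ refl ∷ refl ∷ [])))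
    ... | inj₁ ab | inj₁ ac | inj₁ ad | inj₁ bc | inj₁ bd | inj₁ cd = inj₂ (quad ua ub uc ud
          (ab , λ { refl → h₁ (here refl) }) (ac , λ { refl → h₁ (there (here refl)) }) (ad , λ { refl → h₁ (there (there (here refl))) })
          (bc , λ { refl → h₂ (here refl) }) (bd , λ { refl → h₂ (there (here refl)) }) (cd , λ { refl → h₃ (here refl) }) , refl)
      where h₁ = dist-head {a} {b ∷ c ∷ d ∷ []} dst
            d₂ = dist-tail {a} {b ∷ c ∷ d ∷ []} dst
            h₂ = dist-head {b} {c ∷ d ∷ []} d₂
            d₃ = dist-tail {b} {c ∷ d ∷ []} d₂
            h₃ = dist-head {c} {d ∷ []} d₃

    -- Every group is worth one vertex. A pair has one vertex more than the single that it replaces.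
    -- A quad turns into five vertices instead of one, at the price of three path vertices; as one
    -- and a half windows, each worth a connector and a single, these would have yielded three.
    record Sorted (n : ℕ) (us : List ℕ) : Set where
      field
        pairs : List Piece
        quads : List Quad
        rest : List ℕ
        number : length pairs + length quads ≡ n
        pairs-len : length (flat pairs) ≡ 2 * length pairs
        cnts : ∀ a → cnt a (flat pairs) + (cnt a (flat₄ quads) + cnt a rest) ≤ cnt a us
        rest-len : length us ≡ 4 * n + length rest

    sort : ∀ n us → 4 * n ≤ length us → (∀ u → u ∈ us → U u) → Dist us → Sorted n us
    sort zero us _ _ _ = record { pairs = [] ; quads = [] ; rest = us ; number = refl ; pairs-len = refl ; cnts = λ _ →
        ≤-refl ; rest-len = refl }
    sort (suc n) us l hU d = go us (≤-trans (≤-reflexive (sym (*-suc 4 n))) l) hU d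
      where
      go : ∀ us → 4 + 4 * n ≤ length us → (∀ u → u ∈ us → U u) → Dist us → Sorted (suc n) us
      go (x ∷ y ∷ z ∷ w ∷ us) (s≤s (s≤s (s≤s (s≤s l)))) hU d =
        put (pair-or-quad x y z w (hU x (here refl)) (hU y (there (here refl))) (hU z (there (there (here refl)))) (hU w (there
            (there (there (here refl)))))
              (λ a → ≤-trans (m≤m+n (cnt a xs) (cnt a us)) (≤-trans (≤-reflexive (sym (cnt-++ a xs us))) (d a))))
        where
        xs = x ∷ y ∷ z ∷ w ∷ []
        S : Sorted n us
        S = sort n us l (λ u i → hU u (there (there (there (there i))))) (λ a → ≤-trans (m≤n+m (cnt a us) (cnt a xs)) (≤-trans
            (≤-reflexive (sym (cnt-++ a xs us))) (d a)))
        module S = Sorted S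
        rl : length (xs ++ us) ≡ 4 * suc n + length S.rest
        rl = trans (cong (4 +_) S.rest-len) (trans (sym (+-assoc 4 (4 * n) _)) (cong (_+ length S.rest) (sym (*-suc 4 n))))
        put : Pair xs ⊎ (∃ λ q → Quad.four q ≡ xs) → Sorted (suc n) (xs ++ us)
        put (inj₁ p) = record { pairs = Pair.piece p ∷ S.pairs ; quads = S.quads ; rest = S.rest ; number = cong suc S.number
          ; pairs-len = trans (length-++ (Piece.xs (Pair.piece p))) (trans (cong₂ _+_ (Pair.len p) S.pairs-len) (sym (*-suc 2 _)))
          ; cnts = λ a → subst₂ _≤_ (cong (_+ (cnt a (flat₄ S.quads) + cnt a S.rest)) (sym (cnt-++ a (Piece.xs (Pair.piece p)) _)))
              (sym (cnt-++ a xs us))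
                     (sort-pair (cnt a (Piece.xs (Pair.piece p))) (cnt a (flat S.pairs)) (cnt a (flat₄ S.quads)) (cnt a S.rest)
                         (cnt a us) (cnt a xs) (S.cnts a) (Pair.cnts p a))
          ; rest-len = rl }
        put (inj₂ (q , e)) = record { pairs = S.pairs ; quads = q ∷ S.quads ; rest = S.rest ; number = trans (+-suc _ _) (cong suc S.number)
          ; pairs-len = S.pairs-len
          ; cnts = λ a → subst₂ (λ y z → cnt a (flat S.pairs) + (y + cnt a S.rest) ≤ z)
                     (trans (cong (λ l → cnt a l + cnt a (flat₄ S.quads)) (sym e)) (sym (cnt-++ a (Quad.four q) (flat₄ S.quads))))
                         (sym (cnt-++ a xs us))
                     (sort-quad (cnt a (flat S.pairs)) (cnt a (flat₄ S.quads)) (cnt a S.rest) (cnt a us) (cnt a xs) (S.cnts a))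
          ; rest-len = rl }

-- Giant components and their persistence

module Robust (em : ExcludedMiddle 0ℓ) (c : Colouring) (star : ∀ Y → Colours.Star em c Y) where

  open import Data.List.Relation.Unary.All using (All; []; _∷_)
  open Counting em
  open Colours em c

  data Reach (Y : Bool) (A I : ℕ → Set) : ℕ → Set where
    start : ∀ {v} → I v → A v → Reach Y A I v
    step : ∀ {u v} → Reach Y A I u → E Y u v → A v → Reach Y A I v

  reach-⊆ : ∀ {Y A I v} → Reach Y A I v → A v
  reach-⊆ (start _ a) = a
  reach-⊆ (step _ _ a) = a

  reach-mono : ∀ {Y A A′ I I′ v} → (∀ v → A v → A′ v) → (∀ v → A v → I v → I′ v) → Reach Y A I v → Reach Y A′ I′ v
  reach-mono f g (start i a) = start (g _ a i) (f _ a)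
  reach-mono f g (step r e a) = step (reach-mono f g r) e (f _ a)

  reach-trans : ∀ {Y A I w v} → Reach Y A I w → Reach Y A (_≡ w) v → Reach Y A I v
  reach-trans r (start refl _) = r
  reach-trans r (step s e a) = step (reach-trans r s) e a

  reach-closed : ∀ {Y A I} t → Closed Y A (Reach Y A I) t
  reach-closed t = closed (λ v → reach-⊆) (λ u v _ _ r a e → step r e a)

  closed-≤ : ∀ {Y A D a b} → a ≤ b → Closed Y A D b → Closed Y A D a
  closed-≤ h (closed s f) = closed s (λ u v hu hv → f u v (≤-trans hu h) (≤-trans hv h))

  ∅ : ℕ → Set
  ∅ _ = ⊥

  closed-∅ : ∀ {Y A D t} → Closed Y A D t → Closed Y (A ∖ ∅) D t
  closed-∅ (closed s f) = closed (λ v d → s v d , λ x → x) (λ u v hu hv d a → f u v hu hv d (proj₁ a))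

  #-∅≤ : ∀ t → # ∅ t ≤ 0
  #-∅≤ t = #-∅ t (λ _ _ _ x → x)

  Big : (ℕ → Set) → ℕ → Set
  Big D t = t ≤ 3 * # D t

  threshold : Bool → List ℕ → ℕ
  threshold Y F = proj₁ (star Y F)

  Spares : Bool → List ℕ → (ℕ → Set) → Set
  Spares Y F S = ¬ S (proj₁ (proj₂ (star Y F))) × ¬ S (proj₁ (proj₂ (proj₂ (star Y F))))

  spares-> : ∀ {Y F S} → (∀ v → S v → threshold Y F < v) → Spares Y F S
  spares-> {Y} {F} h = (λ s → <⇒≱ (h _ s) (proj₁ (proj₂ (proj₂ (proj₂ (star Y F)))))) ,
                       (λ s → <⇒≱ (h _ s) (proj₁ (proj₂ (proj₂ (proj₂ (proj₂ (star Y F)))))))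

  -- A closed set with at least t/3 vertices escapes the first alternative of `Star`, so its
  -- complement is small and it has nearly 2t/3 vertices at least. This is the gap in the possible
  -- sizes on which everything below rests.
  module Dichotomy {Y F S σ} {t : ℕ} (h : threshold Y F ≤ t) (sp : Spares Y F S) (hσ : # S t ≤ σ) where

    private f = length F

    cover : ∀ D → t ≤ # D t + (# (Out F ∖ S ∖ D) t + (f + σ))
    cover D = ≤-trans (#-all {λ _ → ℕ} t (λ _ _ _ → 0))
      (≤-trans (#-∪ {_} {D} {λ v → ¬ D v} t (λ v _ _ _ → lem (D v)))
        (+-monoʳ-≤ (# D t) (≤-trans (#-∪ {λ v → ¬ D v} {Out F ∖ S ∖ D} {λ v → v ∈ F ⊎ S v} t rest)
          (+-monoʳ-≤ (# (Out F ∖ S ∖ D) t) (≤-trans (#-∪ {_} {_∈ F} {S} t (λ _ _ _ x → x))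
            (+-mono-≤ (#-∈≤length t F) hσ))))))
      where
      rest : ∀ v → 1 ≤ v → v ≤ t → ¬ D v → (Out F ∖ S ∖ D) v ⊎ (v ∈ F ⊎ S v)
      rest v p _ nd with lem (v ∈ F) | lem (S v)
      ... | inj₁ i | _ = inj₂ (inj₁ i)
      ... | inj₂ _ | inj₁ s = inj₂ (inj₂ s)
      ... | inj₂ i | inj₂ s = inj₁ (((p , i) , s) , nd)

    big⇒ : ∀ {D} → Closed Y (Out F ∖ S) D t → Big D t → 2 * t < 3 * # D t + 2 * f + 3 * σ
    big⇒ {D} cl b with proj₂ (proj₂ (proj₂ (proj₂ (proj₂ (star Y F))))) t h S D (proj₁ sp) (proj₂ sp) cl
    ... | inj₁ s = ⊥-elim (<⇒≱ s (≤-trans b (m≤m+n _ f)))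
    ... | inj₂ s = cover-big t (# D t) (# (Out F ∖ S ∖ D) t) f σ (cover D) s

    ¬big⇒ : ∀ {D} → Closed Y (Out F ∖ S) D t → 2 * f + 3 * σ ≤ t → ¬ Big D t → 3 * # D t + f < t
    ¬big⇒ {D} cl g nb with proj₂ (proj₂ (proj₂ (proj₂ (proj₂ (star Y F))))) t h S D (proj₁ sp) (proj₂ sp) cl
    ... | inj₁ s = s
    ... | inj₂ s = ⊥-elim (big-absurd t (# D t) f σ (cover-big t (# D t) (# (Out F ∖ S ∖ D) t) f σ (cover D) s) g (≰⇒> nb))

  -- The number of elements of D below t changes by at most one from t to t + 1, so it cannot jump over the forbidden middle range.
  persist : ∀ {Y F S D σ a b} → threshold Y F ≤ a → a ≤ b → Spares Y F S → # S b ≤ σ → 2 * length F + 3 * σ ≤ a →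
            Closed Y (Out F ∖ S) D b → Big D a → Big D b
  persist {Y} {F} {S} {D} {σ} {a} h ab sp hσ g cl big = go (≤⇒≤′ ab) hσ cl
    where
    go : ∀ {b} → a ≤′ b → # S b ≤ σ → Closed Y (Out F ∖ S) D b → Big D b
    go ≤′-refl _ _ = big
    go (≤′-step {t} i) hσ cl =
      persist-step t (# D t) _ (length F) σ
        (Dichotomy.big⇒ {Y} {F} {S} {σ} (≤-trans h (≤′⇒≤ i)) sp hσ′ cl′ (go i hσ′ cl′))
        (≤-trans g (≤′⇒≤ i)) (#-suc D t)
      where hσ′ = ≤-trans (#-suc S t) hσ
            cl′ = closed-≤ (n≤1+n t) cl

  -- The components are added one at a time. Two closed sets below t/3 have a union below 2t/3,
  -- which by the gap in sizes is below t/3 again. If all components of vertices of `D` were small,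
  -- their union would be small, yet it contains `D`.
  big-component : ∀ {Y F t} → threshold Y F ≤ t → 2 * length F < t → (D : ℕ → Set) → (∀ v → v ≤ t → D v → Out F v) → Big D t →
                  ∃ λ v → v ≤ t × D v × Big (Reach Y (Out F) (_≡ v)) t
  big-component {Y} {F} {t} h lt D out big = dne λ none → <⇒≱ (m+n≤o⇒m≤o _ (final none)) (≤-trans big (*-monoʳ-≤ 3
      (#-mono {D} {U t} t (λ w a b d → w , a , b , d , start refl (out w b d)))))
    where
    f = length F
    C : ℕ → ℕ → Set
    C v = Reach Y (Out F) (_≡ v)
    U : ℕ → ℕ → Set
    U j w = ∃ λ v → 1 ≤ v × v ≤ j × D v × C v w
    module Di = Dichotomy {Y} {F} {∅} {0} {t} h ((λ x → x) , (λ x → x)) (#-∅≤ t)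
    no-σ : 2 * f + 3 * 0 ≤ t
    no-σ = ≤-trans (≤-reflexive (+-identityʳ _)) (<⇒≤ lt)
    U-closed : ∀ j → Closed Y (Out F ∖ ∅) (U j) t
    U-closed j = closed-∅ (closed (λ { w (v , _ , _ , _ , r) → reach-⊆ r }) (λ { u w _ _ (v , a , b , d , r) o e → v , a , b , d ,
        step r e o }))
    module _ (none : ¬ ∃ λ v → v ≤ t × D v × Big (C v) t) where
      small : ∀ j → j ≤ t → 3 * # (U j) t + f < t
      small zero _ = Di.¬big⇒ (U-closed 0) no-σ (λ b → <⇒≱ lt (≤-trans b (≤-trans (*-monoʳ-≤ 3
                       (#-∅ {U 0} t (λ { w _ _ (v , a , b , _) → 1+n≰n (≤-trans a b) }))) z≤n)))
      small (suc j) hj = Di.¬big⇒ (U-closed (suc j)) no-σ λ b → contra (≤-trans (Di.big⇒ (U-closed (suc j)) b) (≤-reflexive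
          (+-identityʳ _)))
        where
        IH = small j (≤-trans (n≤1+n j) hj)
        contra : 2 * t < 3 * # (U (suc j)) t + 2 * f → ⊥
        contra b with em {D (suc j)}
        ... | yes d = union-small t (# (U (suc j)) t) (# (U j) t) (# (C (suc j)) t) f b
                        (#-∪ {U (suc j)} {U j} {C (suc j)} t un) IH
                        (Di.¬big⇒ (closed-∅ (reach-closed t)) no-σ (λ bb → none (suc j , hj , d , bb)))
          where un : ∀ w → 1 ≤ w → w ≤ t → U (suc j) w → U j w ⊎ C (suc j) w
                un w _ _ (v , a , b , d , r) with v ≟ suc j
                ... | yes refl = inj₂ r
                ... | no ne = inj₁ (v , a , ≤-pred (≤∧≢⇒< b ne) , d , r)
        ... | no nd = big-absurd t (# (U j) t) f 0
                        (≤-trans b (≤-trans (+-monoˡ-≤ (2 * f) (*-monoʳ-≤ 3 (#-mono {U (suc j)} {U j} t un))) (≤-reflexive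
                            (sym (+-identityʳ _)))))
                        no-σ (≤-trans (s≤s (m≤m+n _ f)) IH)
          where un : ∀ w → 1 ≤ w → w ≤ t → U (suc j) w → U j w
                un w _ _ (v , a , b , d , r) with v ≟ suc j
                ... | yes refl = ⊥-elim (nd d)
                ... | no ne = v , a , ≤-pred (≤∧≢⇒< b ne) , d , r
      final : suc (3 * # (U t) t) + f ≤ t
      final = small t ≤-refl

  -- The end of `P` sees components of the graph outside `P` that are giant in total. The time `T`
  -- lies beyond the threshold, so `persist` carries this to all later times.
  record Good (Y : Bool) (P : List ℕ) : Set where
    field
      isSeg : IsSeg Y P
      T : ℕ
      T-thr : threshold Y P ≤ T
      T-len : 2 * length P < T
      big : Big (Reach Y (Out P) (E Y (end isSeg))) T

  module _ {Y : Bool} where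

    comp-∷ : ∀ {F v u} → Reach Y (Out F) (_≡ v) u → u ≡ v ⊎ Reach Y (Out (v ∷ F)) (E Y v) u
    comp-∷ (start e _) = inj₁ e
    comp-∷ {F} {v} (step {u} {w} r e a) with w ≟ v
    ... | yes p = inj₁ p
    ... | no np = inj₂ (go (comp-∷ r))
      where
      a′ : Out (v ∷ F) w
      a′ = proj₁ a , λ { (here p) → np p ; (there i) → proj₂ a i }
      go : u ≡ v ⊎ Reach Y (Out (v ∷ F)) (E Y v) u → Reach Y (Out (v ∷ F)) (E Y v) w
      go (inj₁ refl) = start e a′
      go (inj₂ r′) = step r′ e a′

    -- Without `v`, its component is still covered by what its neighbours reach. As it had nearly
    -- two thirds of all vertices, at least one third remains.
    good-∷ : ∀ {F v t} → threshold Y F ≤ t → 2 * length F < t → Big (Reach Y (Out F) (_≡ v)) t →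
             (s : IsSeg Y (v ∷ F)) → Good Y (v ∷ F)
    good-∷ {F} {v} {t} h lt b s = record { isSeg = s ; T = t′ ; T-thr = ≤-trans (m≤m+n _ _) (m≤n+m _ t)
        ; T-len = ≤-trans (≤-reflexive (len f)) (≤-trans (m≤n+m (2 * f + 3) (threshold Y (v ∷ F))) (m≤n+m _ t)) ; big = big′ }
      where
      f = length F
      t′ = t + (threshold Y (v ∷ F) + (2 * f + 3))
      len : ∀ f → suc (2 * suc f) ≡ 2 * f + 3
      len f = trans (cong suc (*-suc 2 f)) (+-comm 3 (2 * f))
      h′ : threshold Y F ≤ t′
      h′ = ≤-trans h (m≤m+n t _)
      nospare = ((λ x → x) , (λ x → x))
      C = Reach Y (Out F) (_≡ v)
      bC : Big C t′
      bC = persist {Y} {F} {∅} {C} {0} h (m≤m+n t _) nospare (#-∅≤ t′) (≤-trans (≤-reflexive (+-identityʳ _)) (<⇒≤ lt))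
          (closed-∅ (reach-closed t′)) b
      big′ : Big (Reach Y (Out (v ∷ F)) (E Y (end s))) t′
      big′ = component-minus-vertex t′ (# C t′) _ f
        (≤-trans (Dichotomy.big⇒ {Y} {F} {∅} {0} h′ nospare (#-∅≤ t′) (closed-∅ (reach-closed t′)) bC) (≤-reflexive (+-identityʳ _)))
        (≤-trans (#-∪ {C} {_≡ v} {Reach Y (Out (v ∷ F)) (E Y (end s))} t′
                   (λ u _ _ r → Sum.map₂ (reach-mono (λ _ a → a) (λ w _ e → subst (λ x → E Y x w) (sym (seg-head (seg s))) e)) (comp-∷ r)))
                 (+-monoˡ-≤ _ (#-sing v t′)))
        (≤-trans (m≤n+m (2 * f + 3) (threshold Y (v ∷ F))) (m≤n+m _ t))

    reach-first : ∀ {A I w} → Reach Y A I w → ∃ λ v → I v × A v × Reach Y A (_≡ v) w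
    reach-first (start i a) = _ , i , a , start refl a
    reach-first (step r e a) with reach-first r
    ... | v , i , a′ , r′ = v , i , a′ , step r′ e a

    good-extend : ∀ {P} → Good Y P → ∃ λ v → Good Y (v ∷ P)
    good-extend {P} g with big-component {Y} {P} (Good.T-thr g) (Good.T-len g) (Reach Y (Out P) (E Y (end (Good.isSeg g))))
        (λ v _ → reach-⊆) (Good.big g)
    ... | w , w≤ , r , b with reach-first r
    ... | v , e , o , r′ = v , good-∷ (Good.T-thr g) (Good.T-len g)
            (≤-trans b (*-monoʳ-≤ 3 (#-mono {Reach Y (Out P) (_≡ w)} {Reach Y (Out P) (_≡ v)} (Good.T g) (λ u _ _ q → reach-trans r′ q))))
            (record { seg = cons (E-sym e) (seg s) ; dist = dist-∷ {v} {P} (dist s) (proj₂ o)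
                    ; pos = λ { x (here refl) → proj₁ o ; x (there i) → pos s x i } })
      where s = Good.isSeg g

    good-extend* : ∀ m {P} → Good Y P → ∃ λ W → length W ≡ m × Good Y (W ++ P)
    good-extend* zero g = [] , refl , g
    good-extend* (suc m) g with good-extend* m g
    ... | W , e , g′ with good-extend g′
    ... | v , g″ = v ∷ W , cong suc e , g″

    good-initial : ∃ λ P → Good Y P
    good-initial with big-component {Y} {[]} {suc (threshold Y [])} (n≤1+n _) (s≤s z≤n) (Out []) (λ _ _ o → o)
                        (≤-trans (#-all {Out []} _ (λ v p _ → p , λ ())) (m≤m+n _ _))
    ... | v , _ , o , b = v ∷ [] , good-∷ (n≤1+n _) (s≤s z≤n) b (record { seg = single ; dist = dist-single v ; pos = λ { x
        (here refl) → proj₁ o } })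

    reach-bounded : ∀ {A I w} → Reach Y A I w → ∃ λ m → ∀ n → m ≤ n → Reach Y (λ v → A v × v ≤ n) I w
    reach-bounded {w = w} (start i a) = w , λ n h → start i (a , h)
    reach-bounded (step {v = w} r e a) with reach-bounded r
    ... | m , f = m + w , λ n h → step (f n (≤-trans (m≤m+n m w) h)) e (a , ≤-trans (m≤n+m w m) h)

    -- Only finitely many vertices lie up to `k`, each reached by a finite walk, so one bound serves
    -- them all.
    reach-bounded* : ∀ {A I} k → ∃ λ m → ∀ n → m ≤ n → ∀ w → w ≤ k → Reach Y A I w → Reach Y (λ v → A v × v ≤ n) I w
    reach-bounded* {A} {I} zero with em {Reach Y A I 0}
    ... | yes r = let m , f = reach-bounded r in m , λ { n h zero _ _ → f n h }
    ... | no nr = 0 , λ { n h zero _ r → ⊥-elim (nr r) }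
    reach-bounded* {A} {I} (suc k) with reach-bounded* {A} {I} k | em {Reach Y A I (suc k)}
    ... | m , f | no nr = m , λ n h w le r → f n h w (≤-pred (≤∧≢⇒< le (λ { refl → nr r }))) r
    ... | m , f | yes r = m + proj₁ (reach-bounded r) , go
      where go : ∀ n → m + proj₁ (reach-bounded r) ≤ n → ∀ w → w ≤ suc k → Reach Y A I w → Reach Y (λ v → A v × v ≤ n) I w
            go n h w le q with w ≟ suc k
            ... | yes refl = proj₂ (reach-bounded r) n (≤-trans (m≤n+m _ m) h)
            ... | no ne = f n (≤-trans (m≤m+n m _) h) w (≤-pred (≤∧≢⇒< le ne)) q

  -- The giant component beyond `t`

  -- The giant component that survives the deletion of [1,t], recognised by its size at one sufficiently late time.
  abstract
    late : Bool → ℕ → ℕ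
    late Y t = threshold Y (range t) + (20 * t + 20)

    threshold≤late : ∀ Y t → threshold Y (range t) ≤ late Y t
    threshold≤late Y t = m≤m+n _ _

    20t≤late : ∀ Y t → 20 * t ≤ late Y t
    20t≤late Y t = ≤-trans (m≤m+n (20 * t) 20) (m≤n+m _ (threshold Y (range t)))

    2t<late : ∀ Y t → 2 * t < late Y t
    2t<late Y t = late-large t (threshold Y (range t))

  K : Bool → ℕ → ℕ → Set
  K Y t κ = t < κ × Big (Reach Y (Out (range t)) (_≡ κ)) (late Y t)

  out-range : ∀ {t v} → t < v → Out (range t) v
  out-range {t} h = ≤-trans (s≤s z≤n) h , λ i → <⇒≱ h (∈range t i)

  range-out : ∀ {t v} → Out (range t) v → t < v
  range-out {t} {v} (p , n) = ≰⇒> λ le → n (range∈ t p le)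

  -- At the late time `D` holds nearly two thirds of all vertices, and at most `t` of them lie in
  -- [1,t]. The rest is still big, so one of its vertices lies in a big component of the graph
  -- beyond `t`.
  hit-K : ∀ {Y F S D σ t} → threshold Y F ≤ late Y t → Spares Y F S → # S (late Y t) ≤ σ →
          3 * t + 2 * length F + 3 * σ ≤ late Y t → Closed Y (Out F ∖ S) D (late Y t) → Big D (late Y t) →
          ∃ λ κ → K Y t κ × D κ
  hit-K {Y} {F} {S} {D} {σ} {t} h sp hσ g cl b = dne λ none →
      hit-K-size T t (# D T) (# D⁺ T) (length F) σ
        (Dichotomy.big⇒ {Y} {F} {S} {σ} h sp hσ cl b)
        (≤-trans (#-∪ {D} {_≤ t} {D⁺} T (λ v _ _ d → le-or-lt v d)) (+-monoˡ-≤ _ (#-below t T)))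
        (≰⇒> λ b⁺ → let v , _ , (lt , d) , bv = big-component {Y} {range t} (threshold≤late Y t) 2t<T D⁺ (λ v _ q → out-range (proj₁ q)) b⁺
                    in none (v , (lt , bv) , d))
        g
    where
    T = late Y t
    D⁺ : ℕ → Set
    D⁺ v = t < v × D v
    le-or-lt : ∀ v → D v → v ≤ t ⊎ D⁺ v
    le-or-lt v d with v ≤? t
    ... | yes p = inj₁ p
    ... | no n = inj₂ (≰⇒> n , d)
    2t<T : 2 * length (range t) < T
    2t<T rewrite range-length t = 2t<late Y t

  -- Short connections by counting levels

  -- Tier Y A I t k v: v is reachable by a walk with at most k vertices ≤ t after its first vertex.
  data Tier (Y : Bool) (A I : ℕ → Set) (t : ℕ) : ℕ → ℕ → Set where
    start : ∀ {k v} → I v → A v → Tier Y A I t k v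
    free : ∀ {k u v} → Tier Y A I t k u → E Y u v → A v → t < v → Tier Y A I t k v
    pay : ∀ {k u v} → Tier Y A I t k u → E Y u v → A v → Tier Y A I t (suc k) v

  tier-suc : ∀ {Y A I t k v} → Tier Y A I t k v → Tier Y A I t (suc k) v
  tier-suc (start i a) = start i a
  tier-suc (free r e a n) = free (tier-suc r) e a n
  tier-suc (pay r e a) = pay (tier-suc r) e a

  -- If deleting few vertices never separates I from the target G, then G is reached at a low level:
  -- every level not yet reaching G is a separator, so it is large or it meets the protected set Pr.
  module Layers {Y : Bool} (A I G Pr : ℕ → Set) (t s n : ℕ) (A-pos : ∀ v → A v → 1 ≤ v) (Pr-few : # Pr t ≤ n)
    (robust : (S : ℕ → Set) → (∀ v → S v → v ≤ t × ¬ Pr v) → # S t ≤ s → (∀ v → I v → A v → ¬ S v) →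
              ∃ λ v → G v × Reach Y (A ∖ S) I v) where

    Lv : ℕ → ℕ → Set
    Lv = Tier Y A I t

    New : ℕ → ℕ → Set
    New j v = v ≤ t × Lv (suc j) v × ¬ Lv j v

    confined : ∀ j {v} → Reach Y (A ∖ New j) I v → Lv j v
    confined j (start i a) = start i (proj₁ a)
    confined j (step {v = v} r e (a , n)) with v ≤? t
    ... | no gt = free (confined j r) e a (≰⇒> gt)
    ... | yes le = dne λ nl → n (le , pay (confined j r) e a , nl)

    Found : ℕ → Set
    Found j = ∃ λ i → i < j × ∃ λ v → G v × Lv i v

    φ ψ : ℕ → ℕ
    φ j = # (Lv j) t
    ψ j = # (λ v → Pr v × Lv j v) t

    -- The potential counts the vertices reached and gives each protected one the extra weight s +
    -- 1. A new level contains a protected vertex, or it may be deleted; then walks stay confined to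
    -- level `j`, which misses the target, so by `robust` the level has more than `s` vertices.
    -- Either way the potential grows by s + 1.
    count : ∀ j → Found j ⊎ suc s * j ≤ φ j + suc s * ψ j
    count zero = inj₂ (≤-trans (≤-reflexive (*-zeroʳ (suc s))) z≤n)
    count (suc j) with count j
    ... | inj₁ (i , lt , x) = inj₁ (i , ≤-trans lt (n≤1+n j) , x)
    ... | inj₂ h with em {∃ λ v → G v × Lv j v}
    ...   | yes x = inj₁ (j , ≤-refl , x)
    ...   | no none with em {∃ λ v → 1 ≤ v × New j v × Pr v}
    ...     | yes (v , p , (le , l , nl) , pr) = inj₂ (subst (_≤ φ (suc j) + suc s * ψ (suc j)) (sym (*-suc (suc s) j))
                (layer-protected (suc s * j) (suc s) (φ j) (φ (suc j)) (suc s * ψ j) (suc s * ψ (suc j)) h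
                  (#-mono {Lv j} t (λ _ _ _ → tier-suc))
                  (≤-trans (≤-reflexive (trans (+-comm (suc s * ψ j) (suc s)) (sym (*-suc (suc s) (ψ j))))) (*-monoʳ-≤ (suc s) grow))))
              where grow : suc (ψ j) ≤ ψ (suc j)
                    grow = ≤-trans (+-monoˡ-≤ (ψ j) (#-pos {_≡ v} t v p le refl))
                             (#-disj {_≡ v} {λ w → Pr w × Lv j w} t (λ { w _ _ refl → pr , l }) (λ w _ _ → Product.map₂ tier-suc)
                                (λ { w _ _ refl q → nl (proj₂ q) }))
    ...     | no free′ = inj₂ (subst (_≤ φ (suc j) + suc s * ψ (suc j)) (sym (*-suc (suc s) j))
                (layer-large (suc s * j) s (φ j) (φ (suc j)) (suc s * ψ j) (suc s * ψ (suc j)) (# (S) t) h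
                  (#-disj {Lv j} {S} {Lv (suc j)} t (λ _ _ _ → tier-suc) (λ { w _ _ (_ , _ , l , _) → l }) (λ { w _ _ l (_ , _ , _ ,
                      nl) → nl l }))
                  (*-monoʳ-≤ (suc s) (#-mono {λ w → Pr w × Lv j w} t (λ _ _ _ → Product.map₂ tier-suc)))
                  (≰⇒> separator)))
              where
              S : ℕ → Set
              S v = 1 ≤ v × New j v
              separator : ¬ # S t ≤ s
              separator few with robust S (λ { v (p , q) → proj₁ q , λ pr → free′ (v , p , q , pr) }) few (λ { v i a (_ , _ , _ , nl) →
                  nl (start i a) })
              ... | v , g , r = none (v , g , confined j (reach-mono (λ { w (a , n) → a , λ q → n (A-pos w a , q) }) (λ _ _ i → i) r))

    found : ∀ k → t + suc s * n < suc s * k → Found k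
    found k h with count k
    ... | inj₁ x = x
    ... | inj₂ le = ⊥-elim (<⇒≱ h (≤-trans le (+-mono-≤ (#≤ (Lv k) t)
                      (*-monoʳ-≤ (suc s) (≤-trans (#-mono {λ w → Pr w × Lv k w} {Pr} t (λ _ _ _ → proj₁)) Pr-few)))))

  -- A walk that returns to its path is cut back to that vertex, which does not increase the weight.
  -- The bound is `suc k` since the first vertex is not paid for.
  tier-path : ∀ {Y A I t k v} → Tier Y A I t k v →
              ∃ λ ys → ∃ λ u → Seg Y v u ys × I u × Dist ys × (∀ w → w ∈ ys → A w) × wt t ys ≤ suc k
  tier-path {t = t} {v = v} (start i a) = v ∷ [] , v , single , i , dist-single v , (λ { w (here refl) → a }) ,
    ≤-trans (≤-reflexive (+-identityʳ _)) (≤-trans (bit≤1 (v ≤? t)) (s≤s z≤n))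
  tier-path {A = A} {t = t} {k} {v} (free r e a lt) with tier-path r
  ... | ys , u , s , i , d , h , w with em {v ∈ ys}
  ...   | yes m = let zs , s′ , c , w′ = truncate t s m in
          zs , u , s′ , i , (λ x → ≤-trans (c x) (d x)) , (λ x j → h x (∈-cnt≤ c j)) , ≤-trans w′ w
  ...   | no n = v ∷ ys , u , cons (E-sym e) s , i , dist-∷ d n , (λ { x (here refl) → a ; x (there j) → h x j }) , heavy
          where heavy : wt t (v ∷ ys) ≤ suc k
                heavy with v ≤? t
                ... | yes le = ⊥-elim (<⇒≱ lt le)
                ... | no _ = w
  tier-path {A = A} {t = t} {suc k} {v} (pay r e a) with tier-path r
  ... | ys , u , s , i , d , h , w with em {v ∈ ys}
  ...   | yes m = let zs , s′ , c , w′ = truncate t s m in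
          zs , u , s′ , i , (λ x → ≤-trans (c x) (d x)) , (λ x j → h x (∈-cnt≤ c j)) , ≤-trans w′ (≤-trans w (n≤1+n _))
  ...   | no n = v ∷ ys , u , cons (E-sym e) s , i , dist-∷ d n , (λ { x (here refl) → a ; x (there j) → h x j }) ,
          +-mono-≤ (bit≤1 (v ≤? t)) w

  reach-until : ∀ {Y A I v} (X : ℕ → Set) → Reach Y A I v →
                Reach Y (A ∖ X) I v ⊎ ∃ λ κ → X κ × A κ × (I κ ⊎ ∃ λ z → Reach Y (A ∖ X) I z × E Y z κ)
  reach-until {v = v} X (start i a) with em {X v}
  ... | yes x = inj₂ (v , x , a , inj₁ i)
  ... | no n = inj₁ (start i (a , n))
  reach-until {v = v} X (step r e a) with reach-until X r
  ... | inj₂ x = inj₂ x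
  ... | inj₁ r′ with em {X v}
  ...   | yes x = inj₂ (v , x , a , inj₂ (_ , r′ , e))
  ...   | no n = inj₁ (step r′ e (a , n))

  #-restrict : ∀ {P : ℕ → Set} {t} T → (∀ v → P v → v ≤ t) → # P T ≤ # P t
  #-restrict {P} {t} T h with ≤-total T t
  ... | inj₁ le = #-≤ P le
  ... | inj₂ le = go (≤⇒≤′ le)
    where go : ∀ {T} → t ≤′ T → # P T ≤ # P t
          go ≤′-refl = ≤-refl
          go (≤′-step {T} i) = ≤-trans (+-monoˡ-≤ (# P T) (bit-mono (em {P (suc T)}) (no (λ x → x))
                                  (λ p → <⇒≱ (s≤s (≤′⇒≤ i)) (h _ p)))) (go i)

  AdjK : Bool → ℕ → ℕ → Set
  AdjK Y t z = ∃ λ κ → K Y t κ × E Y z κ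

  -- The source `U` already is a third of [1,t], so the giant component survives the deletion of a
  -- set linear in `t`, and eleven levels suffice. The two vertices spared in `Star` may lie below
  -- `t`; they form the protected set. The path stops at a neighbour of `K`, so that it avoids `K`
  -- itself.
  exit : ∀ {Y m t s} (Ω U : ℕ → Set) → threshold Y (range m) ≤ t → Spares Y (range m) Ω → # Ω (late Y t) ≤ 4 →
         (∀ u → U u → u ≤ t × m < u × ¬ Ω u) → Big U t → t + suc s * 2 < suc s * 11 → 2 * m + 3 * (s + 4) ≤ t →
         ∃ λ zs → ∃ λ z → ∃ λ u → Seg Y z u zs × U u × AdjK Y t z × Dist zs ×
           (∀ w → w ∈ zs → m < w × ¬ Ω w × ¬ K Y t w) × wt t zs ≤ 11
  exit {Y} {m} {t} {s} Ω U h sp hΩ hU big hs hm = let i , lt , z , g , l = La.found 11 hs ; zs , u , sg , uu , d , a , w = tier-path l in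
      zs , z , u , sg , uu , g , d , (λ w i → let (o , nΩ) , nK = a w i in range-out o , nΩ , nK) , ≤-trans w lt
    where
    F = range m
    p = proj₁ (proj₂ (star Y F))
    q = proj₁ (proj₂ (proj₂ (star Y F)))
    T = late Y t
    A = Out F ∖ Ω ∖ K Y t
    Pr : ℕ → Set
    Pr v = v ≡ p ⊎ v ≡ q
    t≤T : 20 * t ≤ T
    t≤T = 20t≤late Y t
    robust : (S : ℕ → Set) → (∀ v → S v → v ≤ t × ¬ Pr v) → # S t ≤ s → (∀ v → U v → A v → ¬ S v) →
             ∃ λ v → AdjK Y t v × Reach Y (A ∖ S) U v
    robust S hS few av = result
      where
      S′ : ℕ → Set
      S′ v = S v ⊎ Ω v
      sp′ : Spares Y F S′
      sp′ = [ (λ x → proj₂ (hS _ x) (inj₁ refl)) , proj₁ sp ]′ , [ (λ x → proj₂ (hS _ x) (inj₂ refl)) , proj₂ sp ]′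
      hS′ : # S′ T ≤ s + 4
      hS′ = ≤-trans (#-∪ {S′} {S} {Ω} T (λ _ _ _ x → x)) (+-mono-≤ (≤-trans (#-restrict {S} T (λ v x → proj₁ (hS v x))) few) hΩ)
      D = Reach Y (Out F ∖ S′) U
      U-A : ∀ u → U u → A u
      U-A u x = let a , b , n = hU u x in (out-range b , n) , λ k → <⇒≱ (proj₁ k) a
      bD : Big D T
      bD = persist {Y} {F} {S′} {D} {s + 4} h (≤-trans (m≤m+n t _) t≤T) sp′ hS′
             (≤-trans (+-monoˡ-≤ _ (≤-reflexive (cong (2 *_) (range-length m)))) hm) (reach-closed T)
             (≤-trans big (*-monoʳ-≤ 3 (#-mono {U} {D} t (λ u _ _ x → start x (proj₁ (proj₁ (U-A u x)) , [ av u x (U-A u x) , proj₂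
                 (proj₁ (U-A u x)) ]′)))))
      result : ∃ λ v → AdjK Y t v × Reach Y (A ∖ S) U v
      result = uncurry (λ κ kr → finish (proj₁ kr) (reach-until (K Y t) (proj₂ kr)))
        (hit-K {Y} {F} {S′} {D} {s + 4} {t} (≤-trans h (≤-trans (m≤m+n t _) t≤T)) sp′ hS′
           (subst (λ x → 3 * t + 2 * x + 3 * (s + 4) ≤ T) (sym (range-length m)) (exit-late t m s T hm t≤T)) (reach-closed T) bD)
        where
        finish : ∀ {κ} → K Y t κ → Reach Y (Out F ∖ S′ ∖ K Y t) U κ ⊎ (∃ λ κ → K Y t κ × (Out F ∖ S′) κ × (U κ ⊎ ∃ λ z → Reach Y
            (Out F ∖ S′ ∖ K Y t) U z × E Y z κ)) →
                 ∃ λ v → AdjK Y t v × Reach Y (A ∖ S) U v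
        finish k (inj₁ r′) = ⊥-elim (proj₂ (reach-⊆ r′) k)
        finish k (inj₂ (κ′ , k′ , _ , inj₁ u)) = ⊥-elim (<⇒≱ (proj₁ k′) (proj₁ (hU _ u)))
        finish k (inj₂ (κ′ , k′ , _ , inj₂ (z , r′ , e))) = z , (κ′ , k′ , e) ,
                reach-mono (λ { v ((o , n) , nk) → ((o , (λ ω → n (inj₂ ω))) , nk) , λ x → n (inj₁ x) }) (λ _ _ i → i) r′
    module La = Layers {Y} A U (AdjK Y t) Pr t s 2 (λ v a → proj₁ (proj₁ (proj₁ a)))
                  (≤-trans (#-∪ {Pr} {_≡ p} {_≡ q} t (λ _ _ _ x → x)) (+-mono-≤ (#-sing p t) (#-sing q t))) robust

  Upto : (ℕ → Set) → ℕ → ℕ → Set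
  Upto A t v = A v × v ≤ t

  -- A version of `Good` whose walks stay in [1,m], so that deleting vertices above `m` does not
  -- affect them. This is why [1,m] is protected in the two connections below.
  record Ready (Y : Bool) (P : List ℕ) (x m : ℕ) : Set where
    field
      thr : threshold Y P ≤ m
      big : Big (Reach Y (Upto (Out P) m) (E Y x)) m

  ready : ∀ {Y P} (g : Good Y P) → ∃ λ m₀ → ∀ m → m₀ ≤ m → Ready Y P (end (Good.isSeg g)) m
  ready {Y} {P} g with reach-bounded* {Y} {Out P} {E Y (end (Good.isSeg g))} (Good.T g)
  ... | m₁ , f = m₁ + Good.T g , λ m h → record
        { thr = ≤-trans (Good.T-thr g) (≤-trans (m≤n+m _ m₁) h)
        ; big = persist {Y} {P} {∅} {Reach Y (Upto (Out P) m) I} {0} (Good.T-thr g) (≤-trans (m≤n+m _ m₁) h) ((λ x → x) , (λ x → x))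
            (#-∅≤ m)
                  (≤-trans (≤-reflexive (+-identityʳ _)) (<⇒≤ (Good.T-len g)))
                  (closed-∅ (closed (λ v r → proj₁ (reach-⊆ r)) (λ u v _ hv r a e → step r e (a , hv))))
                  (≤-trans (Good.big g) (*-monoʳ-≤ 3 (#-mono {Reach Y (Out P) I} (Good.T g) (λ w _ b r → f m (≤-trans
                      (m≤m+n m₁ _) h) w b r)))) }
    where I = E Y (end (Good.isSeg g))

  -- After the deletion of few vertices above `m`, nearly 2t/3 vertices of [1,t] can still be
  -- reached from `x`. As `U` has a little more than t/3, the two sets meet. The bound 15 allows for
  -- four reserved vertices and eleven on the exit path.
  entry : ∀ {Y P x m t s k} (Σ′ U : ℕ → Set) → Ready Y P x m → m ≤ t → (∀ v → Σ′ v → m < v) → # Σ′ t ≤ 15 →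
          2 * length P + 3 * (s + 15) ≤ m → (∀ u → U u → u ≤ t) → t + (2 * length P + 3 * (s + 15)) ≤ 3 * # U t →
          t + suc s * m < suc s * k →
          ∃ λ ys → ∃ λ u → ∃ λ q → Seg Y u q ys × U u × E Y x q × Dist ys ×
            (∀ w → w ∈ ys → Out P w × w ≤ t × ¬ Σ′ w) × wt t ys ≤ k
  entry {Y} {P} {x} {m} {t} {s} {k} Σ′ U rd mt hΣ cΣ hm hU big hk =
      let i , lt , u , g , l = La.found k hk ; ys , q , sg , iq , d , a , w = tier-path l in
      ys , u , q , sg , g , iq , d , (λ w i → let (o , le) , n = a w i in o , le , n) , ≤-trans w lt
    where
    A = Upto (Out P) t ∖ Σ′
    I = E Y x
    robust : (S : ℕ → Set) → (∀ v → S v → v ≤ t × ¬ (v ≤ m)) → # S t ≤ s → (∀ v → I v → A v → ¬ S v) →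
             ∃ λ v → U v × Reach Y (A ∖ S) I v
    robust S hS few _ = dne λ none → entry-size t (# D t) (# U t) (2 * length P + 3 * (s + 15))
        (≤-trans (Dichotomy.big⇒ {Y} {P} {S′} {s + 15} {t} (≤-trans (Ready.thr rd) mt) sp hS′ cl bD) (≤-reflexive (+-assoc
            (3 * # D t) _ _)))
        (≤-trans (#-disj {D} {U} {λ _ → ℕ} t (λ _ _ _ _ → 0) (λ _ _ _ _ → 0) (λ v _ _ r u → none (v , u , conv r))) (#≤ _ t)) big
      where
      S′ : ℕ → Set
      S′ v = S v ⊎ Σ′ v
      >m : ∀ v → S′ v → m < v
      >m v (inj₁ x) = ≰⇒> (proj₂ (hS v x))
      >m v (inj₂ x) = hΣ v x
      sp : Spares Y P S′
      sp = spares-> {Y} {P} (λ v x → ≤-trans (s≤s (Ready.thr rd)) (>m v x))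
      hS′ : # S′ t ≤ s + 15
      hS′ = ≤-trans (#-∪ {S′} {S} {Σ′} t (λ _ _ _ x → x)) (+-mono-≤ few cΣ)
      D = Reach Y (Upto (Out P ∖ S′) t) I
      cl : Closed Y (Out P ∖ S′) D t
      cl = closed (λ v r → proj₁ (reach-⊆ r)) (λ u v _ hv r a e → step r e (a , hv))
      conv : ∀ {v} → D v → Reach Y (A ∖ S) I v
      conv = reach-mono (λ { v ((o , n) , le) → ((o , le) , λ y → n (inj₂ y)) , λ y → n (inj₁ y) }) (λ _ _ i → i)
      bD : Big D t
      bD = persist {Y} {P} {S′} {D} {s + 15} (Ready.thr rd) mt sp hS′ hm cl
             (≤-trans (Ready.big rd) (*-monoʳ-≤ 3 (#-mono {Reach Y (Upto (Out P) m) I} {D} m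
                (λ w _ _ → reach-mono (λ { v (o , le) → (o , (λ x → <⇒≱ (>m v x) le)) , ≤-trans le mt }) (λ _ _ i → i)))))
    module La = Layers {Y} A I U (_≤ m) t s m (λ v a → proj₁ (proj₁ (proj₁ a))) (#-below m t) robust

  base : ∀ {Y P x m t s k} → Ready Y P x m → m ≤ t → 2 * length P + 3 * s ≤ m → t + suc s * m < suc s * k →
         AdjK Y t x ⊎ ∃ λ zs → ∃ λ z → ∃ λ q → Seg Y z q zs × AdjK Y t z × E Y x q × Dist zs ×
           (∀ w → w ∈ zs → Out P w × ¬ K Y t w) × wt t zs ≤ k
  base {Y} {P} {x} {m} {t} {s} {k} rd mt hm hk with em {AdjK Y t x}
  ... | yes a = inj₁ a
  ... | no na = inj₂ (let i , lt , z , g , l = La.found k hk ; zs , q , sg , iq , d , a , w = tier-path l in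
                      zs , z , q , sg , g , iq , d , a , ≤-trans w lt)
    where
    A = Out P ∖ K Y t
    I = E Y x
    T = late Y t
    t≤T : 20 * t ≤ T
    t≤T = 20t≤late Y t
    robust : (S : ℕ → Set) → (∀ v → S v → v ≤ t × ¬ (v ≤ m)) → # S t ≤ s → (∀ v → I v → A v → ¬ S v) →
             ∃ λ v → AdjK Y t v × Reach Y (A ∖ S) I v
    robust S hS few _ = result
      where
      sp : Spares Y P S
      sp = spares-> {Y} {P} (λ v x → ≤-trans (s≤s (Ready.thr rd)) (≰⇒> (proj₂ (hS v x))))
      hS′ : # S T ≤ s
      hS′ = ≤-trans (#-restrict {S} T (λ v x → proj₁ (hS v x))) few
      D = Reach Y (Out P ∖ S) I
      mT : m ≤ T
      mT = ≤-trans mt (≤-trans (m≤m+n t _) t≤T)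
      bD : Big D T
      bD = persist {Y} {P} {S} {D} {s} (Ready.thr rd) mT sp hS′ hm (reach-closed T)
             (≤-trans (Ready.big rd) (*-monoʳ-≤ 3 (#-mono {Reach Y (Upto (Out P) m) I} {D} m
                (λ w _ _ → reach-mono (λ { v (o , le) → o , (λ x → proj₂ (hS v x) le) }) (λ _ _ i → i)))))
      result : ∃ λ v → AdjK Y t v × Reach Y (A ∖ S) I v
      result = uncurry (λ κ kr → finish (proj₁ kr) (reach-until (K Y t) (proj₂ kr)))
        (hit-K {Y} {P} {S} {D} {s} {t} (≤-trans (Ready.thr rd) mT) sp hS′ (base-late t m (length P) s T hm mt t≤T) (reach-closed T) bD)
        where
        finish : ∀ {κ} → K Y t κ → Reach Y (Out P ∖ S ∖ K Y t) I κ ⊎ (∃ λ κ → K Y t κ × (Out P ∖ S) κ × (I κ ⊎ ∃ λ z → Reach Y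
            (Out P ∖ S ∖ K Y t) I z × E Y z κ)) →
                 ∃ λ v → AdjK Y t v × Reach Y (A ∖ S) I v
        finish k (inj₁ r′) = ⊥-elim (proj₂ (reach-⊆ r′) k)
        finish k (inj₂ (κ′ , k′ , _ , inj₁ e)) = ⊥-elim (na (κ′ , k′ , e))
        finish k (inj₂ (κ′ , k′ , _ , inj₂ (z , r′ , e))) = z , (κ′ , k′ , e) ,
                reach-mono (λ { v ((o , n) , nk) → (o , nk) , n }) (λ _ _ i → i) r′
    module La = Layers {Y} A I (AdjK Y t) (_≤ m) t s m (λ v a → proj₁ (proj₁ a)) (#-below m t) robust

  -- Admissible paths and exchanges in a longest one

  -- A path through P and then Q ⊆ [1,t], continued by a short detour Z to the giant component beyond t.
  record Valid (Y : Bool) (P : List ℕ) (t r : ℕ) (Q : List ℕ) : Set where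
    field
      {κ origin} : ℕ
      Z : List ℕ
      link : Seg Y κ origin (κ ∷ Z ++ Q ++ P)
      κ∈K : K Y t κ
      distinct : Dist (Z ++ Q ++ P)
      positive : ∀ v → v ∈ Z ++ Q ++ P → 1 ≤ v
      Q≤ : ∀ v → v ∈ Q → v ≤ t
      Z∉K : ∀ v → v ∈ Z → ¬ K Y t v
      wtZ : wt t Z ≤ r
    whole : List ℕ
    whole = Z ++ Q ++ P

  reach-sym : ∀ {Y A u v} → Reach Y A (_≡ u) v → Reach Y A (_≡ v) u
  reach-sym (start refl a) = start refl a
  reach-sym (step r e a) = reach-trans (step (start refl a) (E-sym e) (reach-⊆ r)) (reach-sym r)

  seg-uncons : ∀ {Y u b L} → Seg Y u b (u ∷ L) → L ≢ [] → ∃ λ h → E Y u h × Seg Y h b L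
  seg-uncons single n = ⊥-elim (n refl)
  seg-uncons (cons e s) _ = _ , e , s

  -- The whole component of `κ` beyond `t` consists of vertices of `K`, so it misses `Z`, and it
  -- misses `Q` and `P` because they lie in [1,t]. The vertex next to `κ` is thus an end adjacent to
  -- a giant component outside the path.
  valid⇒good : ∀ {Y P t r Q} → Valid Y P t r Q → P ≢ [] → (∀ v → v ∈ P → v ≤ t) →
               ∃ λ Z → Good Y (Z ++ Q ++ P)
  valid⇒good {Y} {P} {t} {r} {Q} V ne P≤ with seg-uncons (Valid.link V) (nonempty (Valid.Z V) Q)
    where nonempty : ∀ Z Q → Z ++ Q ++ P ≢ []
          nonempty [] [] e = ne e
          nonempty [] (_ ∷ _) ()
          nonempty (_ ∷ _) _ ()
  ... | h , e , s = Z , record { isSeg = record { seg = s ; dist = distinct ; pos = positive } ; T = T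
        ; T-thr = ≤-trans (m≤m+n _ _) (m≤n+m _ T₀) ; T-len = ≤-trans (m≤n+m (suc (2 * length whole)) (threshold Y whole))
            (m≤n+m _ T₀) ; big = bigL }
    where
    open Valid V
    T₀ = late Y t
    T = T₀ + (threshold Y whole + suc (2 * length whole))
    C = Reach Y (Out (range t)) (_≡ κ)
    bC : Big C T
    bC = persist {Y} {range t} {∅} {C} {0} {T₀} {T} (threshold≤late Y t) (m≤m+n T₀ _) ((λ x → x) , (λ x → x)) (#-∅≤ T)
           (≤-trans (≤-reflexive (trans (+-identityʳ _) (cong (2 *_) (range-length t)))) (<⇒≤ (2t<late Y t)))
           (closed-∅ (reach-closed T)) (proj₂ κ∈K)
    C⇒K : ∀ {v} → C v → K Y t v
    C⇒K {v} r = range-out (reach-⊆ r) , ≤-trans (proj₂ κ∈K) (*-monoʳ-≤ 3 (#-mono {C} {Reach Y (Out (range t)) (_≡ v)} T₀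
        (λ w _ _ q → reach-trans (reach-sym r) q)))
    C⇒out : ∀ {v} → C v → Out whole v
    C⇒out {v} r = ≤-trans (s≤s z≤n) (proj₁ k) , λ i → [ (λ i → Z∉K v i k) , (λ i → <⇒≱ (proj₁ k) ([ Q≤ v , P≤ v ]′ (∈-++⁻ Q i))) ]′
        (∈-++⁻ Z i)
      where k = C⇒K r
    conv : ∀ {v} → C v → Reach Y (Out whole) (E Y h) v
    conv q@(start refl _) = start (E-sym e) (C⇒out q)
    conv q@(step q′ e′ _) = step (conv q′) e′ (C⇒out q)
    bigL : Big (Reach Y (Out whole) (E Y h)) T
    bigL = ≤-trans bC (*-monoʳ-≤ 3 (#-mono {C} T (λ v _ _ → conv)))

  regroup : ∀ (Z pre mid post P : List ℕ) b b′ → Z ++ (pre ++ b ∷ mid ++ b′ ∷ post) ++ P ≡ (Z ++ pre) ++ b ∷ mid ++ b′ ∷ (post ++ P)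
  regroup Z pre mid post P b b′ = trans (cong (Z ++_) (trans (++-assoc pre _ P) (cong (λ l → pre ++ b ∷ l) (++-assoc mid _ P))))
      (sym (++-assoc Z pre _))

  exchange : ∀ {Y P t r b b′} pre mid post mid′ → (V : Valid Y P t r (pre ++ b ∷ mid ++ b′ ∷ post)) →
             Seg Y b b′ (b ∷ mid′ ++ b′ ∷ []) → Dist mid′ → (∀ v → v ∈ mid′ → 1 ≤ v × v ≤ t × v ∉ Valid.whole V) →
             Valid Y P t r (pre ++ b ∷ mid′ ++ b′ ∷ post)
  exchange {Y} {P} {t} {r} {b} {b′} pre mid post mid′ V s d h = record
    { Z = Z ; link = subst (Seg Y κ origin) (sym (cong (κ ∷_) (regroup Z pre mid′ post P b b′)))
        (replace (κ ∷ Z ++ pre) mid mid′ (subst (Seg Y κ origin) (cong (κ ∷_) (regroup Z pre mid post P b b′)) link) s)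
    ; κ∈K = κ∈K ; distinct = λ a → ≤-trans (fewer a) (new-dist a)
    ; positive = λ v i → [ (λ j → proj₁ (h v j)) , positive v ]′ (∈-++⁻ mid′ (∈-cnt≤ fewer i))
    ; Q≤ = λ v i → [ (λ j → Q≤ v (∈-++⁺ˡ j)) , old v ]′ (∈-++⁻ pre i)
    ; Z∉K = Z∉K ; wtZ = wtZ }
    where
    open Valid V
    old : ∀ v → v ∈ b ∷ mid′ ++ b′ ∷ post → v ≤ t
    old v (here p) = Q≤ v (∈-++⁺ʳ pre (here p))
    old v (there i) with ∈-++⁻ mid′ i
    ... | inj₁ j = proj₁ (proj₂ (h v j))
    ... | inj₂ j = Q≤ v (∈-++⁺ʳ pre (there (∈-++⁺ʳ mid j)))
    new-dist : Dist (mid′ ++ whole)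
    new-dist = dist-++ {mid′} {whole} d distinct (λ a i j → proj₂ (proj₂ (h a i)) j)
    expand : ∀ a m → cnt a (Z ++ (pre ++ b ∷ m ++ b′ ∷ post) ++ P) ≡ cnt a Z + ((cnt a pre + (bit (a ≟ b) + (cnt a m + (bit
        (a ≟ b′) + cnt a post)))) + cnt a P)
    expand a m = trans (cnt-++ a Z _) (cong (cnt a Z +_) (trans (cnt-++ a (pre ++ b ∷ m ++ b′ ∷ post) P)
                   (cong (_+ cnt a P) (trans (cnt-++ a pre _) (cong (λ x → cnt a pre + (bit (a ≟ b) + x)) (cnt-++ a m _))))))
    fewer : ∀ a → cnt a (Z ++ (pre ++ b ∷ mid′ ++ b′ ∷ post) ++ P) ≤ cnt a (mid′ ++ whole)
    fewer a = ≤-trans (≤-reflexive (expand a mid′)) (exchange-count (cnt a Z) (cnt a pre) (bit (a ≟ b)) (cnt a mid) (cnt a mid′) (bit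
        (a ≟ b′)) (cnt a post) (cnt a P) _
                (≤-reflexive (sym (trans (cnt-++ a mid′ whole) (cong (cnt a mid′ +_) (expand a mid))))))

  longer : ∀ (pre mid mid′ post : List ℕ) b b′ → length mid < length mid′ → length (pre ++ b ∷ mid ++ b′ ∷ post) < length
      (pre ++ b ∷ mid′ ++ b′ ∷ post)
  longer pre mid mid′ post b b′ h = subst₂ (λ x y → suc x ≤ y) (sym (len mid)) (sym (len mid′)) (exchange-length (length pre)
      (length mid) (length mid′) (length post) h)
    where len : ∀ m → length (pre ++ b ∷ m ++ b′ ∷ post) ≡ length pre + suc (length m + suc (length post))
          len m = trans (length-++ pre) (cong (λ x → length pre + suc x) (length-++ m))

  module Maximal (X Y : Bool) (dich : ∀ u v → E X u v ⊎ E Y u v) {P t r Q} (V : Valid X P t r Q)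
                 (maximal : ∀ Q′ → Valid X P t r Q′ → length Q′ ≤ length Q) (U : ℕ → Set)
                 (hU : ∀ u → U u → 1 ≤ u × u ≤ t × u ∉ Valid.whole V) where

    open Merge Y U
    open Quads X Y dich U

    no-exchange : ∀ {b b′} pre mid post mid′ → Q ≡ pre ++ b ∷ mid ++ b′ ∷ post → length mid < length mid′ →
                  Seg X b b′ (b ∷ mid′ ++ b′ ∷ []) → Dist mid′ → (∀ v → v ∈ mid′ → U v) → ⊥
    no-exchange {b} {b′} pre mid post mid′ refl lt s d h =
      <⇒≱ (longer pre mid mid′ post b b′ lt) (maximal _ (exchange pre mid post mid′ V s d (λ v i → hU v (h v i))))

    dist₂ : ∀ {u u′} → u ≢ u′ → Dist (u ∷ u′ ∷ [])
    dist₂ {u} {u′} n = dist-∷ {u} {u′ ∷ []} (dist-single u′) (λ { (here e) → n e })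

    separates₂ : ∀ {b b′} pre post → Q ≡ pre ++ b ∷ b′ ∷ post → Separates b b′
    separates₂ {b} {b′} pre post eq u u′ hu hu′ n x with dich b u | dich b′ u′
    ... | inj₂ y | _ = inj₁ y
    ... | inj₁ _ | inj₂ y = inj₂ y
    ... | inj₁ p | inj₁ q = ⊥-elim (no-exchange pre [] post (u ∷ u′ ∷ []) eq (s≤s z≤n)
            (cons p (cons x (cons (E-sym q) single))) (dist₂ n) (λ { v (here refl) → hu ; v (there (here refl)) → hu′ }))

    -- Here `b₂` would give way to the two vertices `u` and `u′`, which still lengthens the path.
    separates₃ : ∀ {b₁ b₂ b₃} pre post → Q ≡ pre ++ b₁ ∷ b₂ ∷ b₃ ∷ post → Separates b₁ b₃
    separates₃ {b₁} {b₂} {b₃} pre post eq u u′ hu hu′ n x with dich b₁ u | dich b₃ u′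
    ... | inj₂ y | _ = inj₁ y
    ... | inj₁ _ | inj₂ y = inj₂ y
    ... | inj₁ p | inj₁ q = ⊥-elim (no-exchange pre (b₂ ∷ []) post (u ∷ u′ ∷ []) eq (s≤s (s≤s z≤n))
            (cons p (cons x (cons (E-sym q) single))) (dist₂ n) (λ { v (here refl) → hu ; v (there (here refl)) → hu′ }))

    shift : ∀ {b post} pre → Q ≡ pre ++ b ∷ post → Q ≡ (pre ++ b ∷ []) ++ post
    shift pre e = trans e (sym (++-assoc pre _ _))

    triple : ∀ {b₁ b₂ b₃} pre post → Q ≡ pre ++ b₁ ∷ b₂ ∷ b₃ ∷ post → Triple b₁ b₂ b₃
    triple {b₁} {b₂} {b₃} pre post eq = record { s₁₂ = separates₂ pre (b₃ ∷ post) eq ; s₁₃ = separates₃ pre post eq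
                                               ; s₂₃ = separates₂ (pre ++ b₁ ∷ []) post (shift pre eq) }

    -- If `near` attaches the ends of an X-edge to different vertices of the pair, separation is
    -- applied to the edge in the direction that is not yet satisfied; it moves one end over to the
    -- vertex of the other.
    pair-window : ∀ {b b′} pre post → Q ≡ pre ++ b ∷ b′ ∷ post → Window (b , b′)
    pair-window {b} {b′} pre post eq = window near link
      where
      near : ∀ u → U u → E Y b u ⊎ E Y b′ u
      near u hu with dich b u | dich b′ u
      ... | inj₂ y | _ = inj₁ y
      ... | inj₁ _ | inj₂ y = inj₂ y
      ... | inj₁ p | inj₁ q = ⊥-elim (no-exchange pre [] post (u ∷ []) eq (s≤s z≤n) (cons p (cons (E-sym q) single))
                                (dist-single u) (λ { v (here refl) → hu }))
      link : ∀ u u′ → U u → U u′ → u ≢ u′ → E Y u u′ ⊎ (E Y b u × E Y b u′) ⊎ (E Y b′ u × E Y b′ u′)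
      link u u′ hu hu′ n with dich u u′
      ... | inj₂ y = inj₁ y
      ... | inj₁ x with near u hu | near u′ hu′ | separates₂ pre post eq u u′ hu hu′ n x | separates₂ pre post eq u′ u hu′ hu (λ e → n
          (sym e)) (E-sym x)
      ...   | inj₁ p | inj₁ q | _ | _ = inj₂ (inj₁ (p , q))
      ...   | inj₂ p | inj₂ q | _ | _ = inj₂ (inj₂ (p , q))
      ...   | inj₁ p | inj₂ q | _ | inj₁ q′ = inj₂ (inj₁ (p , q′))
      ...   | inj₁ p | inj₂ q | _ | inj₂ p′ = inj₂ (inj₂ (p′ , q))
      ...   | inj₂ p | inj₁ q | inj₁ p′ | _ = inj₂ (inj₁ (p′ , q))
      ...   | inj₂ p | inj₁ q | inj₂ q′ | _ = inj₂ (inj₂ (p , q′))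

    module _ {H : List ℕ} where

      windows : List (Block Q H) → List (ℕ × ℕ)
      windows [] = []
      windows (b ∷ bs) = (b₁ , b₂) ∷ (b₃ , b₄) ∷ (b₅ , b₆) ∷ windows bs
        where open Block b

      windows-length : ∀ bs → length (windows bs) ≡ 3 * length bs
      windows-length [] = refl
      windows-length (b ∷ bs) = trans (cong (3 +_) (windows-length bs)) (sym (*-suc 3 (length bs)))

      windows-flat : ∀ bs → flat₂ (windows bs) ≡ flat₆ bs
      windows-flat [] = refl
      windows-flat (b ∷ bs) = cong (Block.six b ++_) (windows-flat bs)

      windows-ok : ∀ bs → All Window (windows bs)
      windows-ok [] = []
      windows-ok (b ∷ bs) = pair-window pre (b₃ ∷ b₄ ∷ b₅ ∷ b₆ ∷ post) at ∷
          pair-window (pre ++ b₁ ∷ b₂ ∷ []) (b₅ ∷ b₆ ∷ post) (trans at (sym (++-assoc pre _ _))) ∷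
          pair-window (pre ++ b₁ ∷ b₂ ∷ b₃ ∷ b₄ ∷ []) post (trans at (sym (++-assoc pre _ _))) ∷ windows-ok bs
        where open Block b

      record Fives (bs : List (Block Q H)) (qs : List Quad) : Set where
        field
          pieces : List Piece
          number : length pieces ≡ 2 * length bs
          size : length (flat pieces) ≡ 5 * (2 * length bs)
          cnts : ∀ a → cnt a (flat pieces) ≤ cnt a (flat₄ qs) + cnt a (flat₆ bs)

      fives : ∀ bs qs → 2 * length bs ≤ length qs → Fives bs qs
      fives [] qs _ = record { pieces = [] ; number = refl ; size = refl ; cnts = λ _ → z≤n }
      fives (b ∷ bs) qs l = go qs (≤-trans (≤-reflexive (sym (*-suc 2 (length bs)))) l)
        where
        open Block b
        go : ∀ qs → 2 + 2 * length bs ≤ length qs → Fives (b ∷ bs) qs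
        go (q ∷ q′ ∷ qs) (s≤s (s≤s l)) = record
          { pieces = Five.piece f ∷ Five.piece f′ ∷ R.pieces
          ; number = trans (cong (2 +_) R.number) (sym (*-suc 2 (length bs)))
          ; size = trans (length-++ (Piece.xs (Five.piece f))) (trans (cong₂ _+_ (Five.len f)
                     (trans (length-++ (Piece.xs (Five.piece f′))) (cong₂ _+_ (Five.len f′) R.size))) (fve (length bs)))
          ; cnts = bound′ }
          where
          f = five q (triple pre (b₄ ∷ b₅ ∷ b₆ ∷ post) at)
          f′ = five q′ (triple (pre ++ b₁ ∷ b₂ ∷ b₃ ∷ []) post (trans at (sym (++-assoc pre _ _))))
          module R = Fives (fives bs qs l)
          fve : ∀ n → 5 + (5 + 5 * (2 * n)) ≡ 5 * (2 * suc n)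
          fve n = trans (sym (+-assoc 5 5 _)) (trans (sym (*-distribˡ-+ 5 2 (2 * n))) (cong (5 *_) (sym (*-suc 2 n))))
          bound′ : ∀ a → cnt a (flat (Five.piece f ∷ Five.piece f′ ∷ R.pieces)) ≤ cnt a (flat₄ (q ∷ q′ ∷ qs)) + cnt a (flat₆ (b ∷ bs))
          bound′ a = subst₂ _≤_
            (sym (trans (cnt-++ a (Piece.xs (Five.piece f)) (flat (Five.piece f′ ∷ R.pieces)))
                       (cong (cnt a (Piece.xs (Five.piece f)) +_) (cnt-++ a (Piece.xs (Five.piece f′)) (flat R.pieces)))))
            (sym (cong₂ _+_ (trans (cnt-++ a (Quad.four q) (flat₄ (q′ ∷ qs))) (cong (cnt a (Quad.four q) +_) (cnt-++ a
                (Quad.four q′) (flat₄ qs))))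
                            (trans (cnt-++ a six (flat₆ bs)) (cong (_+ cnt a (flat₆ bs)) (cnt-++ a (b₁ ∷ b₂ ∷ b₃ ∷ [])
                                (b₄ ∷ b₅ ∷ b₆ ∷ []))))))
            (fives-count (cnt a (Piece.xs (Five.piece f))) (cnt a (Piece.xs (Five.piece f′))) (cnt a (flat R.pieces)) (cnt a
                (Quad.four q)) (cnt a (Quad.four q′))
               (cnt a (flat₄ qs)) (cnt a (b₁ ∷ b₂ ∷ b₃ ∷ [])) (cnt a (b₄ ∷ b₅ ∷ b₆ ∷ [])) (cnt a (flat₆ bs))
               (≤-trans (Five.cnts f a) (≤-reflexive (cnt-++ a (Quad.four q) (b₁ ∷ b₂ ∷ b₃ ∷ []))))
               (≤-trans (Five.cnts f′ a) (≤-reflexive (cnt-++ a (Quad.four q′) (b₄ ∷ b₅ ∷ b₆ ∷ [])))) (R.cnts a))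

  -- The contradiction at a single time `t`

  wt-++ : ∀ t xs ys → wt t (xs ++ ys) ≡ wt t xs + wt t ys
  wt-++ t [] ys = refl
  wt-++ t (x ∷ xs) ys rewrite wt-++ t xs ys = sym (+-assoc (bit (x ≤? t)) _ _)

  -- Connecting paths cost a few multiples of r vertices.  By gap, at least 120r vertices more than half its length lie off
  -- each path; the gain from 26r groups of four of them outweighs that cost.
  module Core
    (k r s t T n₂ : ℕ) (t≡ : t ≡ suc (80 * k) * r) (t≡s : t ≡ suc s * r) (10≤k : 10 ≤ k) (1000≤r : 1000 ≤ r)
    (T<r : T < r) (n₂<r : n₂ < r) (T≤n₂ : T ≤ n₂)
    (P : Bool → List ℕ) (g : ∀ Y → Good Y (P Y))
    (rd : ∀ Y → Ready Y (P Y) (end (Good.isSeg (g Y))) T)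
    (P≤T : ∀ Y v → v ∈ P Y → v ≤ T)
    (P-len : ∀ Y → 2 * length (P Y) + 3 * (s + 15) ≤ T)
    (thr : ∀ Y → threshold Y (range T) ≤ n₂)
    (Q : Bool → List ℕ) (V : ∀ Y → Valid Y (P Y) t (2 * r) (Q Y))
    (maximal : ∀ Y Q′ → Valid Y (P Y) t (2 * r) Q′ → length Q′ ≤ length (Q Y))
    (gap : ∀ Y → 3 * length (Q Y) + 240 * r ≤ 2 * t)
    (long : ∀ Y → 6 * n₂ + 12 ≤ length (Q Y)) where

    r≤t : r ≤ t
    r≤t = ≤-trans (m≤m+n r (s * r)) (≤-reflexive (sym t≡s))

    T≤t : T ≤ t
    T≤t = ≤-trans (<⇒≤ T<r) r≤t

    n₂≤t : n₂ ≤ t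
    n₂≤t = ≤-trans (<⇒≤ n₂<r) r≤t

    12≤r : 12 ≤ r
    12≤r = ≤-trans (m≤m+n 12 988) 1000≤r

    r≤kr : r ≤ k * r
    r≤kr = ≤-trans (≤-reflexive (sym (+-identityʳ r))) (*-monoˡ-≤ r (≤-trans (s≤s z≤n) 10≤k))

    P≤r : ∀ Y → length (P Y) ≤ r
    P≤r Y = ≤-trans (prefix-short (length (P Y)) s T (P-len Y)) (<⇒≤ T<r)

    whole-wt : ∀ X → wt t (Valid.whole (V X)) ≤ 2 * r + (length (Q X) + length (P X))
    whole-wt X = ≤-trans (≤-reflexive (trans (wt-++ t Z _) (cong (wt t Z +_) (wt-++ t (Q X) (P X)))))
                   (+-mono-≤ wtZ (+-mono-≤ (wt≤length t (Q X)) (wt≤length t (P X))))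
      where open Valid (V X)

    Free : Bool → List ℕ → ℕ → Set
    Free X Ω u = T < u × u ≤ t × u ∉ Valid.whole (V X) × u ∉ Ω

    free-size : ∀ X Ω → length Ω ≤ 4 → t ≤ # (Free X Ω) t + (T + ((2 * r + (length (Q X) + length (P X))) + 4))
    free-size X Ω hΩ = ≤-trans (#-all {λ _ → ℕ} t (λ _ _ _ → 0))
      (≤-trans (#-∪ {_} {Free X Ω} {λ v → v ≤ T ⊎ v ∈ W ⊎ v ∈ Ω} t cases) (+-monoʳ-≤ (# (Free X Ω) t)
        (≤-trans (#-∪ {_} {_≤ T} {λ v → v ∈ W ⊎ v ∈ Ω} t (λ _ _ _ x → x)) (+-mono-≤ (#-below T t)
          (≤-trans (#-∪ {_} {_∈ W} {_∈ Ω} t (λ _ _ _ x → x)) (+-mono-≤ (≤-trans (#-∈≤wt t W) (whole-wt X)) (≤-trans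
              (#-∈≤length t Ω) hΩ)))))))
      where
      W = Valid.whole (V X)
      cases : ∀ v → 1 ≤ v → v ≤ t → ℕ → Free X Ω v ⊎ (v ≤ T ⊎ v ∈ W ⊎ v ∈ Ω)
      cases v _ le _ with lem (v ≤ T) | lem (v ∈ W) | lem (v ∈ Ω)
      ... | inj₁ x | _ | _ = inj₂ (inj₁ x)
      ... | inj₂ _ | inj₁ x | _ = inj₂ (inj₂ (inj₁ x))
      ... | inj₂ _ | inj₂ _ | inj₁ x = inj₂ (inj₂ (inj₂ x))
      ... | inj₂ a | inj₂ b | inj₂ d = inj₁ (≰⇒> a , le , b , d)

    -- `ys` leads from the given path to `u₁`, and `zs` leads from `u₂` towards the giant component;
    -- merging has to bridge `u₁` and `u₂`. Afterwards `ys` belongs to the counted path, and `zs` is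
    -- the detour.
    record Ends (Y : Bool) (U : ℕ → Set) (Ω : List ℕ) : Set where
      field
        {z u₁ u₂ q} : ℕ
        zs ys : List ℕ
        zs-seg : Seg Y z u₂ zs
        ys-seg : Seg Y u₁ q ys
        ys-start : E Y (end (Good.isSeg (g Y))) q
        z-adj : AdjK Y t z
        u₁∈U : U u₁
        u₂∈U : U u₂
        distinct : Dist (ys ++ zs ++ P Y)
        zs-out : ∀ w → w ∈ zs → T < w × w ∉ Ω × ¬ K Y t w
        ys-out : ∀ w → w ∈ ys → 1 ≤ w × w ≤ t × w ∉ Ω
        zs-wt : wt t zs ≤ 11
        ys-wt : wt t ys ≤ 2 * r

    ends : ∀ Y X Ω → length Ω ≤ 4 → (∀ v → v ∈ Ω → n₂ < v) → Ends Y (Free X Ω) Ω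
    ends Y X Ω hΩ Ω> = uncurry (λ zs → uncurry λ z → uncurry λ u → build zs z u)
        (exit {Y} {T} {t} {10 * k * r + r} (_∈ Ω) U (≤-trans (thr Y) n₂≤t)
           (spares-> {Y} {range T} (λ v i → ≤-trans (s≤s (thr Y)) (Ω> v i)))
           (≤-trans (#-∈≤length (late Y t) Ω) hΩ) (λ u h → proj₁ (proj₂ h) , proj₁ h , proj₂ (proj₂ (proj₂ h)))
           (≤-trans (m≤m+n t 0) (room 0 z≤n))
           (exit-levels t k r (≤-reflexive t≡)) (exit-room t k r T (≤-reflexive (sym t≡)) (<⇒≤ T<r) 12≤r r≤kr))
      where
      U = Free X Ω
      room : ∀ c → c ≤ r → t + c ≤ 3 * # U t
      room c h = room-left t (# U t) T r (length (Q X)) (length (P X)) c (free-size X Ω hΩ) (<⇒≤ T<r) (P≤r X) (gap X) 12≤r h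
      build : ∀ zs z u → Seg Y z u zs × U u × AdjK Y t z × Dist zs × (∀ w → w ∈ zs → T < w × ¬ (w ∈ Ω) × ¬ K Y t w) × wt t zs ≤ 11 →
          Ends Y U Ω
      build zs z u (sg , uu , adj , d , out , w) = uncurry (λ ys → uncurry λ u₁ → uncurry λ q → build′ ys u₁ q)
        (entry {Y} {P Y} {end (Good.isSeg (g Y))} {T} {t} {s} {2 * r} (λ v → v ∈ Ω ⊎ v ∈ zs) U (rd Y) T≤t
           (λ v → [ (λ i → ≤-trans (s≤s T≤n₂) (Ω> v i)) , (λ i → proj₁ (out v i)) ]′)
           (≤-trans (#-∪ {_} {_∈ Ω} {_∈ zs} t (λ _ _ _ x → x)) (+-mono-≤ (≤-trans (#-∈≤length t Ω) hΩ) (≤-trans (#-∈≤wt t zs) w)))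
           (P-len Y) (λ u h → proj₁ (proj₂ h)) (room _ (≤-trans (P-len Y) (<⇒≤ T<r)))
           -- With t = (s + 1)r and T < r, fewer than 2r levels can each have s + 1 vertices or one
           -- of the T protected ones.
           (subst (λ x → x + suc s * T < suc s * (2 * r)) (sym t≡s)
              (≤-trans (≤-reflexive (cong suc (sym (*-distribˡ-+ (suc s) r T))))
                 (*-monoʳ-< (suc s) (+-monoʳ-< r (≤-trans T<r (≤-reflexive (sym (+-identityʳ r)))))))))
        where
        build′ : ∀ ys u₁ q → Seg Y u₁ q ys × U u₁ × E Y (end (Good.isSeg (g Y))) q × Dist ys ×
                 (∀ w → w ∈ ys → Out (P Y) w × w ≤ t × ¬ (w ∈ Ω ⊎ w ∈ zs)) × wt t ys ≤ 2 * r → Ends Y U Ω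
        build′ ys u₁ q (sg′ , uu′ , e , d′ , out′ , w′) = record
          { zs = zs ; ys = ys ; zs-seg = sg ; ys-seg = sg′ ; ys-start = e ; z-adj = adj ; u₁∈U = uu′ ; u₂∈U = uu
          ; distinct = dist-++ {ys} {zs ++ P Y} d′ (dist-++ {zs} {P Y} d (dist (Good.isSeg (g Y))) (λ a i j → <⇒≱ (proj₁ (out a i))
              (P≤T Y a j)))
              (λ a i j → [ (λ x → proj₂ (proj₂ (out′ a i)) (inj₂ x)) , proj₂ (proj₁ (out′ a i)) ]′ (∈-++⁻ zs j))
          ; zs-out = out ; ys-out = λ v i → proj₁ (proj₁ (out′ v i)) , proj₁ (proj₂ (out′ v i)) , λ o → proj₂ (proj₂ (out′ v i)) (inj₁ o)
          ; zs-wt = w ; ys-wt = w′ }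

    module Assemble (Y : Bool) (U : ℕ → Set) {Ω} (en : Ends Y U Ω) where
      open Merge Y U
      open Ends en

      -- The merged path, preceded by the given path and followed by `zs`, is again admissible, so
      -- maximality of `Q Y` bounds its length. The vertices of `ys` are simply dropped from the
      -- estimate.
      assemble : ∀ ws p ps → All Window ws → length ws ≡ 2 + length ps →
                 (∀ a → cnt a ys + (cnt a (flat₂ ws) + (cnt a (flat (p ∷ ps)) + (cnt a zs + cnt a (P Y)))) ≤ 1) →
                 (∀ v → v ∈ flat₂ ws → 1 ≤ v × v ≤ t) → (∀ v → v ∈ flat (p ∷ ps) → 1 ≤ v × v ≤ t) →
                 length (flat (p ∷ ps)) + length ps ≤ length (Q Y)
      assemble ws p ps Ws lw d hw hp = ≤-trans (≤-trans (m≤n+m _ (length ys)) (≤-trans (≤-reflexive (sym (+-assoc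
          (length ys) _ _))) R.len)) (maximal Y R.L new)
        where
        u₂≤ : ∀ a → cnt a (u₂ ∷ []) ≤ cnt a zs
        u₂≤ a with a ≟ u₂
        ... | yes refl = ∈⇒cnt (seg-last∈ zs-seg)
        ... | no _ = z≤n
        module R = Result (merge ws {ys} {u₁} {q} {u₂} p ps ys-seg u₁∈U u₂∈U Ws lw
                     (λ a → assemble-count₁ (cnt a ys) (cnt a (flat₂ ws)) (cnt a (flat (p ∷ ps))) (cnt a (u₂ ∷ [])) (cnt a zs) (cnt a
                         (P Y)) (d a) (u₂≤ a)))
        inL : ∀ v → v ∈ R.L → v ∈ ys ++ flat₂ ws ++ flat (p ∷ ps)
        inL v = ∈-cnt≤ (λ a → ≤-trans (R.cnts a) (≤-reflexive (sym (trans (cnt-++ a ys _) (cong (cnt a ys +_) (cnt-++ a (flat₂ ws) _))))))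
        L-range : ∀ v → v ∈ R.L → 1 ≤ v × v ≤ t
        L-range v i = [ (λ j → let a , b , _ = ys-out v j in a , b) , (λ j → [ hw v , hp v ]′ (∈-++⁻ (flat₂ ws) j)) ]′ (∈-++⁻ ys (inL v i))
        sg = Good.isSeg (g Y)
        new : Valid Y (P Y) t (2 * r) R.L
        new = record { Z = zs
          ; link = cons (E-sym (proj₂ (proj₂ z-adj))) (join zs-seg R.to (join R.seg (E-sym ys-start) (seg sg)))
          ; κ∈K = proj₁ (proj₂ z-adj)
          ; distinct = λ a → ≤-trans (≤-reflexive (trans (cnt-++ a zs _) (cong (cnt a zs +_) (cnt-++ a R.L (P Y)))))
                         (assemble-count₂ (cnt a R.L) (cnt a ys) (cnt a (flat₂ ws)) (cnt a (flat (p ∷ ps))) (cnt a zs) (cnt a (P Y))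
                             (d a) (R.cnts a))
          ; positive = λ v i → [ (λ j → ≤-trans (s≤s z≤n) (proj₁ (zs-out v j))) , (λ j → [ (λ l → proj₁ (L-range v l)) , pos sg v ]′
              (∈-++⁻ R.L j)) ]′ (∈-++⁻ zs i)
          ; Q≤ = λ v i → proj₂ (L-range v i)
          ; Z∉K = λ v i → proj₂ (proj₂ (zs-out v i))
          ; wtZ = ≤-trans zs-wt (≤-trans (≤-trans (n≤1+n 11) 12≤r) (m≤m+n r _)) }

    Q-range : ∀ X v → v ∈ Q X → 1 ≤ v × v ≤ t
    Q-range X v i = Valid.positive (V X) v (∈-++⁺ʳ (Valid.Z (V X)) (∈-++⁺ˡ i)) , Valid.Q≤ (V X) v i

    Q⊆whole : ∀ X v → v ∈ Q X → v ∈ Valid.whole (V X)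
    Q⊆whole X v i = ∈-++⁺ʳ (Valid.Z (V X)) (∈-++⁺ˡ i)

    Q-dist : ∀ X → Dist (Q X)
    Q-dist X a = ≤-trans (≤-trans (m≤m+n _ _) (≤-trans (≤-reflexive (sym (cnt-++ a (Q X) (P X)))) (m≤n+m _ (cnt a Z))))
                   (≤-trans (≤-reflexive (sym (cnt-++ a Z _))) (distinct a))
      where open Valid (V X)

    free⇒U : ∀ X Ω u → Free X Ω u → 1 ≤ u × u ≤ t × u ∉ Valid.whole (V X)
    free⇒U X Ω u (a , b , n , _) = ≤-trans (s≤s z≤n) a , b , n

    dich : ∀ Y u v → E (not Y) u v ⊎ E Y u v
    dich Y u v = Sum.swap (E? Y u v)

    outside-size : ∀ H (A : ℕ → Set) → # A t ≤ length (els (λ v → A v × v ∉ H) t) + wt t H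
    outside-size H A = ≤-trans (#-∪ {A} {λ v → A v × v ∉ H} {_∈ H} t (λ v _ _ a → [ inj₂ , (λ n → inj₁ (a , n)) ]′ (lem (v ∈ H))))
                         (+-mono-≤ (≤-reflexive (sym (els-length (λ v → A v × v ∉ H) t))) (#-∈≤wt t H))

    -- A short path may have no block that avoids the connecting paths, so its two windows are fixed
    -- beforehand and the connections are made to avoid them. They lie beyond `n₂`, hence are
    -- distinct from the vertices spared in `Star`.
    record Reserved (X : Bool) : Set where
      field
        block : Block (Q X) (range n₂)
      open Block block
      Ω : List ℕ
      Ω = b₁ ∷ b₂ ∷ b₃ ∷ b₄ ∷ []
      field
        Ω-dist : Dist Ω
        Ω⊆Q : ∀ v → v ∈ Ω → v ∈ Q X
        Ω> : ∀ v → v ∈ Ω → n₂ < v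

    reserved : ∀ X → Reserved X
    reserved X = choose (blocks {Q X} {range n₂} [] (Q X) refl)
      where
      few : sum (_∈ range n₂) (Q X) ≤ n₂
      few = ≤-trans (sum≤# {_∈ range n₂} t (Q X) (Q-dist X) (Q-range X)) (≤-trans (#-∈≤length t (range n₂)) (≤-reflexive (range-length n₂)))
      choose : (∃ λ (bs : List (Block (Q X) (range n₂))) → (∀ a → cnt a (flat₆ bs) ≤ cnt a (Q X)) ×
                length (Q X) ≤ 6 * length bs + 6 * sum (_∈ range n₂) (Q X) + 5 × 6 * length bs ≤ length (Q X)) → Reserved X
      choose ([] , m , l , _) = ⊥-elim (1+n≰n (block-exists (length (Q X)) 0 (sum (_∈ range n₂) (Q X)) n₂ (long X) l few))
      choose (b ∷ bs , m , l , _) = record { block = b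
          ; Ω-dist = λ a → ≤-trans (Ω≤Q a) (Q-dist X a)
          ; Ω⊆Q = λ v → ∈-cnt≤ Ω≤Q
          ; Ω> = λ v i → ≰⇒> (λ le → Block.avoids b v (∈-++⁺ˡ {xs = Ω} i) (range∈ n₂ (proj₁ (Q-range X v (∈-cnt≤ Ω≤Q i))) le)) }
        where
        open Block b
        Ω = b₁ ∷ b₂ ∷ b₃ ∷ b₄ ∷ []
        Ω≤Q : ∀ a → cnt a Ω ≤ cnt a (Q X)
        Ω≤Q a = ≤-trans (≤-trans (m≤m+n (cnt a Ω) _) (≤-trans (≤-reflexive (sym (cnt-++ a Ω (b₅ ∷ b₆ ∷ flat₆ bs)))) ≤-refl)) (m a)

    -- If both paths are short, a monochromatic path in the rest is longer than the path of its colour.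
    module Short (short : ∀ Y → length (Q Y) < 160 * r) (Re : ∀ Y → Reserved (not Y))
                 (en : ∀ Y → Ends Y (Free (not Y) (Reserved.Ω (Re Y))) (Reserved.Ω (Re Y))) where
      Ω : Bool → List ℕ
      Ω Y = Reserved.Ω (Re Y)
      W : Bool → List ℕ
      W Y = Valid.whole (V Y)
      ex : Bool → List ℕ
      ex Y = Ends.ys (en Y) ++ Ends.zs (en Y)
      H : List ℕ
      H = range T ++ W true ++ W false ++ ex true ++ ex false
      us = els (λ v → ℕ × v ∉ H) t
      ex-wt : ∀ Y → wt t (ex Y) ≤ 2 * r + 11
      ex-wt Y = ≤-trans (≤-reflexive (wt-++ t (Ends.ys (en Y)) _)) (+-mono-≤ (Ends.ys-wt (en Y)) (Ends.zs-wt (en Y)))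
      H-wt : wt t H ≤ T + ((2 * r + (length (Q true) + length (P true))) + ((2 * r + (length (Q false) + length (P false))) +
          ((2 * r + 11) + (2 * r + 11))))
      H-wt = ≤-trans (≤-reflexive (trans (wt-++ t (range T) _) (cong (wt t (range T) +_) (trans (wt-++ t (W true) _) (cong (wt t
          (W true) +_)
               (trans (wt-++ t (W false) _) (cong (wt t (W false) +_) (wt-++ t (ex true) _))))))))
               (+-mono-≤ (≤-trans (wt≤length t (range T)) (≤-reflexive (range-length T))) (+-mono-≤ (whole-wt true) (+-mono-≤
                   (whole-wt false) (+-mono-≤ (ex-wt true) (ex-wt false)))))
      us-long : 320 * r ≤ length us
      -- From k ≥ 10 one has t ≥ 801r, while the two short paths and all connections take fewer than
      -- 332r vertices of [1,t].
      us-long = rest-large t (length us) (wt t H) T r (length (Q true)) (length (P true)) (length (Q false)) (length (P false))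
        (≤-trans (#-all {λ _ → ℕ} t (λ _ _ _ → 0)) (outside-size H (λ _ → ℕ))) H-wt (short true) (short false) (<⇒≤ T<r) (P≤r true)
            (P≤r false)
        (time-large t k r (≤-reflexive (sym t≡)) (*-monoˡ-≤ r 10≤k)) 1000≤r
      us∉ : ∀ v → v ∈ us → v ∉ H
      us∉ v i = proj₂ (proj₂ (proj₂ (∈els _ t i)))
      W∈H : ∀ Y v → v ∈ W Y → v ∈ H
      W∈H true v i = ∈-++⁺ʳ (range T) (∈-++⁺ˡ i)
      W∈H false v i = ∈-++⁺ʳ (range T) (∈-++⁺ʳ (W true) (∈-++⁺ˡ i))
      ex∈H : ∀ Y v → v ∈ ex Y → v ∈ H
      ex∈H true v i = ∈-++⁺ʳ (range T) (∈-++⁺ʳ (W true) (∈-++⁺ʳ (W false) (∈-++⁺ˡ i)))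
      ex∈H false v i = ∈-++⁺ʳ (range T) (∈-++⁺ʳ (W true) (∈-++⁺ʳ (W false) (∈-++⁺ʳ (ex true) i)))
      module _ (Y : Bool) (J : List ℕ) (J≤ : ∀ a → cnt a J ≤ cnt a us) where
        X = not Y
        R = Re Y
        U = Free X (Ω Y)
        open Merge Y U
        open Maximal X Y (dich Y) (V X) (maximal X) U (free⇒U X (Ω Y))
        open Block (Reserved.block R)
        open Ends (en Y)
        J-free : ∀ v → v ∈ J → U v
        J-free v i = let p , le , _ , n = ∈els _ t (∈-cnt≤ J≤ i) in
          ≰⇒> (λ le′ → n (∈-++⁺ˡ (range∈ T p le′))) , le , (λ j → n (W∈H X v j)) , λ j → n (W∈H X v (Q⊆whole X v (Reserved.Ω⊆Q R v j)))
        all-dist : Dist (J ++ Ω Y ++ ys ++ zs ++ P Y)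
        all-dist = dist-++ {J} {Ω Y ++ ys ++ zs ++ P Y} (λ a → ≤-trans (J≤ a) (els-dist _ t a))
          (dist-++ {Ω Y} {ys ++ zs ++ P Y} (Reserved.Ω-dist R) distinct
            (λ a i j → [ (λ l → proj₂ (proj₂ (ys-out a l)) i) , (λ l → [ (λ l → proj₁ (proj₂ (zs-out a l)) i) ,
                         (λ l → <⇒≱ (Reserved.Ω> R a i) (≤-trans (P≤T Y a l) T≤n₂)) ]′ (∈-++⁻ zs l)) ]′ (∈-++⁻ ys j)))
          (λ a i j → us∉ a (∈-cnt≤ J≤ i) ([ (λ l → W∈H X a (Q⊆whole X a (Reserved.Ω⊆Q R a l))) ,
             (λ l → [ (λ l → ex∈H Y a (∈-++⁺ˡ l)) , (λ l → [ (λ l → ex∈H Y a (∈-++⁺ʳ ys l)) ,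
                (λ l → W∈H Y a (∈-++⁺ʳ (Valid.Z (V Y)) (∈-++⁺ʳ (Q Y) l))) ]′ (∈-++⁻ zs l)) ]′ (∈-++⁻ ys l)) ]′ (∈-++⁻ (Ω Y) j)))
        too-long : Chain Y J → 160 * r ≤ length J → ⊥
        too-long (inj₁ refl) h = <⇒≱ (≤-trans (s≤s z≤n) (*-mono-≤ {1} {160} {1} {r} (s≤s z≤n) (≤-trans (s≤s z≤n) 12≤r))) h
        too-long (inj₂ (u , v , sg)) h = <⇒≱ (short Y) (≤-trans h (≤-trans (≤-reflexive (sym (trans (+-identityʳ _) (trans
            (length-++ J) (+-identityʳ _)))))
            (Assemble.assemble Y U (en Y) ((b₁ , b₂) ∷ (b₃ , b₄) ∷ []) p [] (pair-window pre (b₃ ∷ b₄ ∷ b₅ ∷ b₆ ∷ post) at ∷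
              pair-window (pre ++ b₁ ∷ b₂ ∷ []) (b₅ ∷ b₆ ∷ post) (trans at (sym (++-assoc pre _ _))) ∷ []) refl
              (λ a → subst (λ x → cnt a ys + (cnt a (Ω Y) + (x + (cnt a zs + cnt a (P Y)))) ≤ 1) (sym (cnt-++ a J []))
                       (reserved-count (cnt a J) (cnt a (Ω Y)) (cnt a ys) (cnt a zs) (cnt a (P Y))
                         (≤-trans (≤-reflexive (sym (trans (cnt-++ a J _) (cong (cnt a J +_) (trans (cnt-++ a (Ω Y)
                             (ys ++ zs ++ P Y)) (cong (cnt a (Ω Y) +_)
                            (trans (cnt-++ a ys (zs ++ P Y)) (cong (cnt a ys +_) (cnt-++ a zs (P Y))))))))))
                           (all-dist a))))
              (λ v i → Q-range X v (Reserved.Ω⊆Q R v i))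
              (λ v i → let q , le , _ = ∈els _ t (∈-cnt≤ J≤ ([ (λ j → j) , (λ ()) ]′ (∈-++⁻ J i))) in q , le))))
          where p : Piece
                p = record { xs = J ; seg = sg ; hd∈U = J-free u (seg-first∈ sg) ; lst∈U = J-free v (seg-last∈ sg) }
      conclude : (∃ λ xs → ∃ λ ys → Chain true xs × Chain false ys × (∀ a → cnt a xs + cnt a ys ≤ cnt a us) ×
          length us ≤ length xs + length ys) → ⊥
      conclude (xs , ys , cx , cy , m , l) = decide (lem (160 * r ≤ length xs))
        where
        decide : (160 * r ≤ length xs) ⊎ ¬ (160 * r ≤ length xs) → ⊥
        decide (inj₁ h) = too-long true xs (λ a → ≤-trans (m≤m+n _ _) (m a)) cx h
        decide (inj₂ n) = too-long false ys (λ a → ≤-trans (m≤n+m _ _) (m a)) cy (half-large (length xs) (length ys)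
            (length us) r us-long l (≰⇒> n))

    not-both-short : (∀ Y → length (Q Y) < 160 * r) → ⊥
    not-both-short short = Short.conclude short Re en (two-paths true false (E? true) (Short.us short Re en))
      where
      Re : ∀ Y → Reserved (not Y)
      Re Y = reserved (not Y)
      en : ∀ Y → Ends Y (Free (not Y) (Reserved.Ω (Re Y))) (Reserved.Ω (Re Y))
      en Y = ends Y (not Y) (Reserved.Ω (Re Y)) ≤-refl (Reserved.Ω> (Re Y))

    split-list : ∀ {A : Set} j (xs : List A) → j ≤ length xs → ∃ λ as → ∃ λ bs → xs ≡ as ++ bs × length as ≡ j
    split-list zero xs _ = [] , xs , refl , refl
    split-list (suc j) (x ∷ xs) (s≤s h) with split-list j xs h
    ... | as , bs , e , l = x ∷ as , bs , cong (x ∷_) e , cong suc l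

    half : ∀ n → ∃ λ h → 2 * h ≤ n × n ≤ 2 * h + 1
    half zero = 0 , z≤n , z≤n
    half (suc zero) = 0 , z≤n , s≤s z≤n
    half (suc (suc n)) with half n
    ... | h , a , b = suc h , ≤-trans (≤-reflexive (*-suc 2 h)) (s≤s (s≤s a)) , ≤-trans (s≤s (s≤s b)) (≤-reflexive (cong (_+ 1) (sym
        (*-suc 2 h))))

    -- `H` hits at most 3r + 11 blocks. A path of 160r vertices therefore keeps enough blocks for
    -- the triples, at most 13r of them, and for more than 26r windows besides.
    module Longer (Y : Bool) (big : 160 * r ≤ length (Q (not Y))) (larger : length (Q Y) ≤ length (Q (not Y)))
                  (en : Ends Y (Free (not Y) []) []) where
      X = not Y
      m = length (Q X)
      U = Free X []
      open Ends en
      open Merge Y U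
      open Quads X Y (dich Y) U
      open Maximal X Y (dich Y) (V X) (maximal X) U (free⇒U X [])
      H = ys ++ zs ++ P Y
      us = els (λ v → U v × v ∉ H) t
      H-wt : wt t H ≤ 2 * r + (11 + length (P Y))
      H-wt = ≤-trans (≤-reflexive (trans (wt-++ t ys _) (cong (wt t ys +_) (wt-++ t zs _)))) (+-mono-≤ ys-wt (+-mono-≤ zs-wt
          (wt≤length t (P Y))))
      us-size : t ≤ length us + m + 7 * r + 15
      us-size = outside-large t (length us) (# U t) r T m (length (P X)) (length (P Y)) (free-size X [] z≤n) (≤-trans
          (outside-size H U) (+-monoʳ-≤ (length us) H-wt))
                  (<⇒≤ T<r) (P≤r X) (P≤r Y)
      us-U : ∀ u → u ∈ us → U u
      us-U u i = proj₁ (proj₂ (proj₂ (∈els _ t i)))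
      singles : ∀ xs → (∀ u → u ∈ xs → U u) → ∃ λ ps → flat ps ≡ xs × length ps ≡ length xs
      singles [] _ = [] , refl , refl
      singles (u ∷ xs) h with singles xs (λ v i → h v (there i))
      ... | ps , e , l = record { xs = u ∷ [] ; seg = single ; hd∈U = h u (here refl) ; lst∈U = h u (here refl) } ∷ ps , cong
          (u ∷_) e , cong suc l
      flat-++ : ∀ ps qs → flat (ps ++ qs) ≡ flat ps ++ flat qs
      flat-++ [] qs = refl
      flat-++ (p ∷ ps) qs = trans (cong (Piece.xs p ++_) (flat-++ ps qs)) (sym (++-assoc (Piece.xs p) _ _))
      flat₆-++ : ∀ (ps qs : List (Block (Q X) H)) → flat₆ (ps ++ qs) ≡ flat₆ ps ++ flat₆ qs
      flat₆-++ [] qs = refl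
      flat₆-++ (p ∷ ps) qs = trans (cong (Block.six p ++_) (flat₆-++ ps qs)) (sym (++-assoc (Block.six p) (flat₆ ps) (flat₆ qs)))

      hits-few : sum (_∈ H) (Q X) ≤ 2 * r + (11 + length (P Y))
      hits-few = ≤-trans (sum≤# {_∈ H} t (Q X) (Q-dist X) (Q-range X)) (≤-trans (#-∈≤wt t H) H-wt)

      module Compare (x : ℕ) (as cs : List (Block (Q X) H)) (as-len : length as ≡ x)
          (bs-cnt : ∀ a → cnt a (flat₆ (as ++ cs)) ≤ cnt a (Q X))
          (bs-many′ : m ≤ 6 * (x + length cs) + 18 * r + 71)
          (S : Sorted (26 * r) us) (2x≤ : 2 * x ≤ length (Sorted.quads S)) (≤2x : length (Sorted.quads S) ≤ 2 * x + 1)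
          (sg : ℕ) (sg≡ : 1 + (length (Sorted.pairs S) + 2 * x) + sg ≡ 3 * length cs)
          (sgl : List ℕ) (sgl-len : length sgl ≡ sg) (sgl-rest : ∀ a → cnt a sgl ≤ cnt a (Sorted.rest S))
          (F : Fives {H} as (Sorted.quads S)) (sn : ∃ λ ps → flat ps ≡ sgl × length ps ≡ length sgl) where
        module S = Sorted S
        module F = Fives F
        i = length S.pairs
        j = length S.quads
        B = length cs
        all : List Piece
        all = S.pairs ++ F.pieces ++ proj₁ sn
        flat-all : flat all ≡ flat S.pairs ++ flat F.pieces ++ sgl
        flat-all = trans (flat-++ S.pairs _) (cong (flat S.pairs ++_) (trans (flat-++ F.pieces _) (cong (flat F.pieces ++_) (proj₁
            (proj₂ sn)))))
        all-len : length all ≡ i + (2 * x + sg)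
        all-len = trans (length-++ S.pairs) (cong (i +_) (trans (length-++ F.pieces) (cong₂ _+_ (trans F.number (cong (2 *_) as-len))
                    (trans (proj₂ (proj₂ sn)) sgl-len))))
        flat-len : length (flat all) ≡ 2 * i + (5 * (2 * x) + sg)
        flat-len = trans (cong length flat-all) (trans (length-++ (flat S.pairs)) (cong₂ _+_ S.pairs-len
                     (trans (length-++ (flat F.pieces)) (cong₂ _+_ (trans F.size (cong (λ y → 5 * (2 * y)) as-len)) sgl-len))))
        flat-cnt : ∀ a → cnt a (flat all) ≡ cnt a (flat S.pairs) + (cnt a (flat F.pieces) + cnt a sgl)
        flat-cnt a = trans (cong (cnt a) flat-all) (trans (cnt-++ a (flat S.pairs) (flat F.pieces ++ sgl)) (cong (cnt a
            (flat S.pairs) +_) (cnt-++ a (flat F.pieces) sgl)))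
        flat₆-avoids : ∀ (bs : List (Block (Q X) H)) v → v ∈ flat₆ bs → v ∉ H
        flat₆-avoids (b ∷ bs) v i = [ Block.avoids b v , flat₆-avoids bs v ]′ (∈-++⁻ (Block.six b) i)
        all-dist : Dist (us ++ flat₆ (as ++ cs) ++ H)
        all-dist = dist-++ {us} {flat₆ (as ++ cs) ++ H} (els-dist _ t)
          (dist-++ {flat₆ (as ++ cs)} {H} (λ a → ≤-trans (bs-cnt a) (Q-dist X a)) distinct (flat₆-avoids (as ++ cs)))
          (λ a i j → [ (λ l → proj₁ (proj₂ (proj₂ (us-U a i))) (Q⊆whole X a (∈-cnt≤ bs-cnt l))) , proj₂ (proj₂ (proj₂
              (∈els _ t i))) ]′ (∈-++⁻ (flat₆ (as ++ cs)) j))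
        total : ∀ a → cnt a us + ((cnt a (flat₆ as) + cnt a (flat₆ cs)) + (cnt a ys + (cnt a zs + cnt a (P Y)))) ≤ 1
        total a = ≤-trans (≤-reflexive (sym (trans (cnt-++ a us (flat₆ (as ++ cs) ++ H)) (cong (cnt a us +_) (trans (cnt-++ a (flat₆
            (as ++ cs)) H) (cong₂ _+_
                    (trans (cong (cnt a) (flat₆-++ as cs)) (cnt-++ a (flat₆ as) (flat₆ cs)))
                    (trans (cnt-++ a ys (zs ++ P Y)) (cong (cnt a ys +_) (cnt-++ a zs (P Y)))))))))) (all-dist a)
        good-dist : ∀ a → cnt a ys + (cnt a (flat₂ (windows cs)) + (cnt a (flat all) + (cnt a zs + cnt a (P Y)))) ≤ 1
        good-dist a = subst₂ (λ y z → cnt a ys + (y + (z + (cnt a zs + cnt a (P Y)))) ≤ 1) (sym (cong (cnt a) (windows-flat cs)))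
            (sym (flat-cnt a))
          (total-count (cnt a ys) (cnt a zs) (cnt a (P Y)) (cnt a us) (cnt a (flat F.pieces)) (cnt a (flat₆ as)) (cnt a
              (flat₄ S.quads)) (cnt a (flat S.pairs))
             (cnt a S.rest) (cnt a (flat₆ cs)) (cnt a sgl) (F.cnts a) (S.cnts a) (sgl-rest a) (total a))
        flat₆⊆ : ∀ v → v ∈ flat₆ (as ++ cs) → 1 ≤ v × v ≤ t
        flat₆⊆ v i = Q-range X v (∈-cnt≤ bs-cnt i)
        from : ∀ v → v ∈ flat₆ as ++ flat₆ cs → v ∈ flat₆ (as ++ cs)
        from v i = subst (v ∈_) (sym (flat₆-++ as cs)) i
        win-range : ∀ v → v ∈ flat₂ (windows cs) → 1 ≤ v × v ≤ t
        win-range v i = flat₆⊆ v (from v (∈-++⁺ʳ (flat₆ as) (subst (v ∈_) (windows-flat cs) i)))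
        us-range : ∀ v → v ∈ us → 1 ≤ v × v ≤ t
        us-range v i = let p , le , _ = ∈els _ t i in p , le
        all-range : ∀ v → v ∈ flat all → 1 ≤ v × v ≤ t
        all-range v i = [ us-range v , (λ l → flat₆⊆ v (from v (∈-++⁺ˡ l))) ]′ (∈-++⁻ us (∈-cnt≤ bnd i))
          where bnd : ∀ a → cnt a (flat all) ≤ cnt a (us ++ flat₆ as)
                bnd a = ≤-trans (≤-reflexive (flat-cnt a)) (≤-trans (pieces-count (cnt a (flat S.pairs)) (cnt a (flat F.pieces))
                    (cnt a sgl) (cnt a (flat₄ S.quads))
                          (cnt a (flat₆ as)) (cnt a S.rest) (cnt a us) (F.cnts a) (S.cnts a) (sgl-rest a)) (≤-reflexive (sym
                              (cnt-++ a us (flat₆ as)))))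

        path-too-long : ⊥
        path-too-long = go all refl
          where
          len≡ : suc (length all) ≡ 3 * B
          len≡ = trans (cong suc all-len) (trans (cong suc (sym (+-assoc i (2 * x) sg))) sg≡)
          go : ∀ qs → all ≡ qs → ⊥
          go [] e = 1+n≰n (≤-trans (s≤s z≤n) (none (length all) B (cong length e) len≡))
            where none : ∀ n B → n ≡ 0 → suc n ≡ 3 * B → 1 ≤ 0
                  none n zero _ ()
                  none .0 (suc B) refl e with trans e (*-suc 3 B)
                  ... | ()
          go (p ∷ ps) e = total-too-long m B r j i x sg (length (flat all)) (length ps) bs-many′ (≤-reflexive (sym S.number)) ≤2x
              (≤-reflexive (trans (sym sg≡) (+-comm _ sg))) (≤-reflexive (sym flat-len)) (≤-reflexive (trans (sym all-len) (cong length e)))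
              (≤-trans (subst (λ l → length (flat l) + length ps ≤ length (Q Y)) (sym e)
                 (Assemble.assemble Y U en (windows cs) p ps (windows-ok cs)
                   (trans (windows-length cs) (trans (sym len≡) (cong (λ l → suc (length l)) e)))
                   (λ a → subst (λ l → cnt a ys + (cnt a (flat₂ (windows cs)) + (cnt a (flat l) + (cnt a zs + cnt a
                       (P Y)))) ≤ 1) e (good-dist a))
                   win-range (λ v i → all-range v (subst (λ l → v ∈ flat l) (sym e) i)))) larger) 1000≤r

      module Sort (S : Sorted (26 * r) us) (bs : List (Block (Q X) H)) (bs-cnt : ∀ a → cnt a (flat₆ bs) ≤ cnt a (Q X))
          (bs-many : m ≤ 6 * length bs + 18 * r + 71) (bs-few : 6 * length bs ≤ m) (x : ℕ)
          (2x≤ : 2 * x ≤ length (Sorted.quads S)) (≤2x : length (Sorted.quads S) ≤ 2 * x + 1) where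
        module S = Sorted S
        i = length S.pairs
        j = length S.quads

        with-split : ∀ as cs → bs ≡ as ++ cs → length as ≡ x → ⊥
        -- Single vertices fill up the pieces until there is exactly one fewer than the 3B windows,
        -- as `merge` demands.
        with-split as cs refl as-len = fill (m≤n⇒∃[o]m+o≡n (windows-enough m B r j i x many big (≤-reflexive S.number) 2x≤ 1000≤r))
          where
          B = length cs
          len : length (as ++ cs) ≡ x + B
          len = trans (length-++ as) (cong (_+ B) as-len)
          many : m ≤ 6 * (x + B) + 18 * r + 71
          many = subst (λ y → m ≤ 6 * y + 18 * r + 71) len bs-many
          fill : (∃ λ sg → 1 + (i + 2 * x) + sg ≡ 3 * B) → ⊥
          fill (sg , sg≡) = take-singles (shorten {Y} sg S.rest sg≤)
            where
            sg≤ : sg ≤ length S.rest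
            sg≤ = singles-fit t (length us) r m (length S.rest) sg B x i us-size (gap X) 1000≤r (≤-reflexive S.rest-len)
                    (subst (λ y → 6 * y ≤ m) len bs-few) (≤-reflexive (trans (+-comm sg _) sg≡))
            take-singles : (∃ λ sgl → length sgl ≡ sg × (∀ a → cnt a sgl ≤ cnt a S.rest)) → ⊥
            take-singles (sgl , sgl-len , sgl-rest) = Compare.path-too-long x as cs as-len bs-cnt many S 2x≤ ≤2x sg sg≡ sgl sgl-len sgl-rest
              (fives {H} as S.quads (≤-trans (≤-reflexive (cong (2 *_) as-len)) 2x≤))
              (singles sgl (λ u i → us-U u (∈-cnt≤ (λ a → ≤-trans (sgl-rest a)
                 (≤-trans (≤-trans (m≤n+m _ (cnt a (flat₄ S.quads))) (m≤n+m _ (cnt a (flat S.pairs)))) (S.cnts a))) i)))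

        result : ⊥
        result = let as , cs , e , l = split-list x bs (blocks-enough m (length bs) r j i x bs-many big (≤-reflexive S.number) 2x≤ 1000≤r) in with-split as cs e l

      impossible : ⊥
      impossible = go (blocks {Q X} {H} [] (Q X) refl) (sort (26 * r) us (quads-fit t (length us) r m us-size
          (gap X) 1000≤r) us-U (els-dist _ t))
        where
        go : (∃ λ (bs : List (Block (Q X) H)) → (∀ a → cnt a (flat₆ bs) ≤ cnt a (Q X)) ×
                length (Q X) ≤ 6 * length bs + 6 * sum (_∈ H) (Q X) + 5 × 6 * length bs ≤ length (Q X)) → Sorted (26 * r) us → ⊥
        go (bs , cn , many , few) S = let x , a , b = half (length (Sorted.quads S)) in
          Sort.result S bs cn (blocks-many m (length bs) (sum (_∈ H) (Q X)) r (length (P Y)) many hits-few (P≤r Y)) few x a b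

    longer-path : ∀ Y → 160 * r ≤ length (Q (not Y)) → length (Q Y) ≤ length (Q (not Y)) → ⊥
    longer-path Y big larger = Longer.impossible Y big larger (ends Y (not Y) [] z≤n (λ v ()))

    absurd : ⊥
    absurd = by-size (lem _) (lem _) (≤-total (length (Q true)) (length (Q false)))
      where
      Small : Bool → Set
      Small Y = length (Q Y) < 160 * r
      by-size : Small true ⊎ ¬ Small true → Small false ⊎ ¬ Small false → length (Q true) ≤ length (Q false) ⊎ length (Q false) ≤ length
          (Q true) → ⊥
      by-size (inj₁ a) (inj₁ b) _ = not-both-short (λ { true → a ; false → b })
      by-size (inj₂ a) _ (inj₂ le) = longer-path false (≮⇒≥ a) le
      by-size (inj₂ a) _ (inj₁ le) = longer-path true (≤-trans (≮⇒≥ a) le) le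
      by-size (inj₁ a) (inj₂ b) (inj₁ le) = longer-path true (≮⇒≥ b) le
      by-size (inj₁ a) (inj₂ b) (inj₂ le) = longer-path false (≤-trans (≮⇒≥ b) le) le

  -- Choice of the scales

  end-of : ∀ {Y P} → Good Y P → ℕ
  end-of g = end (Good.isSeg g)

  seg-nonempty : ∀ {Y u v xs} → Seg Y u v xs → xs ≢ []
  seg-nonempty single ()
  seg-nonempty (cons _ _) ()

  module Blocked (k N : ℕ) (10≤k : 10 ≤ k) (P : Bool → List ℕ) (g : ∀ Y → Good Y (P Y))
    (blocked : ∀ Y Z M n → N ≤ n → Good Y (Z ++ M ++ P Y) → (∀ v → v ∈ M ++ P Y → v ≤ n) →
               3 * k * length (M ++ P Y) + 3 * n ≤ 2 * k * n) where

    module At (T n₂ r t : ℕ) (t≡ : t ≡ suc (80 * k) * r)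
      (rd : ∀ Y → Ready Y (P Y) (end-of (g Y)) T) (P≤T : ∀ Y v → v ∈ P Y → v ≤ T)
      (P-len : ∀ Y → 2 * length (P Y) + 3 * (80 * k + 15) ≤ T)
      (T≤n₂ : T ≤ n₂) (thr : ∀ Y → threshold Y (range T) ≤ n₂) (n₂<r : n₂ < r) (1000≤r : 1000 ≤ r) (N≤r : N ≤ r)
      (W : Bool → List ℕ) (W-len : ∀ Y → length (W Y) ≡ 6 * n₂ + 12) (W≤r : ∀ Y v → v ∈ W Y → v ≤ r)
      (g* : ∀ Y → Good Y (W Y ++ P Y)) (m* : Bool → ℕ) (rd* : ∀ Y → Ready Y (W Y ++ P Y) (end-of (g* Y)) (m* Y))
      (m*<r : ∀ Y → m* Y < r) (len* : ∀ Y → 2 * length (W Y ++ P Y) + 3 * (80 * k) ≤ m* Y) where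

      s = 80 * k

      T<r : T < r
      T<r = ≤-trans (s≤s T≤n₂) n₂<r

      r≤t : r ≤ t
      r≤t = ≤-trans (m≤m+n r (s * r)) (≤-reflexive (sym t≡))

      -- The prescribed extension `W` has 6n₂ + 12 vertices, so a longest admissible path is long
      -- enough to contain a block beyond `n₂`.
      start-valid : ∀ Y → Valid Y (P Y) t (2 * r) (W Y)
      start-valid Y = build (base {Y} {W Y ++ P Y} {end-of (g* Y)} {m* Y} {t} {s} {2 * r} (rd* Y) (≤-trans (<⇒≤ (m*<r Y)) r≤t) (len* Y)
          (subst (λ x → x + suc s * m* Y < suc s * (2 * r)) (sym t≡)
              (≤-trans (≤-reflexive (cong suc (sym (*-distribˡ-+ (suc s) r (m* Y)))))
                 (*-monoʳ-< (suc s) (+-monoʳ-< r (≤-trans (m*<r Y) (≤-reflexive (sym (+-identityʳ r)))))))))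
        where
        sg = Good.isSeg (g* Y)
        L = W Y ++ P Y
        build : AdjK Y t (end sg) ⊎ (∃ λ zs → ∃ λ z → ∃ λ q → Seg Y z q zs × AdjK Y t z × E Y (end sg) q × Dist zs ×
                 (∀ w → w ∈ zs → Out L w × ¬ K Y t w) × wt t zs ≤ 2 * r) → Valid Y (P Y) t (2 * r) (W Y)
        build (inj₁ (κ , kk , e)) = record { Z = [] ; link = cons (E-sym e) (seg sg) ; κ∈K = kk ; distinct = dist sg ; positive = pos sg
          ; Q≤ = λ v i → ≤-trans (W≤r Y v i) r≤t ; Z∉K = λ v () ; wtZ = z≤n }
        build (inj₂ (zs , z , q , s′ , (κ , kk , e) , eq , d , o , w)) = record { Z = zs
          ; link = cons (E-sym e) (join s′ (E-sym eq) (seg sg)) ; κ∈K = kk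
          ; distinct = dist-++ {zs} {L} d (dist sg) (λ a i j → proj₂ (proj₁ (o a i)) j)
          ; positive = λ v i → [ (λ j → proj₁ (proj₁ (o v j))) , pos sg v ]′ (∈-++⁻ zs i)
          ; Q≤ = λ v i → ≤-trans (W≤r Y v i) r≤t ; Z∉K = λ v i → proj₂ (o v i) ; wtZ = w }

      valid-length : ∀ Y Q → Valid Y (P Y) t (2 * r) Q → length Q ≤ t
      valid-length Y Q V = ≤-trans (length≤# {λ _ → ℕ} t Q
          (λ a → ≤-trans (≤-trans (m≤m+n _ _) (≤-trans (≤-reflexive (sym (cnt-++ a Q (P Y)))) (m≤n+m _ (cnt a Z)))) (≤-trans
              (≤-reflexive (sym (cnt-++ a Z _))) (distinct a)))
          (λ v i → positive v (∈-++⁺ʳ Z (∈-++⁺ˡ i)) , Q≤ v i , 0)) (#≤ _ t)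
        where open Valid V

      -- By `valid⇒good` every admissible path is a candidate for an extension at time `t`; being
      -- blocked, it misses density 2/3 by at least 1/k.
      gap-of : ∀ Y Q → Valid Y (P Y) t (2 * r) Q → 3 * length Q + 240 * r ≤ 2 * t
      gap-of Y Q V = *-cancelˡ-≤ k ⦃ >-nonZero (≤-trans (s≤s z≤n) 10≤k) ⦄
          (gap-scaled k (length Q) (length (P Y)) t r (subst (λ x → 3 * k * x + 3 * t ≤ 2 * k * t) (length-++ Q) bl) (≤-reflexive (sym t≡)))
        where
        P≤t : ∀ v → v ∈ P Y → v ≤ t
        P≤t v i = ≤-trans (P≤T Y v i) (≤-trans (<⇒≤ T<r) r≤t)
        vg = valid⇒good V (seg-nonempty (seg (Good.isSeg (g Y)))) P≤t
        bl : 3 * k * length (Q ++ P Y) + 3 * t ≤ 2 * k * t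
        bl = blocked Y (proj₁ vg) Q t (≤-trans N≤r r≤t) (proj₂ vg) (λ v i → [ Valid.Q≤ V v , P≤t v ]′ (∈-++⁻ Q i))

      best : ∀ Y → ∃ λ Q → Valid Y (P Y) t (2 * r) Q × (∀ Q′ → Valid Y (P Y) t (2 * r) Q′ → length Q′ ≤ length Q)
      best Y = pick-best (max-exists (λ m → ∃ λ Q → Valid Y (P Y) t (2 * r) Q × length Q ≡ m) t (length (W Y)) (W Y , start-valid Y , refl)
                   (λ { m (Q , V , refl) → valid-length Y Q V }))
        where
        pick-best : (∃ λ n → (∃ λ Q → Valid Y (P Y) t (2 * r) Q × length Q ≡ n) × (∀ m → (∃ λ Q → Valid Y (P Y) t (2 * r) Q ×
            length Q ≡ m) → m ≤ n)) →
                    ∃ λ Q → Valid Y (P Y) t (2 * r) Q × (∀ Q′ → Valid Y (P Y) t (2 * r) Q′ → length Q′ ≤ length Q)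
        pick-best (n , (Q , V , refl) , mx) = Q , V , λ Q′ V′ → mx (length Q′) (Q′ , V′ , refl)

      impossible : ⊥
      impossible = Core.absurd k r s t T n₂ t≡ t≡ 10≤k 1000≤r T<r n₂<r T≤n₂ P g rd P≤T P-len thr (λ Y → proj₁ (best Y)) (λ Y → proj₁
          (proj₂ (best Y)))
        (λ Y → proj₂ (proj₂ (best Y))) (λ Y → gap-of Y _ (proj₁ (proj₂ (best Y))))
        (λ Y → ≤-trans (≤-reflexive (sym (W-len Y))) (proj₂ (proj₂ (best Y)) (W Y) (start-valid Y)))

    both : (Bool → ℕ) → ℕ
    both f = f true + f false

    ≤both : ∀ f Y → f Y ≤ both f
    ≤both f true = m≤m+n _ _
    ≤both f false = m≤n+m _ (f true)

    abstract
      need : Bool → ℕ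
      need Y = proj₁ (ready (g Y)) + (bound (P Y) + (2 * length (P Y) + 3 * (80 * k + 15)))

      T₀ : ℕ
      T₀ = both need

      T₀-ready : ∀ Y → proj₁ (ready (g Y)) ≤ T₀
      T₀-ready Y = ≤-trans (m≤m+n (proj₁ (ready (g Y))) _) (≤both need Y)

      T₀-bound : ∀ Y → bound (P Y) ≤ T₀
      T₀-bound Y = ≤-trans (≤-trans (m≤m+n (bound (P Y)) _) (m≤n+m _ (proj₁ (ready (g Y))))) (≤both need Y)

      T₀-len : ∀ Y → 2 * length (P Y) + 3 * (80 * k + 15) ≤ T₀
      T₀-len Y = ≤-trans (≤-trans (m≤n+m _ (bound (P Y))) (m≤n+m _ (proj₁ (ready (g Y))))) (≤both need Y)

      N₂ : ℕ
      N₂ = T₀ + both (λ Y → threshold Y (range T₀))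

      T₀≤N₂ : T₀ ≤ N₂
      T₀≤N₂ = m≤m+n _ _

      N₂-thr : ∀ Y → threshold Y (range T₀) ≤ N₂
      N₂-thr Y = ≤-trans (≤both (λ Y → threshold Y (range T₀)) Y) (m≤n+m _ T₀)

      extended : ∀ Y → ∃ λ W → length W ≡ 6 * N₂ + 12 × Good Y (W ++ P Y)
      extended Y = good-extend* (6 * N₂ + 12) (g Y)

    W₀ : Bool → List ℕ
    W₀ Y = proj₁ (extended Y)

    g₀ : ∀ Y → Good Y (W₀ Y ++ P Y)
    g₀ Y = proj₂ (proj₂ (extended Y))

    abstract
      m₀ : Bool → ℕ
      m₀ Y = proj₁ (ready (g₀ Y)) + (2 * length (W₀ Y ++ P Y) + 3 * (80 * k))

      m₀-ready : ∀ Y → proj₁ (ready (g₀ Y)) ≤ m₀ Y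
      m₀-ready Y = m≤m+n _ _

      m₀-len : ∀ Y → 2 * length (W₀ Y ++ P Y) + 3 * (80 * k) ≤ m₀ Y
      m₀-len Y = m≤n+m _ (proj₁ (ready (g₀ Y)))

      R₀ : ℕ
      -- The scale `r` comes last: `T₀` depends on the given paths, `N₂` on `T₀`, the extensions on
      -- `N₂`, and `m₀` on the extensions.
      R₀ = 1000 + (N + (suc N₂ + both (λ Y → suc (m₀ Y) + bound (W₀ Y))))

      1000≤R₀ : 1000 ≤ R₀
      1000≤R₀ = m≤m+n 1000 _

      N≤R₀ : N ≤ R₀
      N≤R₀ = ≤-trans (m≤m+n N _) (m≤n+m _ 1000)

      N₂<R₀ : N₂ < R₀
      N₂<R₀ = ≤-trans (≤-trans (m≤m+n (suc N₂) _) (m≤n+m _ N)) (m≤n+m _ 1000)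

      rest≤R₀ : ∀ Y → suc (m₀ Y) + bound (W₀ Y) ≤ R₀
      rest≤R₀ Y = ≤-trans (≤-trans (≤-trans (≤both (λ Y → suc (m₀ Y) + bound (W₀ Y)) Y) (m≤n+m _ (suc N₂))) (m≤n+m _ N)) (m≤n+m _ 1000)

    contradictory : ⊥
    contradictory = At.impossible T₀ N₂ R₀ (suc (80 * k) * R₀) refl
      (λ Y → proj₂ (ready (g Y)) T₀ (T₀-ready Y)) (λ Y v i → ≤-trans (∈bound (P Y) i) (T₀-bound Y)) T₀-len
      T₀≤N₂ N₂-thr N₂<R₀ 1000≤R₀ N≤R₀ W₀ (λ Y → proj₁ (proj₂ (extended Y)))
      (λ Y v i → ≤-trans (∈bound (W₀ Y) i) (≤-trans (m≤n+m _ (suc (m₀ Y))) (rest≤R₀ Y)))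
      g₀ m₀ (λ Y → proj₂ (ready (g₀ Y)) (m₀ Y) (m₀-ready Y)) (λ Y → ≤-trans (m≤m+n _ _) (rest≤R₀ Y)) m₀-len

  -- Two failures exclude each other

  record Failure (Y : Bool) : Set where
    field
      {P} : List ℕ
      good : Good Y P
      N k : ℕ
      1≤k : 1 ≤ k
      fails : ¬ Extends (Good Y) P N k

  no-two-failures : (∀ Y → Failure Y) → ⊥
  no-two-failures f = Blocked.contradictory k N (m≤n+m 10 _) (λ Y → F.P Y) (λ Y → F.good Y) blocked
    where
    module F (Y : Bool) = Failure (f Y)
    -- By `dense-mono` a failure persists when k grows, so both colours can share one k; the summand
    -- 10 provides t ≥ 801r.
    k = F.k true + F.k false + 10
    N = F.N true + F.N false
    k≤ : ∀ Y → F.k Y ≤ k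
    k≤ true = ≤-trans (m≤m+n _ _) (m≤m+n _ 10)
    k≤ false = ≤-trans (m≤n+m _ (F.k true)) (m≤m+n _ 10)
    N≤ : ∀ Y → F.N Y ≤ N
    N≤ true = m≤m+n _ _
    N≤ false = m≤n+m _ (F.N true)
    blocked : ∀ Y Z M n → N ≤ n → Good Y (Z ++ M ++ F.P Y) → (∀ v → v ∈ M ++ F.P Y → v ≤ n) →
              3 * k * length (M ++ F.P Y) + 3 * n ≤ 2 * k * n
    blocked Y Z M n h gd b = ≮⇒≥ λ lt → F.fails Y (Z , M , n , ≤-trans (N≤ Y) h , gd , b ,
      dense-mono (F.k Y) k n (length (M ++ F.P Y)) (F.1≤k Y) (k≤ Y) lt)

  Wins : Bool → Set
  Wins Y = ∀ P → Good Y P → ∀ N k → 1 ≤ k → Extends (Good Y) P N k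

  failure : ∀ {Y} → ¬ Wins Y → Failure Y
  failure h = dne λ none → h λ P g N k 1≤k → dne λ ne → none (record { good = g ; N = N ; k = k ; 1≤k = 1≤k ; fails = ne })

  wins⇒dense : ∀ {Y} → Wins Y → Dense Y
  wins⇒dense {Y} w = Limit.dense {Y} (Good Y) (λ P → Good.isSeg) w (proj₁ (good-initial {Y})) (proj₂ (good-initial {Y}))

  some-dense : ∃ λ Y → Dense Y
  some-dense = decide (lem (Wins true)) (lem (Wins false))
    where
    decide : Wins true ⊎ ¬ Wins true → Wins false ⊎ ¬ Wins false → ∃ λ Y → Dense Y
    decide (inj₁ w) _ = true , wins⇒dense w
    decide (inj₂ _) (inj₁ w) = false , wins⇒dense w
    decide (inj₂ a) (inj₂ b) = ⊥-elim (no-two-failures λ { true → failure a ; false → failure b })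

theorem1p7 : ExcludedMiddle 0ℓ → (c : Colouring) →
    Σ Bool λ b → Σ (ℕ → ℕ) λ a → IsMonoPath c b a × StrongUpperDensity≥ a 2 3
theorem1p7 em c = decide (Colours.dense⊎star em c true) (Colours.dense⊎star em c false)
  where
  decide : Colours.Dense em c true ⊎ Colours.Star em c false → Colours.Dense em c false ⊎ Colours.Star em c true → Σ Bool
      (Colours.Dense em c)
  decide (inj₁ d) _ = true , d
  decide (inj₂ _) (inj₁ d) = false , d
  -- The colours cross over: failure of `true` gives the star property of `false`, and conversely.
  decide (inj₂ s) (inj₂ s′) = Robust.some-dense em c (λ { true → s′ ; false → s })
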